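{- Let $t_n$ be the total number of grand knight's paths of size $n$ ending at a non-negative altitude. Then $$\sum_{n\ge 0}t_nz^n=\frac{h_0u_1u_2-h_1}{(1-u_1)(1-u_2)},$$ where $$u_1=\frac{ -z^2+\sqrt{z^4+8z^2+4z}}{4z}+\frac{1}{2\sqrt2}\sqrt{\frac{z^3-z\sqrt{z^4+8z^2+4z}-4z+2}{z}},$$ $$u_2=\frac{ -z^2-\sqrt{z^4+8z^2+4z}}{4z}-\frac{1}{2\sqrt2}\sqrt{\frac{z^3+z\sqrt{z^4+8z^2+4z}-4z+2}{z}},$$ $$h_0=\frac{1+u_1u_2}{1+u_1u_2-2z^2(u_1+u_2)-2z+2z(1-u_1^2-u_2^2)u_1^{ -1}u_2^{ -1}},\qquad h_1=\frac{u_1+u_2}{1+u_1u_2}\,h_0 .$$ Moreover, as $n\to\infty$, $$t_n\sim\frac{\sqrt3}{12}\left(1+\sqrt3\right)^{n+1}.$$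
   Context: A grand knight's path is a lattice path in $\mathbb{Z}^2$ that starts at the origin and consists of steps $N=(1,2)$, $\bar N=(1,-2)$, $E=(2,1)$, $\bar E=(2,-1)$ (the empty path is allowed). Its size is the $x$-coordinate of its last point and its altitude is the $y$-coordinate of its last point. The functions $u_1,u_2$ are understood as (Laurent) series in $z^{1/2}$ near $z=0$, with the branches of the square roots given by principal values for small $z>0$ (so $u_1\sim z^{ -1/2}$, $u_2\sim -z^{ -1/2}$). The notation $a_n\sim b_n$ means $a_n/b_n\to1$. -}

module Defs where

open import Algebra.Bundles.Raw using (RawRing)
import Algebra.Definitions.RawMonoid as RawMonoidOps
import Algebra.Definitions.RawSemiring as RawSemiringOps
open import Data.Fin.Base using (Fin; toℕ)
open import Data.Integer.Base as ℤ using (ℤ; +_; -[1+_]; 0ℤ)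
open import Data.List.Base using (List; []; _∷_)
open import Data.Nat.Base as ℕ using (ℕ; zero; suc; _∸_)
open import Data.Product.Base using (Σ; ∃; _×_; _,_; proj₁; proj₂)
open import Data.Rational.Base as ℚ using (ℚ; 0ℚ; 1ℚ)
open import Data.Sum.Base using (_⊎_)
open import Level using (0ℓ)
open import Relation.Binary.PropositionalEquality.Core using (_≡_)

------------------------------------------------------------------------
-- Grand knight's paths

data Step : Set where
  N N̄ E Ē : Step

vector : Step → ℤ × ℤ
vector N = + 1 , + 2
vector N̄ = + 1 , ℤ.- (+ 2)
vector E = + 2 , + 1
vector Ē = + 2 , ℤ.- (+ 1)

endpoint : List Step → ℤ × ℤ
endpoint []      = 0ℤ , 0ℤ
endpoint (s ∷ p) = proj₁ (vector s) ℤ.+ proj₁ (endpoint p)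
                 , proj₂ (vector s) ℤ.+ proj₂ (endpoint p)

size altitude : List Step → ℤ
size     p = proj₁ (endpoint p)
altitude p = proj₂ (endpoint p)

NonNegativePath : ℕ → Set
NonNegativePath n =
  Σ (List Step) λ p → (size p ≡ + n) × (0ℤ ℤ.≤ altitude p)

------------------------------------------------------------------------
-- Derived operations of a ring

module RingOps (R : RawRing 0ℓ 0ℓ) where
  open RawRing R public
  open RawMonoidOps +-rawMonoid public using () renaming (_×_ to _·_)
  open RawSemiringOps rawSemiring public using (_^_)

  infixl 6 _-_
  _-_ : Carrier → Carrier → Carrier
  x - y = x + (- y)

  -- "q = x / y".  In an integral domain, and all uses below are in one,
  -- this determines q uniquely.
  infix 4 _≐_÷_
  _≐_÷_ : Carrier → Carrier → Carrier → Set
  q ≐ x ÷ y = (y ≉ 0#) × (q * y ≈ x)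

------------------------------------------------------------------------
-- The real quadratic field ℚ(√d), as a subfield of the reals.  It is used
-- only for d = 2 and d = 3, where √d is irrational.

infix 5 _+√_
record ℚ√ (d : ℕ) : Set where
  constructor _+√_
  field
    rat irr : ℚ

open ℚ√ public

fromℚ : ∀ {d} → ℚ → ℚ√ d
fromℚ p = p +√ 0ℚ

fromℕ : ∀ {d} → ℕ → ℚ√ d
fromℕ n = fromℚ (+ n ℚ./ 1)

ℚ√-rawRing : ℕ → RawRing 0ℓ 0ℓ
ℚ√-rawRing d = record
  { Carrier = ℚ√ d
  ; _≈_     = _≡_
  ; _+_     = λ x y → (rat x ℚ.+ rat y) +√ (irr x ℚ.+ irr y)
  ; _*_     = λ x y →
      (rat x ℚ.* rat y ℚ.+ (+ d ℚ./ 1) ℚ.* (irr x ℚ.* irr y))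
        +√ (rat x ℚ.* irr y ℚ.+ irr x ℚ.* rat y)
  ; -_      = λ x → (ℚ.- rat x) +√ (ℚ.- irr x)
  ; 0#      = fromℚ 0ℚ
  ; 1#      = fromℚ 1ℚ
  }

-- p + q√d > 0 in the order inherited from the reals: as √d is irrational,
-- one of p and q√d is strictly larger in absolute value unless both vanish,
-- and the larger one decides the sign.
Positive : ∀ {d} → ℚ√ d → Set
Positive {d} (p +√ q) =
    (0ℚ ℚ.< p × (+ d ℚ./ 1) ℚ.* (q ℚ.* q) ℚ.< p ℚ.* p)
  ⊎ (0ℚ ℚ.< q × p ℚ.* p ℚ.< (+ d ℚ./ 1) ℚ.* (q ℚ.* q))

module _ {d : ℕ} where
  open RingOps (ℚ√-rawRing d)

  infix 4 ∣_∣<_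
  ∣_∣<_ : ℚ√ d → ℚ√ d → Set
  ∣ x ∣< e = Positive (e - x) × Positive (e + x)

  -- aₙ / bₙ → 1; rational ε suffice.
  infix 4 _∼_
  _∼_ : (ℕ → ℚ√ d) → (ℕ → ℚ√ d) → Set
  a ∼ b = (ε : ℚ) → 0ℚ ℚ.< ε →
    ∃ λ n₀ → ∀ n → n₀ ℕ.≤ n →
    ∃ λ q → (q ≐ a n ÷ b n) × ∣ q - 1# ∣< fromℚ ε

------------------------------------------------------------------------
-- Formal Laurent series in one indeterminate w

module Laurent (K : RawRing 0ℓ 0ℓ) where
  private
    module K = RawRing K
  open RawMonoidOps K.+-rawMonoid using (sum)

  -- w^(- pole) · Σₙ coeff n · wⁿ; leading coefficients may vanish.
  record Series : Set where
    constructor mk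
    field
      pole  : ℕ
      coeff : ℕ → K.Carrier

  open Series public

  shift : ℕ → (ℕ → K.Carrier) → ℕ → K.Carrier
  shift zero    a n       = a n
  shift (suc k) a zero    = K.0#
  shift (suc k) a (suc n) = shift k a n

  infix 4 _≋_
  record _≋_ (x y : Series) : Set where
    constructor mk≋
    field
      coeff≈ : ∀ n → shift (pole y) (coeff x) n K.≈ shift (pole x) (coeff y) n

  open _≋_ public

  single : K.Carrier → ℕ → K.Carrier
  single c zero    = c
  single c (suc _) = K.0#

  -- The coefficient of w^k is c, all others vanish.
  monomial : K.Carrier → ℤ → Series
  monomial c (+ k)    = mk 0 (shift k (single c))
  monomial c -[1+ k ] = mk (suc k) (single c)

  constant : K.Carrier → Series
  constant c = monomial c 0ℤ

  rawRing : RawRing 0ℓ 0ℓ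
  rawRing = record
    { Carrier = Series
    ; _≈_     = _≋_
    ; _+_     = λ x y → mk (pole x ℕ.+ pole y) λ n →
        shift (pole y) (coeff x) n K.+ shift (pole x) (coeff y) n
    ; _*_     = λ x y → mk (pole x ℕ.+ pole y) λ n →
        sum λ (i : Fin (suc n)) → coeff x (toℕ i) K.* coeff y (n ∸ toℕ i)
    ; -_      = λ x → mk (pole x) λ n → K.- coeff x n
    ; 0#      = constant K.0#
    ; 1#      = constant K.1#
    }

------------------------------------------------------------------------
-- Laurent series in w = z^½ over ℚ(√2), the field containing 1 / (2√2)

open Laurent (ℚ√-rawRing 2) public
  using (Series; mk; pole; coeff; shift; _≋_; mk≋; coeff≈; single;
         monomial; constant)
  renaming (rawRing to series-rawRing)

-- x(w) > 0 for all small w > 0.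
LeadingPositive : Series → Set
LeadingPositive x = ∃ λ n →
  Positive (coeff x n) × (∀ m → m ℕ.< n → coeff x m ≡ fromℚ 0ℚ)

-- Note z = w², and 1 / (2√2) = √2 / 4.
z z⁻¹ ⟨4z⟩⁻¹ ⟨2√2⟩⁻¹ : Series
z        = monomial (fromℚ 1ℚ) (+ 2)
z⁻¹      = monomial (fromℚ 1ℚ) (ℤ.- (+ 2))
⟨4z⟩⁻¹   = monomial (fromℚ (+ 1 ℚ./ 4)) (ℤ.- (+ 2))
⟨2√2⟩⁻¹  = constant (0ℚ +√ (+ 1 ℚ./ 4))

interleaveZeros : (ℕ → ℕ) → ℕ → ℚ√ 2
interleaveZeros a zero          = fromℕ (a 0)
interleaveZeros a (suc zero)    = fromℚ 0ℚ
interleaveZeros a (suc (suc m)) = interleaveZeros (λ n → a (suc n)) m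

-- Σₙ aₙ zⁿ, whose coefficient at w²ⁿ is aₙ.
generatingFunction : (ℕ → ℕ) → Series
generatingFunction a = mk 0 (interleaveZeros a)

module SeriesOps = RingOps series-rawRing
open SeriesOps

record IsPrincipalSqrt (r x : Series) : Set where
  field
    square   : r * r ≈ x
    positive : LeadingPositive r

{-# OPTIONS --safe #-}

-- Put σ = u₁ + u₂ and π = u₁ u₂. The numbers u₁, 1/u₁, u₂, 1/u₂ are the roots in y of the kernel
-- 1 - z (y² + y⁻²) - z² (y + y⁻¹), and the coefficient of yᵏ in its inverse is the series gₖ of the
-- paths ending at altitude k. The sequence F₀ = 1 + π, F₁ = σ with characteristic roots 1/u₁ and
-- 1/u₂ solves the same recurrence in k as gₖ · den, where den is the denominator of h₀, with the
-- same boundary term; since the recurrence carries factors z, the two agree modulo all powers of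
-- w = z^½, whence h₀ = g₀. By reflection in the axis, twice the wanted series is g₀ plus the series
-- 1 / (1 - 2z - 2z²) of all paths; the rest is algebra with σ and π.
--
-- The number of all paths of size n is the irrational part of (1 + √3)ⁿ⁺¹, so for the asymptotics it
-- remains to see that the paths ending on the axis are negligible. A path of large size has either
-- many steps N, N̄ or many steps E, Ē, and either kind alone spreads the altitude like a row of
-- Pascal's triangle, in which the entries of row 2l are at most 4ˡ / √(l + 1).

module Submission where

open import Algebra.Bundles using (AbelianGroup; CommutativeRing)
open import Algebra.Bundles.Raw using (RawRing)
import Algebra.Solver.Ring
import Algebra.Solver.Ring.AlmostCommutativeRing as ACR
open import Algebra.Structures using (IsCommutativeRing)
open import Axiom.UniquenessOfIdentityProofs.WithK using (uip)
open import Data.Empty using (⊥; ⊥-elim)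
open import Data.Fin.Base using (Fin; zero; suc; toℕ)
import Data.Fin.Permutation as Perm
import Data.Fin.Properties as Finₚ
open import Data.Integer.Base as ℤ using (ℤ; +_; -[1+_]; 0ℤ; 1ℤ; +<+)
import Data.Integer.DivMod as ℤ-DivMod
import Data.Integer.Properties as ℤₚ
import Data.Integer.Tactic.RingSolver as ℤ-solver
open import Data.List.Base using (List; []; _∷_)
open import Data.Maybe.Base using (Maybe; just; nothing)
open import Data.Nat.Base as ℕ using (ℕ; zero; suc; z≤n; s≤s; _∸_)
import Data.Nat.Properties as ℕₚ
import Data.Nat.Tactic.RingSolver as ℕ-solver
open import Data.Product.Base using (Σ; ∃; _×_; _,_; proj₁; proj₂)
open import Data.Rational.Base as ℚ using (ℚ; mkℚ; 0ℚ; 1ℚ; ½; toℚᵘ; *<*; _/_)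
import Data.Rational.Properties as ℚₚ
open import Data.Rational.Solver using (module +-*-Solver)
import Data.Rational.Unnormalised.Base as ℚᵘ
import Data.Rational.Unnormalised.Properties as ℚᵘₚ
open import Data.Sum.Base using (_⊎_; inj₁; inj₂)
open import Data.Sum.Function.Propositional using (_⊎-↔_)
open import Function.Bundles using (_↔_; mk↔ₛ′)
open import Function.Construct.Composition using (_↔-∘_)
open import Function.Construct.Symmetry using (↔-sym)
open import Level using (0ℓ)
open import Relation.Binary.PropositionalEquality as ≡ using (_≡_; _≢_)
open import Relation.Binary.Structures using (IsEquivalence)
open import Relation.Nullary using (¬_; yes; no; contradiction)
open import Relation.Nullary.Decidable using (from-yes)
open import Defs using (module Laurent; module RingOps; ℚ√; _+√_; rat; irr; ℚ√-rawRing; Positive; fromℕ; fromℚ; _∼_; interleaveZeros)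

-- The nested radicals come from τ = y + 1/y: in τ the kernel is a quadratic with the roots ±s/(2z)
-- - z/2, and each of them splits into y and 1/y by a second square root. Up to a constant and a
-- power of w, all three square roots have the form 1 + wc, where c is the fixed point of a
-- w-adically contracting quadratic map. The obstacle in comparing F with the paths is that π is
-- about -1/z, so that F has poles; hence z times the difference is shown to vanish. The values F₀
-- and F₁ make F₋₁ = F₁, as the evenness of the gₖ demands, and den is the amount by which the
-- recurrence then fails at 0. Division never takes place: inverses are elements with a known
-- product, and each derivation is a polynomial identity with cofactors of the hypotheses. Real
-- numbers do not occur either. For y = (1 + √3)ⁿ⁺¹ and the quotient q in question, (ε ± (q - 1)) y
-- lies in ℚ(√3), where signs are decided by squares; multiplication by a power of (√3 - 1)/2 then
-- removes y. The factor √3/12 is 1/(4√3): tₙ is about b/2 and y about 2√3 b for the irrational part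
-- b of y.

module IntegerSolver (R : CommutativeRing 0ℓ 0ℓ) where
  open CommutativeRing R
  open import Algebra.Properties.Semiring.Mult semiring using (×-homo-+; ×1-homo-*) renaming (_×_ to _·_)
  open import Algebra.Properties.Ring ring using (-‿distribˡ-*; -‿distribʳ-*; -0#≈0#; -‿involutive; -‿+-comm)
  open import Relation.Binary.Reasoning.Setoid setoid

  -- The separate clause for 1 makes `con (+ 1)` and `con (+ 2)` denote `1#` and `1# + 1#` on the
  -- nose, without a trailing `0#`, so that solved identities fit the goals as written.
  fromNat : ℕ → Carrier
  fromNat zero          = 0#
  fromNat (suc zero)    = 1#
  fromNat (suc (suc n)) = 1# + fromNat (suc n)

  fromℤ : ℤ → Carrier
  fromℤ (+ n)    = fromNat n
  fromℤ -[1+ n ] = - fromNat (suc n)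

  fromNat≈× : ∀ n → fromNat n ≈ n · 1#
  fromNat≈× zero          = refl
  fromNat≈× (suc zero)    = sym (+-identityʳ 1#)
  fromNat≈× (suc (suc n)) = +-congˡ (fromNat≈× (suc n))

  fromNat-suc : ∀ n → fromNat (suc n) ≈ 1# + fromNat n
  fromNat-suc n = trans (fromNat≈× (suc n)) (+-congˡ (sym (fromNat≈× n)))

  fromNat-+ : ∀ m n → fromNat (m ℕ.+ n) ≈ fromNat m + fromNat n
  fromNat-+ m n = begin
    fromNat (m ℕ.+ n)     ≈⟨ fromNat≈× (m ℕ.+ n) ⟩
    (m ℕ.+ n) · 1#        ≈⟨ ×-homo-+ 1# m n ⟩
    m · 1# + n · 1#       ≈⟨ +-cong (fromNat≈× m) (fromNat≈× n) ⟨
    fromNat m + fromNat n ∎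

  fromNat-* : ∀ m n → fromNat (m ℕ.* n) ≈ fromNat m * fromNat n
  fromNat-* m n = begin
    fromNat (m ℕ.* n)     ≈⟨ fromNat≈× (m ℕ.* n) ⟩
    (m ℕ.* n) · 1#        ≈⟨ ×1-homo-* m n ⟩
    m · 1# * n · 1#       ≈⟨ *-cong (fromNat≈× m) (fromNat≈× n) ⟨
    fromNat m * fromNat n ∎

  private
    cancel : ∀ x y z → (x + y) + - (x + z) ≈ y + - z
    cancel x y z = begin
      (x + y) + - (x + z)     ≈⟨ +-congˡ (-‿+-comm x z) ⟨
      (x + y) + (- x + - z)   ≈⟨ +-congʳ (+-comm x y) ⟩
      (y + x) + (- x + - z)   ≈⟨ +-assoc y x _ ⟩
      y + (x + (- x + - z))   ≈⟨ +-congˡ (+-assoc x (- x) (- z)) ⟨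
      y + ((x + - x) + - z)   ≈⟨ +-congˡ (+-congʳ (-‿inverseʳ x)) ⟩
      y + (0# + - z)          ≈⟨ +-congˡ (+-identityˡ _) ⟩
      y + - z                 ∎

  fromℤ-⊖ : ∀ m n → fromℤ (m ℤ.⊖ n) ≈ fromNat m + - fromNat n
  fromℤ-⊖ zero    zero    = sym (trans (+-congˡ -0#≈0#) (+-identityʳ 0#))
  fromℤ-⊖ zero    (suc n) = sym (+-identityˡ _)
  fromℤ-⊖ (suc m) zero    = sym (trans (+-congˡ -0#≈0#) (+-identityʳ _))
  fromℤ-⊖ (suc m) (suc n) = begin
    fromℤ (suc m ℤ.⊖ suc n)                 ≡⟨ ≡.cong fromℤ (ℤₚ.[1+m]⊖[1+n]≡m⊖n m n) ⟩
    fromℤ (m ℤ.⊖ n)                         ≈⟨ fromℤ-⊖ m n ⟩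
    fromNat m + - fromNat n                 ≈⟨ cancel 1# _ _ ⟨
    1# + fromNat m + - (1# + fromNat n)     ≈⟨ +-cong (fromNat-suc m) (-‿cong (fromNat-suc n)) ⟨
    fromNat (suc m) + - fromNat (suc n)     ∎

  fromℤ-neg : ∀ i → fromℤ (ℤ.- i) ≈ - fromℤ i
  fromℤ-neg (+ zero)  = sym -0#≈0#
  fromℤ-neg (+ suc n) = refl
  fromℤ-neg -[1+ n ]  = sym (-‿involutive _)

  fromℤ-+ : ∀ i j → fromℤ (i ℤ.+ j) ≈ fromℤ i + fromℤ j
  fromℤ-+ (+ m)    (+ n)    = fromNat-+ m n
  fromℤ-+ (+ m)    -[1+ n ] = fromℤ-⊖ m (suc n)
  fromℤ-+ -[1+ m ] (+ n)    = trans (fromℤ-⊖ n (suc m)) (+-comm _ _)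
  fromℤ-+ -[1+ m ] -[1+ n ] = begin
    - fromNat (suc (suc (m ℕ.+ n)))           ≡⟨ ≡.cong (λ k → - fromNat (suc k)) (ℕₚ.+-suc m n) ⟨
    - fromNat (suc m ℕ.+ suc n)               ≈⟨ -‿cong (fromNat-+ (suc m) (suc n)) ⟩
    - (fromNat (suc m) + fromNat (suc n))     ≈⟨ -‿+-comm _ _ ⟨
    - fromNat (suc m) + - fromNat (suc n)     ∎

  fromℤ-*⁺ : ∀ m j → fromℤ (+ m ℤ.* j) ≈ fromNat m * fromℤ j
  fromℤ-*⁺ m (+ n) = begin
    fromℤ (+ m ℤ.* + n)     ≡⟨ ≡.cong fromℤ (ℤₚ.pos-* m n) ⟨
    fromNat (m ℕ.* n)       ≈⟨ fromNat-* m n ⟩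
    fromNat m * fromNat n   ∎
  fromℤ-*⁺ m -[1+ n ] = begin
    fromℤ (+ m ℤ.* ℤ.- (+ suc n))        ≡⟨ ≡.cong fromℤ (ℤₚ.neg-distribʳ-* (+ m) (+ suc n)) ⟨
    fromℤ (ℤ.- (+ m ℤ.* + suc n))        ≈⟨ fromℤ-neg (+ m ℤ.* + suc n) ⟩
    - fromℤ (+ m ℤ.* + suc n)            ≈⟨ -‿cong (fromℤ-*⁺ m (+ suc n)) ⟩
    - (fromNat m * fromNat (suc n))      ≈⟨ -‿distribʳ-* _ _ ⟩
    fromNat m * - fromNat (suc n)        ∎

  fromℤ-* : ∀ i j → fromℤ (i ℤ.* j) ≈ fromℤ i * fromℤ j
  fromℤ-* (+ m)    j = fromℤ-*⁺ m j
  fromℤ-* -[1+ m ] j = begin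
    fromℤ (ℤ.- (+ suc m) ℤ.* j)          ≡⟨ ≡.cong fromℤ (ℤₚ.neg-distribˡ-* (+ suc m) j) ⟨
    fromℤ (ℤ.- (+ suc m ℤ.* j))          ≈⟨ fromℤ-neg (+ suc m ℤ.* j) ⟩
    - fromℤ (+ suc m ℤ.* j)              ≈⟨ -‿cong (fromℤ-*⁺ (suc m) j) ⟩
    - (fromNat (suc m) * fromℤ j)        ≈⟨ -‿distribˡ-* _ _ ⟩
    - fromNat (suc m) * fromℤ j          ∎

  private
    fromℤ≟ : ∀ i j → Maybe (fromℤ i ≈ fromℤ j)
    fromℤ≟ i j with i ℤₚ.≟ j
    ... | yes eq = just (reflexive (≡.cong fromℤ eq))
    ... | no _   = nothing

    fromℤ-homomorphism : ℤ.+-*-rawRing ACR.-Raw-AlmostCommutative⟶ ACR.fromCommutativeRing R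
    fromℤ-homomorphism = record
      { ⟦_⟧ = fromℤ ; +-homo = fromℤ-+ ; *-homo = fromℤ-* ; -‿homo = fromℤ-neg
      ; 0-homo = refl ; 1-homo = refl }

  open Algebra.Solver.Ring ℤ.+-*-rawRing (ACR.fromCommutativeRing R) fromℤ-homomorphism fromℤ≟ public

-- Power series over a commutative ring

module PowerSeries (K : CommutativeRing 0ℓ 0ℓ) where
  private
    module K = CommutativeRing K
  module Lau = Laurent K.rawRing
  open import Algebra.Definitions.RawMonoid K.+-rawMonoid using (sum)
  open import Algebra.Properties.CommutativeSemigroup K.+-commutativeSemigroup
    using (interchange; x∙yz≈y∙xz)

  PowerSeries : Set
  PowerSeries = ℕ → K.Carrier

  infix 4 _≈_
  -- A record instead of a bare pointwise equality, so that unification recovers the two series from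
  -- the type of a proof.
  record _≈_ (a b : PowerSeries) : Set where
    constructor pointwise
    field at : ∀ n → a n K.≈ b n
  open _≈_ public

  infixl 7 _*_
  infixl 6 _+_
  infixr 5 _◂_

  _+_ _*_ : PowerSeries → PowerSeries → PowerSeries
  (a + b) n = a n K.+ b n
  (a * b) n = sum λ (i : Fin (suc n)) → a (toℕ i) K.* b (n ∸ toℕ i)

  -_ : PowerSeries → PowerSeries
  (- a) n = K.- a n

  0# 1# : PowerSeries
  0# = Lau.single K.0#
  1# = Lau.single K.1#

  _◂_ : K.Carrier → PowerSeries → PowerSeries
  (c ◂ a) zero    = c
  (c ◂ a) (suc n) = a n

  tail : PowerSeries → PowerSeries
  tail a n = a (suc n)

  scale : K.Carrier → PowerSeries → PowerSeries
  scale c a n = c K.* a n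

  0#-at : ∀ n → 0# n K.≈ K.0#
  0#-at zero    = K.refl
  0#-at (suc n) = K.refl

  private
    module ≈-R where
      open import Relation.Binary.Reasoning.Setoid K.setoid public
    open ≈-R

    cong-at : ∀ n {a a′ b b′} → a ≈ a′ → b ≈ b′ → (a * b) n K.≈ (a′ * b′) n
    cong-at zero    p q = K.+-congʳ (K.*-cong (at p 0) (at q 0))
    cong-at (suc n) p q =
      K.+-cong (K.*-cong (at p 0) (at q (suc n))) (cong-at n (pointwise λ m → at p (suc m)) q)

    distribʳ-at : ∀ n c a b → ((a + b) * c) n K.≈ (a * c + b * c) n
    distribʳ-at zero    c a b = begin
      (a 0 K.+ b 0) K.* c 0 K.+ K.0#                         ≈⟨ K.+-identityʳ _ ⟩
      (a 0 K.+ b 0) K.* c 0                                  ≈⟨ K.distribʳ _ _ _ ⟩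
      a 0 K.* c 0 K.+ b 0 K.* c 0                            ≈⟨ K.+-cong (K.+-identityʳ _) (K.+-identityʳ _) ⟨
      (a 0 K.* c 0 K.+ K.0#) K.+ (b 0 K.* c 0 K.+ K.0#)      ∎
    distribʳ-at (suc n) c a b =
      K.trans (K.+-cong (K.distribʳ _ _ _) (distribʳ-at n c (tail a) (tail b))) (interchange _ _ _ _)

    distribˡ-at : ∀ n c a b → (c * (a + b)) n K.≈ (c * a + c * b) n
    distribˡ-at zero    c a b = begin
      c 0 K.* (a 0 K.+ b 0) K.+ K.0#                         ≈⟨ K.+-identityʳ _ ⟩
      c 0 K.* (a 0 K.+ b 0)                                  ≈⟨ K.distribˡ _ _ _ ⟩
      c 0 K.* a 0 K.+ c 0 K.* b 0                            ≈⟨ K.+-cong (K.+-identityʳ _) (K.+-identityʳ _) ⟨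
      (c 0 K.* a 0 K.+ K.0#) K.+ (c 0 K.* b 0 K.+ K.0#)      ∎
    distribˡ-at (suc n) c a b =
      K.trans (K.+-cong (K.distribˡ _ _ _) (distribˡ-at n (tail c) a b)) (interchange _ _ _ _)

    scale-at : ∀ n c a b → (scale c a * b) n K.≈ c K.* (a * b) n
    scale-at zero    c a b = begin
      c K.* a 0 K.* b 0 K.+ K.0#       ≈⟨ K.+-identityʳ _ ⟩
      c K.* a 0 K.* b 0                ≈⟨ K.*-assoc _ _ _ ⟩
      c K.* (a 0 K.* b 0)              ≈⟨ K.*-congˡ (K.+-identityʳ _) ⟨
      c K.* (a 0 K.* b 0 K.+ K.0#)     ∎
    scale-at (suc n) c a b =
      K.trans (K.+-cong (K.*-assoc _ _ _) (scale-at n c (tail a) b)) (K.sym (K.distribˡ _ _ _))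

    -- The mirror image of how the sum unfolds: the top coefficient of the left factor is split off
    -- instead of the bottom one. Commutativity plays the two against each other.
    suc-at : ∀ n a b → (a * b) (suc n) K.≈ a (suc n) K.* b 0 K.+ (a * tail b) n
    suc-at zero    a b = begin
      a 0 K.* b 1 K.+ (a 1 K.* b 0 K.+ K.0#)   ≈⟨ x∙yz≈y∙xz _ _ _ ⟩
      a 1 K.* b 0 K.+ (a 0 K.* b 1 K.+ K.0#)   ∎
    suc-at (suc n) a b =
      K.trans (K.+-congˡ (suc-at n (tail a) b)) (x∙yz≈y∙xz _ _ _)

    comm-at : ∀ n a b → (a * b) n K.≈ (b * a) n
    comm-at zero    a b = K.+-congʳ (K.*-comm _ _)
    comm-at (suc n) a b = begin
      a 0 K.* b (suc n) K.+ (tail a * b) n     ≈⟨ K.+-cong (K.*-comm _ _) (comm-at n (tail a) b) ⟩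
      b (suc n) K.* a 0 K.+ (b * tail a) n     ≈⟨ suc-at n b a ⟨
      (b * a) (suc n)                          ∎

    assoc-at : ∀ n a b c → ((a * b) * c) n K.≈ (a * (b * c)) n
    assoc-at zero    a b c = begin
      (a 0 K.* b 0 K.+ K.0#) K.* c 0 K.+ K.0#  ≈⟨ K.+-congʳ (K.*-congʳ (K.+-identityʳ _)) ⟩
      a 0 K.* b 0 K.* c 0 K.+ K.0#             ≈⟨ K.+-congʳ (K.*-assoc _ _ _) ⟩
      a 0 K.* (b 0 K.* c 0) K.+ K.0#           ≈⟨ K.+-congʳ (K.*-congˡ (K.+-identityʳ _)) ⟨
      a 0 K.* (b 0 K.* c 0 K.+ K.0#) K.+ K.0#  ∎
    assoc-at (suc n) a b c = begin
      (a * b) 0 K.* c (suc n) K.+ (tail (a * b) * c) n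
        -- By unfolding, `tail (a * b)` is `scale (a 0) (tail b) + tail a * b`.
        ≈⟨ K.+-congˡ (distribʳ-at n c (scale (a 0) (tail b)) (tail a * b)) ⟩
      (a * b) 0 K.* c (suc n) K.+ ((scale (a 0) (tail b) * c) n K.+ ((tail a * b) * c) n)
        ≈⟨ K.+-cong (K.*-congʳ (K.+-identityʳ _))
                    (K.+-cong (scale-at n (a 0) (tail b) c) (assoc-at n (tail a) b c)) ⟩
      a 0 K.* b 0 K.* c (suc n) K.+ (a 0 K.* (tail b * c) n K.+ (tail a * (b * c)) n)
        ≈⟨ K.+-assoc _ _ _ ⟨
      (a 0 K.* b 0 K.* c (suc n) K.+ a 0 K.* (tail b * c) n) K.+ (tail a * (b * c)) n
        ≈⟨ K.+-congʳ (K.+-congʳ (K.*-assoc _ _ _)) ⟩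
      (a 0 K.* (b 0 K.* c (suc n)) K.+ a 0 K.* (tail b * c) n) K.+ (tail a * (b * c)) n
        ≈⟨ K.+-congʳ (K.distribˡ _ _ _) ⟨
      a 0 K.* (b * c) (suc n) K.+ (tail a * (b * c)) n
        ∎

    zero-at : ∀ n a → ((λ _ → K.0#) * a) n K.≈ K.0#
    zero-at zero    a = K.trans (K.+-identityʳ _) (K.zeroˡ _)
    zero-at (suc n) a =
      K.trans (K.+-cong (K.zeroˡ _) (zero-at n a)) (K.+-identityʳ _)

    single-at : ∀ n c a → (Lau.single c * a) n K.≈ c K.* a n
    single-at zero    c a = K.+-identityʳ _
    single-at (suc n) c a = K.trans (K.+-congˡ (zero-at n a)) (K.+-identityʳ _)

  isEquivalence : IsEquivalence _≈_
  isEquivalence = record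
    { refl  = pointwise λ _ → K.refl
    ; sym   = λ p → pointwise λ n → K.sym (at p n)
    ; trans = λ p q → pointwise λ n → K.trans (at p n) (at q n)
    }

  single-* : ∀ c a → Lau.single c * a ≈ scale c a
  single-* c a = pointwise λ n → single-at n c a

  *-comm : ∀ a b → a * b ≈ b * a
  *-comm a b = pointwise λ n → comm-at n a b

  *-identityˡ : ∀ a → 1# * a ≈ a
  *-identityˡ a = pointwise λ n → K.trans (single-at n K.1# a) (K.*-identityˡ _)

  isCommutativeRing : IsCommutativeRing _≈_ _+_ _*_ -_ 0# 1#
  isCommutativeRing = record
    { isRing = record
      { +-isAbelianGroup = record
        { isGroup = record
          { isMonoid = record
            { isSemigroup = record
              { isMagma = record
                { isEquivalence = isEquivalence
                ; ∙-cong = λ p q → pointwise λ n → K.+-cong (at p n) (at q n) }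
              ; assoc = λ a b c → pointwise λ n → K.+-assoc _ _ _ }
            ; identity = (λ a → pointwise λ n → K.trans (K.+-congʳ (0#-at n)) (K.+-identityˡ _))
                       , (λ a → pointwise λ n → K.trans (K.+-congˡ (0#-at n)) (K.+-identityʳ _)) }
          ; inverse = (λ a → pointwise λ n → K.trans (K.-‿inverseˡ _) (K.sym (0#-at n)))
                    , (λ a → pointwise λ n → K.trans (K.-‿inverseʳ _) (K.sym (0#-at n)))
          ; ⁻¹-cong = λ p → pointwise λ n → K.-‿cong (at p n) }
        ; comm = λ a b → pointwise λ n → K.+-comm _ _ }
      ; *-cong = λ p q → pointwise λ n → cong-at n p q
      ; *-assoc = λ a b c → pointwise λ n → assoc-at n a b c
      ; *-identity = *-identityˡ
                   , λ a → IsEquivalence.trans isEquivalence (*-comm a 1#) (*-identityˡ a)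
      ; distrib = (λ c a b → pointwise λ n → distribˡ-at n c a b)
                , (λ c a b → pointwise λ n → distribʳ-at n c a b) }
    ; *-comm = *-comm }

  commutativeRing : CommutativeRing 0ℓ 0ℓ
  commutativeRing = record { isCommutativeRing = isCommutativeRing }

  ◂-* : ∀ a b → (K.0# ◂ a) * b ≈ K.0# ◂ (a * b)
  ◂-* a b = pointwise λ where
    zero    → K.trans (K.+-identityʳ _) (K.zeroˡ _)
    (suc n) → K.trans (K.+-congʳ (K.zeroˡ _)) (K.+-identityˡ _)

-- Laurent series as fractions of power series

module LaurentSeries (K : CommutativeRing 0ℓ 0ℓ) where
  private
    module K = CommutativeRing K
    module P = PowerSeries K
    module PR = CommutativeRing P.commutativeRing
    module Lau = Laurent K.rawRing
    open Lau using (shift; Series; mk; pole; coeff; _≋_; mk≋; coeff≈)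
    module L = RingOps Lau.rawRing
  open P using (PowerSeries; pointwise; at; _≈_; _+_; _*_; -_; 0#; 1#; _◂_)
  open IntegerSolver P.commutativeRing using (solve; _:=_; _:+_; _:*_; _:-_; :-_; con)
  open import Relation.Binary.Reasoning.Setoid PR.setoid

  W : ℕ → PowerSeries
  W k = shift k 1#

  shift-suc : ∀ k a → shift (suc k) a ≈ K.0# ◂ shift k a
  shift-suc k a = pointwise λ where
    zero    → K.refl
    (suc n) → K.refl

  ◂-cong : ∀ {c a b} → a ≈ b → c ◂ a ≈ c ◂ b
  ◂-cong p = pointwise λ where
    zero    → K.refl
    (suc n) → at p n

  shift≈W* : ∀ k a → shift k a ≈ W k * a
  shift≈W* zero    a = PR.sym (PR.*-identityˡ a)
  shift≈W* (suc k) a = begin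
    shift (suc k) a         ≈⟨ shift-suc k a ⟩
    K.0# ◂ shift k a        ≈⟨ ◂-cong (shift≈W* k a) ⟩
    K.0# ◂ (W k * a)        ≈⟨ P.◂-* (W k) a ⟨
    (K.0# ◂ W k) * a        ≈⟨ PR.*-congʳ (shift-suc k 1#) ⟨
    W (suc k) * a           ∎

  shift-+ : ∀ j k a → shift (j ℕ.+ k) a ≈ shift j (shift k a)
  shift-+ zero    k a = PR.refl
  shift-+ (suc j) k a = begin
    shift (suc (j ℕ.+ k)) a        ≈⟨ shift-suc (j ℕ.+ k) a ⟩
    K.0# ◂ shift (j ℕ.+ k) a       ≈⟨ ◂-cong (shift-+ j k a) ⟩
    K.0# ◂ shift j (shift k a)     ≈⟨ shift-suc j (shift k a) ⟨
    shift (suc j) (shift k a)      ∎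

  W-+ : ∀ j k → W (j ℕ.+ k) ≈ W j * W k
  W-+ j k = PR.trans (shift-+ j k 1#) (shift≈W* j (W k))

  shift-injective : ∀ k {a b} → shift k a ≈ shift k b → a ≈ b
  shift-injective zero    p = p
  shift-injective (suc k) p = shift-injective k (pointwise λ n → at p (suc n))

  -- Powers of the indeterminate can be cancelled over any coefficient ring, with or without zero
  -- divisors; transitivity of `≋` rests on this.
  W*-injective : ∀ k {a b} → W k * a ≈ W k * b → a ≈ b
  W*-injective k {a} {b} p = shift-injective k
    (PR.trans (shift≈W* k a) (PR.trans p (PR.sym (shift≈W* k b))))

  ≋⇒ : ∀ {x y} → x ≋ y → W (pole y) * coeff x ≈ W (pole x) * coeff y
  ≋⇒ {x} {y} p = begin
    W (pole y) * coeff x         ≈⟨ shift≈W* (pole y) (coeff x) ⟨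
    shift (pole y) (coeff x)     ≈⟨ pointwise (coeff≈ p) ⟩
    shift (pole x) (coeff y)     ≈⟨ shift≈W* (pole x) (coeff y) ⟩
    W (pole x) * coeff y         ∎

  ⇒≋ : ∀ {x y} → W (pole y) * coeff x ≈ W (pole x) * coeff y → x ≋ y
  ⇒≋ {x} {y} p = mk≋ (at (begin
    shift (pole y) (coeff x)     ≈⟨ shift≈W* (pole y) (coeff x) ⟩
    W (pole y) * coeff x         ≈⟨ p ⟩
    W (pole x) * coeff y         ≈⟨ shift≈W* (pole x) (coeff y) ⟨
    shift (pole x) (coeff y)     ∎))

  -- x = A / Q, where Q is the power of the indeterminate given by the pole.
  record Fraction (x : Series) (A Q : PowerSeries) : Set where
    constructor fraction
    field
      numerator   : coeff x ≈ A
      denominator : W (pole x) ≈ Q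
  open Fraction

  frac : ∀ x → Fraction x (coeff x) (W (pole x))
  frac x = fraction PR.refl PR.refl

  frac-+ : ∀ {x y A B P Q} → Fraction x A P → Fraction y B Q →
           Fraction (x L.+ y) (Q * A + P * B) (P * Q)
  frac-+ {x} {y} p q = fraction
    (PR.+-cong (PR.trans (shift≈W* (pole y) (coeff x)) (PR.*-cong (denominator q) (numerator p)))
               (PR.trans (shift≈W* (pole x) (coeff y)) (PR.*-cong (denominator p) (numerator q))))
    (PR.trans (W-+ (pole x) (pole y)) (PR.*-cong (denominator p) (denominator q)))

  frac-* : ∀ {x y A B P Q} → Fraction x A P → Fraction y B Q → Fraction (x L.* y) (A * B) (P * Q)
  frac-* {x} {y} p q = fraction
    (PR.*-cong (numerator p) (numerator q))
    (PR.trans (W-+ (pole x) (pole y)) (PR.*-cong (denominator p) (denominator q)))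

  frac-neg : ∀ {x A P} → Fraction x A P → Fraction (L.- x) (- A) P
  frac-neg p = fraction (PR.-‿cong (numerator p)) (denominator p)

  frac-mk : ∀ a → Fraction (mk 0 a) a 1#
  frac-mk a = fraction PR.refl PR.refl

  frac-0 : Fraction L.0# 0# 1#
  frac-0 = fraction PR.refl PR.refl

  frac-1 : Fraction L.1# 1# 1#
  frac-1 = fraction PR.refl PR.refl

  -- Cross-multiplication. It reduces each ring law to an identity between numerators and
  -- denominators, which the solver proves.
  frac-≋ : ∀ {x y A B P Q} → Fraction x A P → Fraction y B Q → Q * A ≈ P * B → x ≋ y
  frac-≋ p q eq = ⇒≋ (PR.trans (PR.*-cong (denominator q) (numerator p))
    (PR.trans eq (PR.sym (PR.*-cong (denominator p) (numerator q)))))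

  ≋-isEquivalence : IsEquivalence _≋_
  ≋-isEquivalence = record
    { refl  = mk≋ λ n → K.refl
    ; sym   = λ p → mk≋ λ n → K.sym (coeff≈ p n)
    ; trans = λ {x} {y} {z} p q → ⇒≋ (W*-injective (pole y) (begin
        W (pole y) * (W (pole z) * coeff x)
          ≈⟨ solve 3 (λ x y z → y :* (z :* x) := z :* (y :* x)) PR.refl (coeff x) (W (pole y)) (W (pole z)) ⟩
        W (pole z) * (W (pole y) * coeff x)   ≈⟨ PR.*-congˡ {W (pole z)} (≋⇒ p) ⟩
        W (pole z) * (W (pole x) * coeff y)
          ≈⟨ solve 3 (λ x y z → z :* (x :* y) := x :* (z :* y)) PR.refl (W (pole x)) (coeff y) (W (pole z)) ⟩
        W (pole x) * (W (pole z) * coeff y)   ≈⟨ PR.*-congˡ {W (pole x)} (≋⇒ q) ⟩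
        W (pole x) * (W (pole y) * coeff z)
          ≈⟨ solve 3 (λ x y z → x :* (y :* z) := y :* (x :* z)) PR.refl (W (pole x)) (W (pole y)) (coeff z) ⟩
        W (pole y) * (W (pole x) * coeff z)   ∎))
    }

  private
    +-cong : ∀ {x x′ y y′} → x ≋ x′ → y ≋ y′ → (x L.+ y) ≋ (x′ L.+ y′)
    +-cong {x} {x′} {y} {y′} p q = frac-≋ (frac-+ (frac x) (frac y)) (frac-+ (frac x′) (frac y′)) (begin
      (P′ * Q′) * (Q * A + P * B)
        ≈⟨ solve 6 (λ P Q P′ Q′ A B → (P′ :* Q′) :* (Q :* A :+ P :* B)
                     := (Q :* Q′) :* (P′ :* A) :+ (P :* P′) :* (Q′ :* B)) PR.refl P Q P′ Q′ A B ⟩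
      (Q * Q′) * (P′ * A) + (P * P′) * (Q′ * B)
        ≈⟨ PR.+-cong (PR.*-congˡ {Q * Q′} (≋⇒ p)) (PR.*-congˡ {P * P′} (≋⇒ q)) ⟩
      (Q * Q′) * (P * A′) + (P * P′) * (Q * B′)
        ≈⟨ solve 6 (λ P Q P′ Q′ A B → (Q :* Q′) :* (P :* A) :+ (P :* P′) :* (Q :* B)
                     := (P :* Q) :* (Q′ :* A :+ P′ :* B)) PR.refl P Q P′ Q′ A′ B′ ⟩
      (P * Q) * (Q′ * A′ + P′ * B′) ∎)
      where
      P = W (pole x)
      Q = W (pole y)
      P′ = W (pole x′)
      Q′ = W (pole y′)
      A = coeff x
      B = coeff y
      A′ = coeff x′
      B′ = coeff y′

    *-cong : ∀ {x x′ y y′} → x ≋ x′ → y ≋ y′ → (x L.* y) ≋ (x′ L.* y′)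
    *-cong {x} {x′} {y} {y′} p q = frac-≋ (frac-* (frac x) (frac y)) (frac-* (frac x′) (frac y′)) (begin
      (P′ * Q′) * (A * B)    ≈⟨ interchange P′ Q′ A B ⟩
      (P′ * A) * (Q′ * B)    ≈⟨ PR.*-cong (≋⇒ p) (≋⇒ q) ⟩
      (P * A′) * (Q * B′)    ≈⟨ interchange P A′ Q B′ ⟩
      (P * Q) * (A′ * B′)    ∎)
      where
      open import Algebra.Properties.CommutativeSemigroup PR.*-commutativeSemigroup using (interchange)
      P = W (pole x)
      Q = W (pole y)
      P′ = W (pole x′)
      Q′ = W (pole y′)
      A = coeff x
      B = coeff y
      A′ = coeff x′
      B′ = coeff y′

    -‿cong : ∀ {x y} → x ≋ y → (L.- x) ≋ (L.- y)
    -‿cong {x} {y} p = frac-≋ (frac-neg (frac x)) (frac-neg (frac y)) (begin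
      W (pole y) * - coeff x      ≈⟨ -‿distribʳ-* (W (pole y)) (coeff x) ⟨
      - (W (pole y) * coeff x)    ≈⟨ PR.-‿cong (≋⇒ p) ⟩
      - (W (pole x) * coeff y)    ≈⟨ -‿distribʳ-* (W (pole x)) (coeff y) ⟩
      W (pole x) * - coeff y      ∎)
      where open import Algebra.Properties.Ring PR.ring using (-‿distribʳ-*)

    +-comm : ∀ x y → (x L.+ y) ≋ (y L.+ x)
    +-comm x y = frac-≋ (frac-+ (frac x) (frac y)) (frac-+ (frac y) (frac x))
      (solve 4 (λ A P B Q → (Q :* P) :* (Q :* A :+ P :* B) := (P :* Q) :* (P :* B :+ Q :* A))
        PR.refl (coeff x) (W (pole x)) (coeff y) (W (pole y)))

    *-comm : ∀ x y → (x L.* y) ≋ (y L.* x)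
    *-comm x y = frac-≋ (frac-* (frac x) (frac y)) (frac-* (frac y) (frac x))
      (solve 4 (λ A P B Q → (Q :* P) :* (A :* B) := (P :* Q) :* (B :* A))
        PR.refl (coeff x) (W (pole x)) (coeff y) (W (pole y)))

    +-assoc : ∀ x y z → ((x L.+ y) L.+ z) ≋ (x L.+ (y L.+ z))
    +-assoc x y z = frac-≋ (frac-+ (frac-+ (frac x) (frac y)) (frac z)) (frac-+ (frac x) (frac-+ (frac y) (frac z)))
      (solve 6 (λ A P B Q C R → (P :* (Q :* R)) :* (R :* (Q :* A :+ P :* B) :+ (P :* Q) :* C)
                             := ((P :* Q) :* R) :* ((Q :* R) :* A :+ P :* (R :* B :+ Q :* C)))
        PR.refl (coeff x) (W (pole x)) (coeff y) (W (pole y)) (coeff z) (W (pole z)))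

    *-assoc : ∀ x y z → ((x L.* y) L.* z) ≋ (x L.* (y L.* z))
    *-assoc x y z = frac-≋ (frac-* (frac-* (frac x) (frac y)) (frac z)) (frac-* (frac x) (frac-* (frac y) (frac z)))
      (solve 6 (λ A P B Q C R → (P :* (Q :* R)) :* ((A :* B) :* C) := ((P :* Q) :* R) :* (A :* (B :* C)))
        PR.refl (coeff x) (W (pole x)) (coeff y) (W (pole y)) (coeff z) (W (pole z)))

    +-identityˡ : ∀ x → (L.0# L.+ x) ≋ x
    +-identityˡ x = frac-≋ (frac-+ frac-0 (frac x)) (frac x)
      (solve 4 (λ A P z o → P :* (P :* con (+ 0) :+ con (+ 1) :* A) := (con (+ 1) :* P) :* A)
        PR.refl (coeff x) (W (pole x)) 0# 1#)

    *-identityˡ : ∀ x → (L.1# L.* x) ≋ x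
    *-identityˡ x = frac-≋ (frac-* frac-1 (frac x)) (frac x)
      (solve 2 (λ A P → P :* (con (+ 1) :* A) := (con (+ 1) :* P) :* A)
        PR.refl (coeff x) (W (pole x)))

    -‿inverseˡ : ∀ x → (L.- x L.+ x) ≋ L.0#
    -‿inverseˡ x = frac-≋ (frac-+ (frac-neg (frac x)) (frac x)) frac-0
      (solve 2 (λ A P → con (+ 1) :* (P :* (:- A) :+ P :* A) := (P :* P) :* con (+ 0))
        PR.refl (coeff x) (W (pole x)))

    distribˡ : ∀ x y z → (x L.* (y L.+ z)) ≋ (x L.* y L.+ x L.* z)
    distribˡ x y z = frac-≋ (frac-* (frac x) (frac-+ (frac y) (frac z)))
                            (frac-+ (frac-* (frac x) (frac y)) (frac-* (frac x) (frac z)))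
      (solve 6 (λ A P B Q C R → ((P :* Q) :* (P :* R)) :* (A :* (R :* B :+ Q :* C))
                             := (P :* (Q :* R)) :* ((P :* R) :* (A :* B) :+ (P :* Q) :* (A :* C)))
        PR.refl (coeff x) (W (pole x)) (coeff y) (W (pole y)) (coeff z) (W (pole z)))

    module ≋ = IsEquivalence ≋-isEquivalence

  isCommutativeRing : IsCommutativeRing _≋_ L._+_ L._*_ L.-_ L.0# L.1#
  isCommutativeRing = record
    { isRing = record
      { +-isAbelianGroup = record
        { isGroup = record
          { isMonoid = record
            { isSemigroup = record
              { isMagma = record { isEquivalence = ≋-isEquivalence ; ∙-cong = +-cong }
              ; assoc = +-assoc }
            ; identity = +-identityˡ , λ x → ≋.trans (+-comm x L.0#) (+-identityˡ x) }
          ; inverse = -‿inverseˡ , λ x → ≋.trans (+-comm x (L.- x)) (-‿inverseˡ x)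
          ; ⁻¹-cong = -‿cong }
        ; comm = +-comm }
      ; *-cong = *-cong
      ; *-assoc = *-assoc
      ; *-identity = *-identityˡ , λ x → ≋.trans (*-comm x L.1#) (*-identityˡ x)
      ; distrib = distribˡ , λ x y z → ≋.trans (*-comm (y L.+ z) x)
          (≋.trans (distribˡ x y z) (+-cong (*-comm x y) (*-comm x z))) }
    ; *-comm = *-comm }

  commutativeRing : CommutativeRing 0ℓ 0ℓ
  commutativeRing = record { isCommutativeRing = isCommutativeRing }

-- Fixed points of contractions of power series

module Fixpoint (K : CommutativeRing 0ℓ 0ℓ) where
  private
    module K = CommutativeRing K
    module P = PowerSeries K
    module PR = CommutativeRing P.commutativeRing
  open P using (PowerSeries; pointwise; _≈_; _+_; _*_; 0#; _◂_)
  open import Data.Nat.Base using (_≤_; _<_)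

  Agree : ℕ → PowerSeries → PowerSeries → Set
  Agree n a b = ∀ i → i < n → a i K.≈ b i

  agree-* : ∀ n {a a′ b b′} → Agree n a a′ → Agree n b b′ → Agree n (a * b) (a′ * b′)
  agree-* n p q i i<n = go i (λ j j≤i → p j (ℕₚ.≤-<-trans j≤i i<n)) (λ j j≤i → q j (ℕₚ.≤-<-trans j≤i i<n))
    where
    go : ∀ i {a a′ b b′} → (∀ j → j ≤ i → a j K.≈ a′ j) → (∀ j → j ≤ i → b j K.≈ b′ j) →
         (a * b) i K.≈ (a′ * b′) i
    go zero    p q = K.+-congʳ (K.*-cong (p 0 z≤n) (q 0 z≤n))
    go (suc i) p q = K.+-cong (K.*-cong (p 0 z≤n) (q (suc i) ℕₚ.≤-refl))
      (go i (λ j j≤i → p (suc j) (s≤s j≤i)) (λ j j≤i → q j (ℕₚ.m≤n⇒m≤1+n j≤i)))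

  module _ (Φ : PowerSeries → PowerSeries)
           (contracts : ∀ n {a b} → Agree n a b → Agree (suc n) (Φ a) (Φ b)) where
    private
      iterate : ℕ → PowerSeries
      iterate zero    = 0#
      iterate (suc n) = Φ (iterate n)

      agree-suc : ∀ n → Agree n (iterate n) (iterate (suc n))
      agree-suc zero    i ()
      agree-suc (suc n) = contracts n (agree-suc n)

      agree-later : ∀ i d → iterate (suc i) i K.≈ iterate (d ℕ.+ suc i) i
      agree-later i zero    = K.refl
      agree-later i (suc d) = K.trans (agree-later i d) (agree-suc (d ℕ.+ suc i) i (ℕₚ.m≤n+m (suc i) d))

    -- Each round settles one more coefficient, so coefficient n can be taken from round n + 1.
    fix : PowerSeries
    fix n = iterate (suc n) n

    fix-agrees : ∀ n → Agree n fix (iterate n)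
    fix-agrees n i i<n =
      ≡.subst (λ m → fix i K.≈ iterate m i) (ℕₚ.m∸n+n≡m i<n) (agree-later i (n ℕ.∸ suc i))

    fix-fixed : fix ≈ Φ fix
    fix-fixed = pointwise λ n → K.sym (contracts n (fix-agrees n) n ℕₚ.≤-refl)

  abstract
    -- The `K.0# ◂` multiplies by the indeterminate and so makes the map contracting whatever the
    -- coefficients are. The block is abstract so that the iteration is never unfolded.
    quadratic : ∀ α β γ → ∃ λ x → x ≈ α + (K.0# ◂ (β * x + γ * (x * x)))
    quadratic α β γ = fix Φ contracts , fix-fixed Φ contracts
      where
      Φ : PowerSeries → PowerSeries
      Φ x = α + (K.0# ◂ (β * x + γ * (x * x)))

      contracts : ∀ n {a b} → Agree n a b → Agree (suc n) (Φ a) (Φ b)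
      contracts n p zero    _         = K.refl
      contracts n p (suc i) (s≤s i<n) = K.+-congˡ (K.+-cong
        (agree-* n {β} {β} (λ _ _ → K.refl) p i i<n)
        (agree-* n {γ} {γ} (λ _ _ → K.refl) (agree-* n p p) i i<n))

-- Identities modulo hypotheses

module Cancellation (R : CommutativeRing 0ℓ 0ℓ) where
  open CommutativeRing R

  vanishes : ∀ {x y} → x ≈ y → ∀ k → k * (x - y) ≈ 0#
  vanishes {x} {y} p k = trans (*-congˡ (trans (+-congʳ p) (-‿inverseʳ y))) (zeroʳ k)

  -- A derivation from the hypothesis l ≈ r is a ring identity x ≈ y + k (l - r).
  infixr 1 _modulo_by_
  _modulo_by_ : ∀ {x y l r} k → x ≈ y + k * (l - r) → l ≈ r → x ≈ y
  (k modulo eq by p) = trans eq (trans (+-congˡ (vanishes p k)) (+-identityʳ _))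

module QuadraticRoots (R : CommutativeRing 0ℓ 0ℓ) where
  open CommutativeRing R
  open Cancellation R
  open IntegerSolver R using (solve; _:=_; _:+_; _:*_; _:-_; :-_; con)

  substitute : ∀ w x {α α′ β β′ γ γ′} → α ≈ α′ → β ≈ β′ → γ ≈ γ′ →
               x ≈ α + w * (β * x + γ * (x * x)) → x ≈ α′ + w * (β′ * x + γ′ * (x * x))
  substitute w x p q r eq = trans eq (+-cong p (*-congˡ (+-cong (*-congʳ q) (*-congʳ r))))

  -- The fixed-point equation is (1 + we) y = 1 solved for its first y; the quadratic term is
  -- switched off.
  inverse : ∀ w e y → y ≈ 1# + w * (- e * y + 0# * (y * y)) → (1# + w * e) * y ≈ 1#
  inverse w e y p = 1# modulo
    solve 3 (λ w e y → (con (+ 1) :+ w :* e) :* y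
      := con (+ 1) :+ con (+ 1) :* (y :- (con (+ 1) :+ w :* (:- e :* y :+ con (+ 0) :* (y :* y)))))
      refl w e y by p

  -- The square of 1 + wc is 1 + we as soon as 2c + wc² = e; halved, this is the fixed-point
  -- equation c = e/2 - wc²/2, with h for one half.
  square : ∀ w e c h → h + h ≈ 1# → c ≈ h * e + w * (0# * c + - h * (c * c)) →
           (1# + w * c) * (1# + w * c) ≈ 1# + w * e
  square w e c h hh p = (w * e - w * w * (c * c)) modulo ((1# + 1#) * w modulo
    solve 4 (λ w e c h → (con (+ 1) :+ w :* c) :* (con (+ 1) :+ w :* c)
      := ((con (+ 1) :+ w :* e) :+ (w :* e :- w :* w :* (c :* c)) :* (h :+ h :- con (+ 1)))
         :+ con (+ 2) :* w :* (c :- (h :* e :+ w :* (con (+ 0) :* c :+ :- h :* (c :* c)))))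
      refl w e c h by p) by hh

-- What the argument uses of the Laurent series: a ring that contains the power series and an
-- inverse of the indeterminate. Working over this interface keeps the concrete operations from
-- unfolding inside large terms.
record Embedding (K R : CommutativeRing 0ℓ 0ℓ) : Set where
  private
    module K = CommutativeRing K
    module P = PowerSeries K
    module PR = CommutativeRing P.commutativeRing
  open CommutativeRing R
  field
    ι           : P.PowerSeries → Carrier
    w w⁻¹       : Carrier
    ι-cong      : ∀ {a b} → a P.≈ b → ι a ≈ ι b
    ι-injective : ∀ {a b} → ι a ≈ ι b → a P.≈ b
    ι-+         : ∀ a b → ι (a P.+ b) ≈ ι a + ι b
    ι-*         : ∀ a b → ι (a P.* b) ≈ ι a * ι b
    ι-neg       : ∀ a → ι (P.- a) ≈ - ι a
    ι-0#        : ι P.0# ≈ 0#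
    ι-1#        : ι P.1# ≈ 1#
    ι-0◂        : ∀ a → ι (K.0# P.◂ a) ≈ w * ι a
    w*w⁻¹       : w * w⁻¹ ≈ 1#

module LaurentEmbedding (K : CommutativeRing 0ℓ 0ℓ) where
  private
    module K = CommutativeRing K
    module P = PowerSeries K
    module PR = CommutativeRing P.commutativeRing
    module Lau = Laurent K.rawRing
    module LS = LaurentSeries K
  open Lau using (single; Series; mk; coeff≈; monomial; constant)
  open LS using (W; frac; frac-mk; frac-+; frac-*; frac-≋; fraction; shift≈W*; ◂-cong)
  open P using (PowerSeries; pointwise; _◂_)
  open CommutativeRing LS.commutativeRing
  open IntegerSolver P.commutativeRing using (solve; _:=_; _:+_; _:*_; con)
  open import Relation.Binary.Reasoning.Setoid setoid

  ι : PowerSeries → Series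
  ι = mk 0

  w w⁻¹ : Series
  w   = monomial K.1# (+ 1)
  w⁻¹ = monomial K.1# -[1+ 0 ]

  ι-cong : ∀ {a b} → a P.≈ b → ι a ≈ ι b
  ι-cong {a} {b} p = frac-≋ (frac-mk a) (frac-mk b) (PR.*-congˡ {P.1#} p)

  ι-injective : ∀ {a b} → ι a ≈ ι b → a P.≈ b
  ι-injective p = pointwise (coeff≈ p)

  ι-+ : ∀ a b → ι (a P.+ b) ≈ ι a + ι b
  ι-+ a b = frac-≋ (frac-mk (a P.+ b)) (frac-+ (frac-mk a) (frac-mk b))
    (solve 2 (λ a b → (con (+ 1) :* con (+ 1)) :* (a :+ b)
                   := con (+ 1) :* (con (+ 1) :* a :+ con (+ 1) :* b)) PR.refl a b)

  ι-* : ∀ a b → ι (a P.* b) ≈ ι a * ι b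
  ι-* a b = frac-≋ (frac-mk (a P.* b)) (frac-* (frac-mk a) (frac-mk b))
    (solve 2 (λ a b → (con (+ 1) :* con (+ 1)) :* (a :* b) := con (+ 1) :* (a :* b)) PR.refl a b)

  ι-neg : ∀ a → ι (P.- a) ≈ - ι a
  ι-neg a = refl

  W1* : ∀ a → W 1 P.* a P.≈ K.0# ◂ a
  W1* a = PR.trans (PR.sym (shift≈W* 1 a)) (PR.trans (LS.shift-suc 0 a) (◂-cong PR.refl))

  ι-0◂ : ∀ a → ι (K.0# ◂ a) ≈ w * ι a
  ι-0◂ a = trans (ι-cong (PR.sym (W1* a))) (ι-* (W 1) a)

  mk≈ : ∀ k a → mk (suc k) a ≈ monomial K.1# -[1+ k ] * ι a
  mk≈ k a = frac-≋ (frac (mk (suc k) a)) (frac-* (frac (monomial K.1# -[1+ k ])) (frac-mk a))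
    (solve 2 (λ p a → (p :* con (+ 1)) :* a := p :* (con (+ 1) :* a)) PR.refl (W (suc k)) a)

  monomial-scale⁻ : ∀ c k → monomial c -[1+ k ] ≈ constant c * monomial K.1# -[1+ k ]
  monomial-scale⁻ c k = trans (mk≈ k (single c)) (*-comm (monomial K.1# -[1+ k ]) (constant c))

  monomial⁻-+ : ∀ j k → monomial K.1# -[1+ suc (j ℕ.+ k) ]
                      ≈ monomial K.1# -[1+ j ] * monomial K.1# -[1+ k ]
  monomial⁻-+ j k = frac-≋
    (frac (monomial K.1# -[1+ suc (j ℕ.+ k) ]))
    (fraction (PR.*-identityˡ P.1#) (PR.reflexive (≡.cong W (≡.cong suc (ℕₚ.+-suc j k)))))
    PR.refl

  monomial⁺-+ : ∀ j k → monomial K.1# (+ (j ℕ.+ k)) ≈ monomial K.1# (+ j) * monomial K.1# (+ k)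
  monomial⁺-+ j k = trans (ι-cong (LS.W-+ j k)) (ι-* (W j) (W k))

  w*w⁻¹ : w * w⁻¹ ≈ 1#
  w*w⁻¹ = frac-≋ (frac-* (frac w) (frac w⁻¹)) LS.frac-1
    (solve 1 (λ p → con (+ 1) :* (p :* con (+ 1)) := (con (+ 1) :* p) :* con (+ 1)) PR.refl (W 1))

  embedding : Embedding K LS.commutativeRing
  embedding = record
    { ι = ι ; w = w ; w⁻¹ = w⁻¹
    ; ι-cong = ι-cong ; ι-injective = ι-injective ; ι-+ = ι-+ ; ι-* = ι-* ; ι-neg = ι-neg
    ; ι-0# = refl ; ι-1# = refl ; ι-0◂ = ι-0◂ ; w*w⁻¹ = w*w⁻¹ }

-- Divisibility by powers of w

module Integrality {K R : CommutativeRing 0ℓ 0ℓ} (E : Embedding K R) where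
  private
    module K = CommutativeRing K
    module P = PowerSeries K
    module PR = CommutativeRing P.commutativeRing
    module LS = LaurentSeries K
  open LS using (W; shift≈W*)
  open Laurent K.rawRing using (single; shift)
  open P using (PowerSeries; pointwise; at; _◂_)
  open CommutativeRing R
  open Embedding E
  open IntegerSolver P.commutativeRing using (solve; _:=_; _:*_; _:-_; :-_)
  open import Relation.Binary.Reasoning.Setoid setoid

  constant : K.Carrier → Carrier
  constant c = ι (single c)

  ι-◂ : ∀ c a → ι (c ◂ a) ≈ constant c + w * ι a
  ι-◂ c a = begin
    ι (c ◂ a)                                        ≈⟨ ι-cong (pointwise split) ⟩
    ι (single c P.+ (K.0# ◂ a))                      ≈⟨ ι-+ (single c) (K.0# ◂ a) ⟩
    constant c + ι (K.0# ◂ a)                        ≈⟨ +-congˡ (ι-0◂ a) ⟩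
    constant c + w * ι a                             ∎
    where
    split : ∀ n → (c ◂ a) n K.≈ (single c P.+ (K.0# ◂ a)) n
    split zero    = K.sym (K.+-identityʳ c)
    split (suc n) = K.sym (K.+-identityˡ (a n))

  constant-cong : ∀ {c d} → c K.≈ d → constant c ≈ constant d
  constant-cong p = ι-cong (pointwise λ { zero → p ; (suc n) → K.refl })

  constant-+ : ∀ c d → constant (c K.+ d) ≈ constant c + constant d
  constant-+ c d = trans
    (ι-cong (pointwise λ { zero → K.refl ; (suc n) → K.sym (K.+-identityʳ K.0#) }))
    (ι-+ (single c) (single d))

  constant-* : ∀ c d → constant (c K.* d) ≈ constant c * constant d
  constant-* c d = trans
    (ι-cong (PR.sym (PR.trans (P.single-* c (single d))
      (pointwise λ { zero → K.refl ; (suc n) → K.zeroʳ c }))))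
    (ι-* (single c) (single d))

  1≉0 : ¬ (K.1# K.≈ K.0#) → ¬ (1# ≈ 0#)
  1≉0 ne p = ne (at (ι-injective (trans ι-1# (trans p (sym ι-0#)))) 0)

  ι-W1 : ι (W 1) ≈ w
  ι-W1 = trans (ι-cong (LS.shift-suc 0 P.1#))
           (trans (ι-0◂ P.1#) (trans (*-congˡ ι-1#) (*-identityʳ w)))

  -- Membership in the ideal of the power series generated by wⁿ, inside the larger ring; `O 0` says
  -- that x has no pole.
  O : ℕ → Carrier → Set
  O n x = ∃ λ a → x ≈ ι (W n P.* a)

  Int : Carrier → Set
  Int = O 0

  ι-Int : ∀ a → Int (ι a)
  ι-Int a = a , ι-cong (PR.sym (PR.*-identityˡ a))

  Int⇒ι : ∀ {x} → Int x → ∃ λ a → x ≈ ι a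
  Int⇒ι (a , p) = a , trans p (ι-cong (PR.*-identityˡ a))

  O-resp : ∀ n {x y} → x ≈ y → O n x → O n y
  O-resp n p (a , q) = a , trans (sym p) q

  O-+ : ∀ n {x y} → O n x → O n y → O n (x + y)
  O-+ n (a , p) (b , q) = a P.+ b , trans (+-cong p q)
    (trans (sym (ι-+ (W n P.* a) (W n P.* b))) (ι-cong (PR.sym (PR.distribˡ (W n) a b))))

  O-neg : ∀ n {x} → O n x → O n (- x)
  O-neg n (a , p) = P.- a , trans (-‿cong p) (trans (sym (ι-neg (W n P.* a)))
    (ι-cong (solve 2 (λ w a → :- (w :* a) := w :* (:- a)) PR.refl (W n) a)))

  O-* : ∀ m n {x y} → O m x → O n y → O (m ℕ.+ n) (x * y)
  O-* m n (a , p) (b , q) = a P.* b , trans (*-cong p q)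
    (trans (sym (ι-* (W m P.* a) (W n P.* b)))
      (ι-cong (PR.trans
        (solve 4 (λ v a w b → (v :* a) :* (w :* b) := (v :* w) :* (a :* b)) PR.refl (W m) a (W n) b)
        (PR.*-congʳ (PR.sym (LS.W-+ m n))))))

  O1-w : O 1 w
  O1-w = P.1# , trans (sym ι-W1) (ι-cong (PR.sym (PR.*-identityʳ (W 1))))

  Int-w : Int w
  Int-w = O-resp 0 ι-W1 (ι-Int (W 1))

  Int-0# : Int 0#
  Int-0# = O-resp 0 ι-0# (ι-Int P.0#)

  Int-1# : Int 1#
  Int-1# = O-resp 0 ι-1# (ι-Int P.1#)

  shift-below : ∀ n a → shift (suc n) a n K.≈ K.0#
  shift-below zero    a = K.refl
  shift-below (suc n) a = shift-below n a

  O-vanish : ∀ {x} → (∀ n → O n x) → x ≈ 0#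
  O-vanish {x} o with o 0
  ... | (a , p) = trans p (trans (ι-cong {b = P.0#} (PR.trans (PR.*-identityˡ a) (pointwise λ n → K.trans (go n) (K.sym (P.0#-at n))))) ι-0#)
    where
    go : ∀ n → a n K.≈ K.0#
    go n with o (suc n)
    ... | (b , q) = K.trans (at (ι-injective {a} {W (suc n) P.* b}
            (trans (ι-cong (PR.sym (PR.*-identityˡ a))) (trans (sym p) q))) n)
          (K.trans (K.sym (at (shift≈W* (suc n) b) n)) (shift-below n b))

  module _ (d : ℕ → Carrier) (int : ∀ k → Int (d k))
           (gain : ∀ n → (∀ k → O n (d k)) → ∀ k → O (suc n) (d k)) where
    -- Takes the place of initial values in a uniqueness proof: each use of `gain` raises the
    -- divisibility by one power of w. The whole family has to move at once because the intended
    -- recurrence ties each index to neighbours on both sides.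
    vanish : ∀ k → d k ≈ 0#
    vanish k = O-vanish λ n → all n k
      where
      all : ∀ n k → O n (d k)
      all zero    = int
      all (suc n) = gain n (all n)

  ι-quadratic : ∀ b c x → ι (b P.* x P.+ c P.* (x P.* x)) ≈ ι b * ι x + ι c * (ι x * ι x)
  ι-quadratic b c x = trans (ι-+ (b P.* x) (c P.* (x P.* x)))
    (+-cong (ι-* b x) (trans (ι-* c (x P.* x)) (*-congˡ (ι-* x x))))

  private
    from-fixed : ∀ {α β γ} a b c x → α ≈ ι a → β ≈ ι b → γ ≈ ι c →
                 x P.≈ a P.+ (K.0# ◂ (b P.* x P.+ c P.* (x P.* x))) →
                 ι x ≈ α + w * (β * ι x + γ * (ι x * ι x))
    from-fixed a b c x p q r fixed = QuadraticRoots.substitute R w (ι x) (sym p) (sym q) (sym r) (begin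
      ι x                                             ≈⟨ ι-cong fixed ⟩
      ι (a P.+ (K.0# ◂ y))                            ≈⟨ ι-+ a (K.0# ◂ y) ⟩
      ι a + ι (K.0# ◂ y)                              ≈⟨ +-congˡ (ι-0◂ y) ⟩
      ι a + w * ι y                                   ≈⟨ +-congˡ (*-congˡ (ι-quadratic b c x)) ⟩
      ι a + w * (ι b * ι x + ι c * (ι x * ι x))       ∎)
      where
      y = b P.* x P.+ c P.* (x P.* x)

  quadratic : ∀ {α β γ} → Int α → Int β → Int γ → ∃ λ x → Int x × x ≈ α + w * (β * x + γ * (x * x))
  quadratic iα iβ iγ with Int⇒ι iα | Int⇒ι iβ | Int⇒ι iγ
  ... | (a , p) | (b , q) | (c , r) =
    let (x , fixed) = Fixpoint.quadratic K a b c in ι x , ι-Int x , from-fixed a b c x p q r fixed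

  unit : ∀ {e} → Int e → ∃ λ y → (1# + w * e) * y ≈ 1#
  unit {e} ie =
    let (y , _ , p) = quadratic Int-1# (O-neg 0 ie) Int-0# in
    y , QuadraticRoots.inverse R w e y p

  module _ (½ : K.Carrier) (½+½ : ½ K.+ ½ K.≈ K.1#) where
    half+half : constant ½ + constant ½ ≈ 1#
    half+half = trans (sym (constant-+ ½ ½)) (trans (constant-cong ½+½) ι-1#)

    sqrt : ∀ {e} → Int e → ∃ λ c → Int c × (1# + w * c) * (1# + w * c) ≈ 1# + w * e
    sqrt {e} ie =
      let (c , ic , p) = quadratic (O-* 0 0 (ι-Int (single ½)) ie) Int-0# (O-neg 0 (ι-Int (single ½))) in
      c , ic , QuadraticRoots.square R w e c (constant ½) half+half p

-- The roots of the kernel in radicals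

module RootFormulas (R : CommutativeRing 0ℓ 0ℓ) where
  open RingOps (CommutativeRing.rawRing R)
  open CommutativeRing R using (refl; sym; trans; *-cong; +-cong; *-congˡ; +-congˡ; -‿cong)
  open Cancellation R
  open IntegerSolver R using (solve; _:=_; _:+_; _:*_; _:-_; :-_; _:^_; _:×_; con)

  -- √x₁ and √x₂ below stand for r₁ / √2 and r₂ / √2, and x for s / (2z).
  module Roots {z z⁻¹ ½ √2 x √x₁ √x₂ : Carrier}
    (zz⁻¹ : z * z⁻¹ ≈ 1#) (½½ : ½ + ½ ≈ 1#) (√2√2 : √2 * √2 ≈ 1# + 1#)
    (xx : x * x ≈ z⁻¹ + (1# + 1#) + ½ * ½ * (z * z))
    (xx₁ : √x₁ * √x₁ ≈ z⁻¹ - (1# + 1#) - z * x + ½ * (z * z))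
    (xx₂ : √x₂ * √x₂ ≈ z⁻¹ - (1# + 1#) + z * x + ½ * (z * z))
    where

    -- In τ = y + 1/y the kernel is, up to the factor -z, the quadratic τ² + zτ - (1/z + 2) with the
    -- roots ±x - z/2. The pair u₁, v₁ belongs to the plus sign and u₂, v₂ to the minus sign; within
    -- a pair only the sign of the second square root changes.
    u₁ u₂ v₁ v₂ : Carrier
    u₁ = ½ * (x + √x₁) - ½ * ½ * z
    v₁ = ½ * (x - √x₁) - ½ * ½ * z
    u₂ = - (½ * (x + √x₂)) - ½ * ½ * z
    v₂ = - (½ * (x - √x₂)) - ½ * ½ * z

    -- For τ = x - z/2 the square of `√x₁` is τ² - 4, the discriminant of y² - τy + 1; so the two
    -- conjugates are the roots of this polynomial.
    u₁v₁ : u₁ * v₁ ≈ 1#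
    -- One half is just an element of the ring and unknown to the solver, so even ½ + ½ = 1 enters
    -- through a cofactor.
    u₁v₁ = (1# + ½ + ½ - ½ * ½ * z * x + ½ * ½ * ½ * z * z) modulo (- (½ * ½) modulo (½ * ½ modulo
      solve 5 (λ z z⁻¹ h x y →
          (h :* (x :+ y) :- h :* h :* z) :* (h :* (x :- y) :- h :* h :* z)
        := ((con (+ 1) :+ (con (+ 1) :+ h :+ h :- h :* h :* z :* x :+ h :* h :* h :* z :* z) :* (h :+ h :- con (+ 1)))
           :+ :- (h :* h) :* (y :* y :- (z⁻¹ :- con (+ 2) :- z :* x :+ h :* (z :* z))))
           :+ (h :* h) :* (x :* x :- (z⁻¹ :+ con (+ 2) :+ h :* h :* (z :* z))))
        refl z z⁻¹ ½ x √x₁ by xx) by xx₁) by ½½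

    u₂v₂ : u₂ * v₂ ≈ 1#
    u₂v₂ = (1# + ½ + ½ + ½ * ½ * z * x + ½ * ½ * ½ * z * z) modulo (- (½ * ½) modulo (½ * ½ modulo
      solve 5 (λ z z⁻¹ h x y →
          (:- (h :* (x :+ y)) :- h :* h :* z) :* (:- (h :* (x :- y)) :- h :* h :* z)
        := ((con (+ 1) :+ (con (+ 1) :+ h :+ h :+ h :* h :* z :* x :+ h :* h :* h :* z :* z) :* (h :+ h :- con (+ 1)))
           :+ :- (h :* h) :* (y :* y :- (z⁻¹ :- con (+ 2) :+ z :* x :+ h :* (z :* z))))
           :+ (h :* h) :* (x :* x :- (z⁻¹ :+ con (+ 2) :+ h :* h :* (z :* z))))
        refl z z⁻¹ ½ x √x₂ by xx) by xx₂) by ½½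

    -- Vieta for the quadratic in τ, whose roots are u₁ + v₁ and u₂ + v₂; `traces-product` is its
    -- other coefficient.
    roots-sum : u₁ + u₂ + (v₁ + v₂) ≈ - z
    roots-sum = (- z * (1# + ½ + ½)) modulo
      solve 5 (λ z h x y t →
          (h :* (x :+ y) :- h :* h :* z) :+ (:- (h :* (x :+ t)) :- h :* h :* z)
            :+ ((h :* (x :- y) :- h :* h :* z) :+ (:- (h :* (x :- t)) :- h :* h :* z))
        := (:- z) :+ (:- z :* (con (+ 1) :+ h :+ h)) :* (h :+ h :- con (+ 1)))
        refl z ½ x √x₁ √x₂ by ½½

    traces-product : (u₁ + v₁) * (u₂ + v₂) ≈ - (z⁻¹ + (1# + 1#))
    traces-product = (- (z⁻¹ + (1# + 1#)) * (1# + ½ + ½)) modulo (- ((½ + ½) * (½ + ½)) modulo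
      solve 6 (λ z z⁻¹ h x y t →
          ((h :* (x :+ y) :- h :* h :* z) :+ (h :* (x :- y) :- h :* h :* z))
            :* ((:- (h :* (x :+ t)) :- h :* h :* z) :+ (:- (h :* (x :- t)) :- h :* h :* z))
        := (:- (z⁻¹ :+ con (+ 2)) :+ (:- (z⁻¹ :+ con (+ 2)) :* (con (+ 1) :+ h :+ h)) :* (h :+ h :- con (+ 1)))
           :+ (:- ((h :+ h) :* (h :+ h))) :* (x :* x :- (z⁻¹ :+ con (+ 2) :+ h :* h :* (z :* z))))
        refl z z⁻¹ ½ x √x₁ √x₂ by xx) by ½½

    module Formulas {s r₁ r₂ ⟨4z⟩⁻¹ ⟨2√2⟩⁻¹ : Carrier}
      (s≈ : s ≈ (1# + 1#) * (z * x)) (r₁≈ : r₁ ≈ √2 * √x₁) (r₂≈ : r₂ ≈ √2 * √x₂)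
      (4z≈ : ⟨4z⟩⁻¹ ≈ ½ * ½ * z⁻¹) (2√2≈ : ⟨2√2⟩⁻¹ ≈ ½ * ½ * √2) where

      s-square : s * s ≈ z ^ 4 + 8 · z ^ 2 + 4 · z
      s-square = trans (*-cong s≈ s≈) ((z ^ 4 * (½ + ½ + 1#)) modulo ((4 · z) modulo (4 · z ^ 2 modulo
        solve 4 (λ z z⁻¹ h x →
            (con (+ 2) :* (z :* x)) :* (con (+ 2) :* (z :* x))
          := ((z :^ 4 :+ 8 :× (z :^ 2) :+ 4 :× z :+ (z :^ 4 :* (h :+ h :+ con (+ 1))) :* (h :+ h :- con (+ 1)))
             :+ (4 :× z) :* (z :* z⁻¹ :- con (+ 1)))
             :+ (4 :× (z :^ 2)) :* (x :* x :- (z⁻¹ :+ con (+ 2) :+ h :* h :* (z :* z))))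
          refl z z⁻¹ ½ x by xx) by zz⁻¹) by ½½)

      r₁-square : r₁ * r₁ ≈ (z ^ 3 - z * s - 4 · z + 2 · 1#) * z⁻¹
      r₁-square = trans (*-cong r₁≈ r₁≈) (trans
        ((√x₁ * √x₁) modulo ((1# + 1#) modulo (z * z modulo (- (z * z - (1# + 1#) * (z * x) - 4 · 1#) modulo
        solve 6 (λ z z⁻¹ h q x y →
            (q :* y) :* (q :* y)
          := ((((z :^ 3 :- z :* (con (+ 2) :* (z :* x)) :- 4 :× z :+ 2 :× con (+ 1)) :* z⁻¹
             :+ (y :* y) :* (q :* q :- con (+ 2)))
             :+ con (+ 2) :* (y :* y :- (z⁻¹ :- con (+ 2) :- z :* x :+ h :* (z :* z))))
             :+ (z :* z) :* (h :+ h :- con (+ 1)))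
             :+ (:- (z :* z :- con (+ 2) :* (z :* x) :- 4 :× con (+ 1))) :* (z :* z⁻¹ :- con (+ 1)))
          refl z z⁻¹ ½ √2 x √x₁ by zz⁻¹) by ½½) by xx₁) by √2√2)
        (CommutativeRing.*-congʳ R (CommutativeRing.+-congʳ R (CommutativeRing.+-congʳ R
          (+-congˡ (-‿cong (*-congˡ (sym s≈))))))))

      r₂-square : r₂ * r₂ ≈ (z ^ 3 + z * s - 4 · z + 2 · 1#) * z⁻¹
      r₂-square = trans (*-cong r₂≈ r₂≈) (trans
        ((√x₂ * √x₂) modulo ((1# + 1#) modulo (z * z modulo (- (z * z + (1# + 1#) * (z * x) - 4 · 1#) modulo
        solve 6 (λ z z⁻¹ h q x y →
            (q :* y) :* (q :* y)
          := ((((z :^ 3 :+ z :* (con (+ 2) :* (z :* x)) :- 4 :× z :+ 2 :× con (+ 1)) :* z⁻¹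
             :+ (y :* y) :* (q :* q :- con (+ 2)))
             :+ con (+ 2) :* (y :* y :- (z⁻¹ :- con (+ 2) :+ z :* x :+ h :* (z :* z))))
             :+ (z :* z) :* (h :+ h :- con (+ 1)))
             :+ (:- (z :* z :+ con (+ 2) :* (z :* x) :- 4 :× con (+ 1))) :* (z :* z⁻¹ :- con (+ 1)))
          refl z z⁻¹ ½ √2 x √x₂ by zz⁻¹) by ½½) by xx₂) by √2√2)
        (CommutativeRing.*-congʳ R (CommutativeRing.+-congʳ R (CommutativeRing.+-congʳ R
          (+-congˡ (*-congˡ (sym s≈)))))))

      u₁-formula : u₁ ≈ (- (z ^ 2) + s) * ⟨4z⟩⁻¹ + ⟨2√2⟩⁻¹ * r₁
      u₁-formula = sym (trans
        (+-cong (*-cong (+-congˡ s≈) 4z≈) (*-cong 2√2≈ r₁≈))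
        ((½ * x + ½ * √x₁) modulo (½ * ½ * √x₁ modulo ((- (z * (½ * ½)) + (1# + 1#) * (½ * ½ * x)) modulo
        solve 6 (λ z z⁻¹ h q x y →
            (:- (z :^ 2) :+ con (+ 2) :* (z :* x)) :* (h :* h :* z⁻¹) :+ (h :* h :* q) :* (q :* y)
          := (((h :* (x :+ y) :- h :* h :* z)
             :+ (h :* x :+ h :* y) :* (h :+ h :- con (+ 1)))
             :+ (h :* h :* y) :* (q :* q :- con (+ 2)))
             :+ (:- (z :* (h :* h)) :+ con (+ 2) :* (h :* h :* x)) :* (z :* z⁻¹ :- con (+ 1)))
          refl z z⁻¹ ½ √2 x √x₁ by zz⁻¹) by √2√2) by ½½))

      u₂-formula : u₂ ≈ (- (z ^ 2) - s) * ⟨4z⟩⁻¹ - ⟨2√2⟩⁻¹ * r₂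
      u₂-formula = sym (trans
        (+-cong (*-cong (+-congˡ (-‿cong s≈)) 4z≈) (-‿cong (*-cong 2√2≈ r₂≈)))
        ((- (½ * x + ½ * √x₂)) modulo (- (½ * ½ * √x₂) modulo ((- (z * (½ * ½)) - (1# + 1#) * (½ * ½ * x)) modulo
        solve 6 (λ z z⁻¹ h q x y →
            (:- (z :^ 2) :- con (+ 2) :* (z :* x)) :* (h :* h :* z⁻¹) :- (h :* h :* q) :* (q :* y)
          := (((:- (h :* (x :+ y)) :- h :* h :* z)
             :+ (:- (h :* x :+ h :* y)) :* (h :+ h :- con (+ 1)))
             :+ (:- (h :* h :* y)) :* (q :* q :- con (+ 2)))
             :+ (:- (z :* (h :* h)) :- con (+ 2) :* (h :* h :* x)) :* (z :* z⁻¹ :- con (+ 1)))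
          refl z z⁻¹ ½ √2 x √x₂ by zz⁻¹) by √2√2) by ½½))

-- Symmetric functions of the roots

module KernelAlgebra (R : CommutativeRing 0ℓ 0ℓ) where
  open RingOps (CommutativeRing.rawRing R)
  open CommutativeRing R using (refl; sym; trans; +-cong)
  open Cancellation R
  open IntegerSolver R using (solve; _:=_; _:+_; _:*_; _:-_; :-_; _:^_; _:×_; con)

  module SymmetricFunctions {z z⁻¹ u₁ u₂ v₁ v₂ : Carrier}
    (zz⁻¹ : z * z⁻¹ ≈ 1#) (u₁v₁ : u₁ * v₁ ≈ 1#) (u₂v₂ : u₂ * v₂ ≈ 1#)
    (roots-sum : u₁ + u₂ + (v₁ + v₂) ≈ - z)
    (traces-product : (u₁ + v₁) * (u₂ + v₂) ≈ - (z⁻¹ + (1# + 1#)))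
    where

    -- `den` is the denominator of h₀ with v₁, v₂ for the inverses of u₁, u₂. `K` is the kernel at y
    -- = 1, whose inverse counts all paths, and `Q` is (y - u₁)(y - u₂) at y = 1.
    σ π σ̄ π̄ den K Q : Carrier
    σ = u₁ + u₂
    π = u₁ * u₂
    σ̄ = v₁ + v₂
    π̄ = v₁ * v₂
    den = 1# + u₁ * u₂ - 2 · z ^ 2 * (u₁ + u₂) - 2 · z
            + 2 · z * (1# - u₁ ^ 2 - u₂ ^ 2) * v₁ * v₂
    K = 1# - (1# + 1#) * z - (1# + 1#) * (z * z)
    Q = (1# - u₁) * (1# - u₂)

    ππ̄ : π * π̄ ≈ 1#
    ππ̄ = 1# modulo (u₁ * v₁ modulo
      solve 4 (λ u₁ u₂ v₁ v₂ → (u₁ :* u₂) :* (v₁ :* v₂)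
        := (con (+ 1) :+ con (+ 1) :* (u₁ :* v₁ :- con (+ 1))) :+ (u₁ :* v₁) :* (u₂ :* v₂ :- con (+ 1)))
        refl u₁ u₂ v₁ v₂ by u₂v₂) by u₁v₁

    σ̄π : σ̄ * π ≈ σ
    σ̄π = u₁ modulo (u₂ modulo
      solve 4 (λ u₁ u₂ v₁ v₂ → (v₁ :+ v₂) :* (u₁ :* u₂)
        := (u₁ :+ u₂ :+ u₁ :* (u₂ :* v₂ :- con (+ 1))) :+ u₂ :* (u₁ :* v₁ :- con (+ 1)))
        refl u₁ u₂ v₁ v₂ by u₁v₁) by u₂v₂

    σπ̄ : σ * π̄ ≈ σ̄
    σπ̄ = v₁ modulo (v₂ modulo
      solve 4 (λ u₁ u₂ v₁ v₂ → (u₁ :+ u₂) :* (v₁ :* v₂)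
        := (v₁ :+ v₂ :+ v₁ :* (u₂ :* v₂ :- con (+ 1))) :+ v₂ :* (u₁ :* v₁ :- con (+ 1)))
        refl u₁ u₂ v₁ v₂ by u₁v₁) by u₂v₂

    -- `roots-sum` multiplied by π. With `z[1+π²+σ²]` it expresses the kernel relations without v₁
    -- and v₂.
    σ[1+π] : σ * (1# + π) ≈ - (z * π)
    σ[1+π] = π modulo (- 1# modulo
      solve 5 (λ z s p s̄ _ → s :* (con (+ 1) :+ p)
        := (:- (z :* p) :+ p :* (s :+ s̄ :- :- z)) :+ (:- con (+ 1)) :* (s̄ :* p :- s))
        refl z σ π σ̄ σ by σ̄π) by roots-sum

    -- The relation π + π̄ + σσ̄ = -1/z multiplied by zπ.
    z[1+π²+σ²] : z * (π * π + 1# + σ * σ) ≈ - π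
    z[1+π²+σ²] = (- π) modulo (- (z * (u₂ * u₂ + u₂ * v₂)) modulo (- (z * (u₁ * u₁ + 1#)) modulo (z * π modulo
      solve 6 (λ z z⁻¹ u₁ u₂ v₁ v₂ →
          z :* ((u₁ :* u₂) :* (u₁ :* u₂) :+ con (+ 1) :+ (u₁ :+ u₂) :* (u₁ :+ u₂))
        := (((:- (u₁ :* u₂)
           :+ (:- (u₁ :* u₂)) :* (z :* z⁻¹ :- con (+ 1)))
           :+ (:- (z :* (u₂ :* u₂ :+ u₂ :* v₂))) :* (u₁ :* v₁ :- con (+ 1)))
           :+ (:- (z :* (u₁ :* u₁ :+ con (+ 1)))) :* (u₂ :* v₂ :- con (+ 1)))
           :+ (z :* (u₁ :* u₂)) :* ((u₁ :+ v₁) :* (u₂ :+ v₂) :- :- (z⁻¹ :+ con (+ 2))))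
        refl z z⁻¹ u₁ u₂ v₁ v₂ by traces-product) by u₂v₂) by u₁v₁) by zz⁻¹

    π+π̄+σσ̄ : π + π̄ + σ * σ̄ ≈ - z⁻¹
    π+π̄+σσ̄ = 1# modulo (1# modulo (1# modulo
      solve 5 (λ z⁻¹ u₁ u₂ v₁ v₂ →
          u₁ :* u₂ :+ v₁ :* v₂ :+ (u₁ :+ u₂) :* (v₁ :+ v₂)
        := ((:- z⁻¹ :+ con (+ 1) :* (u₁ :* v₁ :- con (+ 1))) :+ con (+ 1) :* (u₂ :* v₂ :- con (+ 1)))
           :+ con (+ 1) :* ((u₁ :+ v₁) :* (u₂ :+ v₂) :- :- (z⁻¹ :+ con (+ 2))))
        refl z⁻¹ u₁ u₂ v₁ v₂ by traces-product) by u₂v₂) by u₁v₁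

    σ̄π+σπ̄ : σ̄ * π + σ * π̄ ≈ - z
    σ̄π+σπ̄ = trans (+-cong σ̄π σπ̄) roots-sum

    -- The kernel is z (y² − σ̄ y + π̄) (y² − σ y + π), so sequences with the first
    -- factor as characteristic polynomial solve the recurrence of the kernel.
    kernel-recurrence : ∀ {x₀ x₁ x₂ x₃ x₄} →
      x₂ ≈ σ̄ * x₁ - π̄ * x₀ → x₃ ≈ σ̄ * x₂ - π̄ * x₁ → x₄ ≈ σ̄ * x₃ - π̄ * x₂ →
      x₂ ≈ z * (x₀ + x₄) + z * z * (x₁ + x₃)
    kernel-recurrence {x₀} {x₁} {x₂} {x₃} {x₄} p₂ p₃ p₄ =
      -- The multipliers -zπ, zσ, -z of the three instances are -z times the coefficients of the
      -- complementary factor y² - σy + π. The remaining hypotheses evaluate the coefficients of the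
      -- product of the two factors.
      (- (z * π)) modulo (z * σ modulo (- z modulo
      ((- x₂) modulo (x₂ * z modulo (- (z * x₃) modulo (- (x₁ * z) modulo (z * x₀ modulo
      solve 11 (λ z z⁻¹ s p s̄ p̄ x₀ x₁ x₂ x₃ x₄ → x₂
        := (((((((z :* (x₀ :+ x₄) :+ z :* z :* (x₁ :+ x₃)
           :+ (:- (z :* p)) :* (x₂ :- (s̄ :* x₁ :- p̄ :* x₀)))
           :+ (z :* s) :* (x₃ :- (s̄ :* x₂ :- p̄ :* x₁)))
           :+ (:- z) :* (x₄ :- (s̄ :* x₃ :- p̄ :* x₂)))
           :+ (:- x₂) :* (z :* z⁻¹ :- con (+ 1)))
           :+ (x₂ :* z) :* (p :+ p̄ :+ s :* s̄ :- :- z⁻¹))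
           :+ (:- (z :* x₃)) :* (s :+ s̄ :- :- z))
           :+ (:- (x₁ :* z)) :* (s̄ :* p :+ s :* p̄ :- :- z))
           :+ (z :* x₀) :* (p :* p̄ :- con (+ 1)))
        refl z z⁻¹ σ π σ̄ π̄ x₀ x₁ x₂ x₃ x₄ by ππ̄) by σ̄π+σπ̄) by roots-sum) by π+π̄+σσ̄) by zz⁻¹)
      by p₄) by p₃) by p₂

    -- With these initial values the recurrence run backwards gives F₋₁ = F₁, the evenness that the
    -- path series have.
    F : ℕ → Carrier
    F 0             = 1# + π
    F 1             = σ
    F (suc (suc k)) = σ̄ * F (suc k) - π̄ * F k

    F-recurrence : ∀ k → F (suc (suc k)) ≈ z * (F k + F (4 ℕ.+ k)) + z * z * (F (1 ℕ.+ k) + F (3 ℕ.+ k))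
    F-recurrence k = kernel-recurrence refl refl refl

    F-recurrence₁ : F 1 ≈ z * (F 1 + F 3) + z * z * (F 0 + F 2)
    F-recurrence₁ = kernel-recurrence (sym reflected) refl refl
      where
      reflected : σ̄ * F 0 - π̄ * F 1 ≈ F 1
      reflected = 1# modulo (- 1# modulo
        solve 4 (λ s p s̄ p̄ → s̄ :* (con (+ 1) :+ p) :- p̄ :* s
          := (s :+ con (+ 1) :* (s̄ :* p :- s)) :+ (:- con (+ 1)) :* (s :* p̄ :- s̄))
          refl σ π σ̄ π̄ by σπ̄) by σ̄π

    -- The sequence run backwards has F₋₂ different from F₂, so the symmetrised recurrence fails at
    -- 0; the defect is exactly the denominator of h₀.
    F-recurrence₀ : F 0 ≈ den + z * (F 2 + F 2) + z * z * (F 1 + F 1)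
    F-recurrence₀ = ((1# + 1#) * (z * (v₂ * u₁)) + (1# + 1#) * (z * (u₂ * v₂ - 1#))) modulo ((1# + 1#) * (z * (v₁ * u₂)) modulo
      solve 5 (λ z u₁ u₂ v₁ v₂ →
        let F₀ = con (+ 1) :+ u₁ :* u₂
            F₁ = u₁ :+ u₂
            F₂ = (v₁ :+ v₂) :* F₁ :- (v₁ :* v₂) :* F₀
        in F₀ := ((con (+ 1) :+ u₁ :* u₂ :- 2 :× z :^ 2 :* (u₁ :+ u₂) :- 2 :× z
                    :+ 2 :× z :* (con (+ 1) :- u₁ :^ 2 :- u₂ :^ 2) :* v₁ :* v₂)
                 :+ z :* (F₂ :+ F₂) :+ z :* z :* (F₁ :+ F₁)
                 :+ (con (+ 2) :* (z :* (v₂ :* u₁)) :+ con (+ 2) :* (z :* (u₂ :* v₂ :- con (+ 1)))) :* (u₁ :* v₁ :- con (+ 1)))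
                 :+ (con (+ 2) :* (z :* (v₁ :* u₂))) :* (u₂ :* v₂ :- con (+ 1)))
        refl z u₁ u₂ v₁ v₂ by u₂v₂) by u₁v₁

    -- The factorised kernel at y = 1: the factor with the roots u₁, u₂ takes the value Q there, and
    -- the one with the roots v₁, v₂ the value π̄Q.
    Kπ : K * π ≈ - (z * (Q * Q))
    Kπ = 1# modulo (- ((1# + 1#) * z) modulo
      solve 3 (λ z u₁ u₂ →
        let s = u₁ :+ u₂
            p = u₁ :* u₂
            q = (con (+ 1) :- u₁) :* (con (+ 1) :- u₂)
        in (con (+ 1) :- con (+ 2) :* z :- con (+ 2) :* (z :* z)) :* p
        := (:- (z :* (q :* q))
           :+ con (+ 1) :* (z :* (p :* p :+ con (+ 1) :+ s :* s) :- :- p))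
           :+ (:- (con (+ 2) :* z)) :* (s :* (con (+ 1) :+ p) :- :- (z :* p)))
        refl z u₁ u₂ by σ[1+π]) by z[1+π²+σ²]

    -- Since 1 + π + σ = (1 + u₁)(1 + u₂), the right side is -z(π - 1)(1 - u₁²)(1 - u₂²). What
    -- matters is that it shares the factor Q with `Kπ`.
    denπ : den * π ≈ - (z * ((π - 1#) * Q * (1# + π + σ)))
    denπ = (1# + π) modulo (- ((1# + 1#) * (z * σ)) modulo ((1# + 1#) * (z * (1# - u₁ * u₁ - u₂ * u₂)) modulo
      solve 5 (λ z u₁ u₂ v₁ v₂ →
        let s = u₁ :+ u₂
            p = u₁ :* u₂
            q = (con (+ 1) :- u₁) :* (con (+ 1) :- u₂)
        in (con (+ 1) :+ u₁ :* u₂ :- 2 :× z :^ 2 :* (u₁ :+ u₂) :- 2 :× z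
             :+ 2 :× z :* (con (+ 1) :- u₁ :^ 2 :- u₂ :^ 2) :* v₁ :* v₂) :* p
        := ((:- (z :* ((p :- con (+ 1)) :* q :* (con (+ 1) :+ p :+ s)))
           :+ (con (+ 1) :+ p) :* (z :* (p :* p :+ con (+ 1) :+ s :* s) :- :- p))
           :+ (:- (con (+ 2) :* (z :* s))) :* (s :* (con (+ 1) :+ p) :- :- (z :* p)))
           :+ (con (+ 2) :* (z :* (con (+ 1) :- u₁ :* u₁ :- u₂ :* u₂))) :* (p :* (v₁ :* v₂) :- con (+ 1)))
        refl z u₁ u₂ v₁ v₂ by ππ̄) by σ[1+π]) by z[1+π²+σ²]

    -- This is `doubled` with A = 1/K, g₀ = (1 + π)/den and the denominators cleared. Multiplied by
    -- π, the left side becomes -zQ² times a polynomial in σ and π that is identically zero.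
    boundary : Q * den + K * Q * (1# + π) - (1# + 1#) * (K * (1# + π) * π) + (1# + 1#) * (K * σ) ≈ 0#
    -- The left side Y occurs in its own cofactor: Y = ππ̄Y - Y(ππ̄ - 1), which reduces the claim to
    -- πY.
    boundary = (- Y) modulo (π̄ * Q modulo (π̄ * (Q * (1# + π) - (1# + 1#) * ((1# + π) * π) + (1# + 1#) * σ) modulo
      solve 6 (λ z u₁ u₂ p̄ K den →
        let s = u₁ :+ u₂
            p = u₁ :* u₂
            q = (con (+ 1) :- u₁) :* (con (+ 1) :- u₂)
            y = q :* den :+ K :* q :* (con (+ 1) :+ p) :- con (+ 2) :* (K :* (con (+ 1) :+ p) :* p) :+ con (+ 2) :* (K :* s)
        in y
        := ((con (+ 0) :+ (:- y) :* (p :* p̄ :- con (+ 1)))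
           :+ (p̄ :* q) :* (den :* p :- :- (z :* ((p :- con (+ 1)) :* q :* (con (+ 1) :+ p :+ s)))))
           :+ (p̄ :* (q :* (con (+ 1) :+ p) :- con (+ 2) :* ((con (+ 1) :+ p) :* p) :+ con (+ 2) :* s))
              :* (K :* p :- :- (z :* (q :* q))))
        refl z u₁ u₂ π̄ K den by Kπ) by denπ) by ππ̄
      where Y = Q * den + K * Q * (1# + π) - (1# + 1#) * (K * (1# + π) * π) + (1# + 1#) * (K * σ)

    -- g₀ and A stand for the series of the paths ending on the axis and of all paths.
    module HalfPlane {ρ g₀ A : Carrier} ([1+π]ρ : (1# + π) * ρ ≈ 1#) (g₀den : g₀ * den ≈ 1# + π) (AK : A * K ≈ 1#) where

      c : Carrier
      c = σ * ρ

      c[1+π] : c * (1# + π) ≈ σ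
      c[1+π] = σ modulo
        solve 3 (λ s p r → s :* r :* (con (+ 1) :+ p) := s :+ s :* ((con (+ 1) :+ p) :* r :- con (+ 1)))
          refl σ π ρ by [1+π]ρ

      -- Read off from Kπ = -zQ² and AK = 1; it shows that the denominator of the generating
      -- function is not zero.
      Q-inverse : Q * (- (z * Q * A * π̄)) ≈ 1#
      Q-inverse = 1# modulo (A * K modulo (- (A * π̄) modulo
        solve 6 (λ z q A p p̄ K → q :* (:- (z :* q :* A :* p̄))
          := ((con (+ 1) :+ con (+ 1) :* (A :* K :- con (+ 1)))
             :+ (A :* K) :* (p :* p̄ :- con (+ 1)))
             :+ (:- (A :* p̄)) :* (K :* p :- :- (z :* (q :* q))))
          refl z Q A π π̄ K by Kπ) by ππ̄) by AK

      doubled : (A + g₀) * Q ≈ (1# + 1#) * (g₀ * (π - c))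
      -- The difference X of the two sides is multiplied by the units AK and (1 + π)ρ, after which
      -- the hypotheses turn it into a multiple of `boundary`; hence the cofactors that contain X.
      doubled = (A * ρ * g₀) modulo ((A * ρ * g₀ * Q * den - X * (1# + π) * ρ)
        modulo ((A * ρ * g₀ * K * (Q - (1# + 1#) * π + (1# + 1#) * c) - A * K * ρ * X)
        modulo (((1# + 1#) * (K * A * ρ * g₀)) modulo ((- X) modulo
        solve 9 (λ A g ρ q d K p s c →
          let x = (A :+ g) :* q :- con (+ 2) :* (g :* (p :- c))
              y = q :* d :+ K :* q :* (con (+ 1) :+ p) :- con (+ 2) :* (K :* (con (+ 1) :+ p) :* p) :+ con (+ 2) :* (K :* s)
          in (A :+ g) :* q
          := ((((con (+ 2) :* (g :* (p :- c))
             :+ (A :* ρ :* g) :* (y :- con (+ 0)))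
             :+ (A :* ρ :* g :* q :* d :- x :* (con (+ 1) :+ p) :* ρ) :* (A :* K :- con (+ 1)))
             :+ (A :* ρ :* g :* K :* (q :- con (+ 2) :* p :+ con (+ 2) :* c) :- A :* K :* ρ :* x)
                :* (g :* d :- (con (+ 1) :+ p)))
             :+ (con (+ 2) :* (K :* A :* ρ :* g)) :* (c :* (con (+ 1) :+ p) :- s))
             :+ (:- x) :* ((con (+ 1) :+ p) :* ρ :- con (+ 1)))
          refl A g₀ ρ Q den K π σ c by [1+π]ρ) by c[1+π]) by g₀den) by AK) by boundary
        where X = (A + g₀) * Q - (1# + 1#) * (g₀ * (π - c))

      halved : ∀ {½ T} → ½ + ½ ≈ 1# → T + T ≈ A + g₀ → T * Q ≈ g₀ * u₁ * u₂ - c * g₀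
      halved {½} {T} ½½ TT = ½ modulo (½ * Q modulo ((- (T * Q - g₀ * (π - c))) modulo
        solve 8 (λ A g q u₁ u₂ c h T →
          T :* q
          := ((g :* u₁ :* u₂ :- c :* g
             :+ h :* ((A :+ g) :* q :- con (+ 2) :* (g :* (u₁ :* u₂ :- c))))
             :+ (h :* q) :* (T :+ T :- (A :+ g)))
             :+ (:- (T :* q :- g :* (u₁ :* u₂ :- c))) :* (h :+ h :- con (+ 1)))
          refl A g₀ Q u₁ u₂ c ½ T by ½½) by TT) by doubled

-- Comparison of the path series with F

module KernelMethod {KK R : CommutativeRing 0ℓ 0ℓ} (E : Embedding KK R) where
  open RingOps (CommutativeRing.rawRing R)
  open CommutativeRing R using (refl; sym; trans; +-cong; *-congˡ; *-congʳ; +-congˡ; +-congʳ; -‿cong)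
  open Embedding E using (w)
  open Integrality E
  open Cancellation R
  open IntegerSolver R using (solve; _:=_; _:+_; _:*_; _:-_; :-_; con)

  module Kernel {z z⁻¹ u₁ u₂ v₁ v₂ : Carrier} (z≈ : z ≈ w * w)
    (zz⁻¹ : z * z⁻¹ ≈ 1#) (u₁v₁ : u₁ * v₁ ≈ 1#) (u₂v₂ : u₂ * v₂ ≈ 1#)
    (roots-sum : u₁ + u₂ + (v₁ + v₂) ≈ - z)
    (traces-product : (u₁ + v₁) * (u₂ + v₂) ≈ - (z⁻¹ + (1# + 1#)))
    (wu₁ : Int (w * u₁)) (wu₂ : Int (w * u₂)) (int-v₁ : Int v₁) (int-v₂ : Int v₂)
    where
    private
      module SF = KernelAlgebra.SymmetricFunctions R zz⁻¹ u₁v₁ u₂v₂ roots-sum traces-product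
      open SF using (F; den)

      infixl 6 _⊕_
      infixl 7 _⊛_
      _⊕_ : ∀ {x y} → Int x → Int y → Int (x + y)
      _⊕_ = O-+ 0
      _⊛_ : ∀ {x y} → Int x → Int y → Int (x * y)
      _⊛_ = O-* 0 0

      O1-z : O 1 z
      -- z is even divisible by w²; one factor per round is enough for `vanish`.
      O1-z = O-resp 1 (sym z≈) (O-* 1 0 O1-w Int-w)

      Int-z : Int z
      Int-z = O-resp 0 (sym z≈) (Int-w ⊛ Int-w)

      -- F₀ contains u₁u₂ with its pole w⁻². One factor z removes it, and the coefficients of the
      -- recurrence of F have no poles, so none arises later.
      Int-zF : ∀ k → Int (z * F k)
      Int-zF 0 = O-resp 0 (trans
        (solve 4 (λ z w a b → z :+ (w :* a) :* (w :* b) := z :+ (w :* w) :* (a :* b)) refl z w u₁ u₂)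
        (trans (+-congˡ (*-congʳ (sym z≈)))
          (solve 3 (λ z a b → z :+ z :* (a :* b) := z :* (con (+ 1) :+ a :* b)) refl z u₁ u₂)))
        (Int-z ⊕ wu₁ ⊛ wu₂)
      Int-zF 1 = O-resp 0 (trans
        (solve 3 (λ w a b → w :* (w :* a :+ w :* b) := (w :* w) :* (a :+ b)) refl w u₁ u₂)
        (*-congʳ (sym z≈))) (Int-w ⊛ (wu₁ ⊕ wu₂))
      Int-zF (suc (suc k)) = O-resp 0
        (solve 5 (λ z a b x y → (a :+ b) :* (z :* x) :+ :- ((a :* b) :* (z :* y)) := z :* ((a :+ b) :* x :- (a :* b) :* y))
          refl z v₁ v₂ (F (suc k)) (F k))
        ((int-v₁ ⊕ int-v₂) ⊛ Int-zF (suc k) ⊕ O-neg 0 ((int-v₁ ⊛ int-v₂) ⊛ Int-zF k))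

      Int-z*den : Int (z * den)
      Int-z*den = O-resp 0
        (trans (+-congʳ (+-congʳ refl)) (sym (trans (*-congˡ den≈)
          (solve 4 (λ z f₀ f₁ f₂ → z :* (f₀ :- z :* (f₂ :+ f₂) :- z :* z :* (f₁ :+ f₁))
            := z :* f₀ :- z :* (z :* f₂ :+ z :* f₂) :- z :* z :* (z :* f₁ :+ z :* f₁)) refl z (F 0) (F 1) (F 2)))))
        (Int-zF 0 ⊕ O-neg 0 (Int-z ⊛ (Int-zF 2 ⊕ Int-zF 2)) ⊕ O-neg 0 (Int-z ⊛ Int-z ⊛ (Int-zF 1 ⊕ Int-zF 1)))
        where
        den≈ : den ≈ F 0 - z * (F 2 + F 2) - z * z * (F 1 + F 1)
        den≈ = (- 1#) modulo
          solve 5 (λ d z f₀ f₁ f₂ → d := f₀ :- z :* (f₂ :+ f₂) :- z :* z :* (f₁ :+ f₁)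
            :+ (:- con (+ 1)) :* (f₀ :- (d :+ z :* (f₂ :+ f₂) :+ z :* z :* (f₁ :+ f₁))))
            refl den z (F 0) (F 1) (F 2) by SF.F-recurrence₀

    -- Both g k · den and F k solve the recurrence of the kernel with the same boundary
    -- term, so z times their difference is divisible by every power of w.
    module _ (g : ℕ → Carrier) (int-g : ∀ k → Int (g k))
      (g-recurrence₀ : g 0 ≈ 1# + z * (g 2 + g 2) + z * z * (g 1 + g 1))
      (g-recurrence₁ : g 1 ≈ z * (g 1 + g 3) + z * z * (g 0 + g 2))
      (g-recurrence : ∀ k → g (2 ℕ.+ k) ≈ z * (g k + g (4 ℕ.+ k)) + z * z * (g (1 ℕ.+ k) + g (3 ℕ.+ k)))
      where
      private
        d : ℕ → Carrier
        d k = z * (g k * den - F k)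

        difference : ∀ {x y a b a′ b′ p q p′ q′} →
          x ≈ z * (a + b) + z * z * (p + q) → y ≈ z * (a′ + b′) + z * z * (p′ + q′) →
          z * (x * den - y) ≈ z * (z * (a * den - a′) + z * (b * den - b′))
                              + z * (z * (z * (p * den - p′) + z * (q * den - q′)))
        difference {x} {y} {a} {b} {a′} {b′} {p} {q} {p′} {q′} eq eq′ = trans
          (*-congˡ (+-cong (*-congʳ eq) (-‿cong eq′)))
          (solve 10 (λ z D a b a′ b′ p q p′ q′ →
              z :* ((z :* (a :+ b) :+ z :* z :* (p :+ q)) :* D :- (z :* (a′ :+ b′) :+ z :* z :* (p′ :+ q′)))
            := z :* (z :* (a :* D :- a′) :+ z :* (b :* D :- b′))
               :+ z :* (z :* (z :* (p :* D :- p′) :+ z :* (q :* D :- q′))))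
            refl z den a b a′ b′ p q p′ q′)

        d-recurrence₀ : d 0 ≈ z * (d 2 + d 2) + z * (z * (d 1 + d 1))
        d-recurrence₀ = trans
          (*-congˡ (+-cong (*-congʳ g-recurrence₀) (-‿cong (SF.F-recurrence₀))))
          (solve 6 (λ z D a a′ p p′ →
              z :* ((con (+ 1) :+ z :* (a :+ a) :+ z :* z :* (p :+ p)) :* D :- (D :+ z :* (a′ :+ a′) :+ z :* z :* (p′ :+ p′)))
            := z :* (z :* (a :* D :- a′) :+ z :* (a :* D :- a′))
               :+ z :* (z :* (z :* (p :* D :- p′) :+ z :* (p :* D :- p′))))
            refl z den (g 2) (F 2) (g 1) (F 1))

        gain-step : ∀ n {x a b p q} → x ≈ z * (a + b) + z * (z * (p + q)) →
                    O n a → O n b → O n p → O n q → O (suc n) x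
        gain-step n eq oa ob op oq = O-resp (suc n) (sym eq)
          (O-+ (suc n) (O-* 1 n O1-z (O-+ n oa ob)) (O-* 1 n O1-z (O-* 0 n Int-z (O-+ n op oq))))

        gain : ∀ n → (∀ k → O n (d k)) → ∀ k → O (suc n) (d k)
        gain n o 0 = gain-step n d-recurrence₀ (o 2) (o 2) (o 1) (o 1)
        gain n o 1 = gain-step n (difference g-recurrence₁ (SF.F-recurrence₁))
          (o 1) (o 3) (o 0) (o 2)
        gain n o (suc (suc k)) = gain-step n
          (difference (g-recurrence k) (SF.F-recurrence k))
          (o k) (o (4 ℕ.+ k)) (o (1 ℕ.+ k)) (o (3 ℕ.+ k))

        Int-d : ∀ k → Int (d k)
        Int-d k = O-resp 0
          (solve 4 (λ z g D f → g :* (z :* D) :+ :- (z :* f) := z :* (g :* D :- f)) refl z (g k) den (F k))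
          (int-g k ⊛ Int-z*den ⊕ O-neg 0 (Int-zF k))

      kernel-method : g 0 * den ≈ F 0
      -- `vanish` at 0 annihilates z times the difference, and z is a unit.
      kernel-method = z⁻¹ modulo ((- (g 0 * den - F 0)) modulo
        solve 4 (λ z z⁻¹ x y → x := (y :+ z⁻¹ :* (z :* (x :- y) :- con (+ 0))) :+ (:- (x :- y)) :* (z :* z⁻¹ :- con (+ 1)))
          refl z z⁻¹ (g 0 * den) (F 0) by zz⁻¹) by vanish d Int-d gain 0

-- Counting paths with weights on the altitude

module Paths where
  open ≡ using (refl; sym; trans; cong; cong₂; subst; subst₂; module ≡-Reasoning)
  open import Data.Nat.Base using (_≤_)
  open import Algebra.Properties.CommutativeSemigroup ℕₚ.+-commutativeSemigroup using (interchange)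
  open import Algebra.Properties.Group (AbelianGroup.group ℤₚ.+-0-abelianGroup) using (∙-cancelˡ)
  open import Defs using (Step; N; N̄; E; Ē; size; altitude; NonNegativePath)

  spread : ℤ → (ℤ → ℕ) → ℤ → ℕ
  spread s f x = f (s ℤ.+ x) ℕ.+ f (ℤ.- s ℤ.+ x)

  -- The sum of f (altitude p) over all grand knight's paths p of size n.
  pathSum : ℕ → (ℤ → ℕ) → ℕ
  pathSum zero          f = f 0ℤ
  pathSum (suc zero)    f = spread (+ 2) f 0ℤ
  pathSum (suc (suc n)) f = pathSum (suc n) (spread (+ 2) f) ℕ.+ pathSum n (spread (+ 1) f)

  -- The type counted by `pathSum`, with a predicate in place of the weight. For the predicate
  -- `0ℤ ℤ.≤_` it is `NonNegativePath` by definition.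
  PathTo : (ℤ → Set) → ℕ → Set
  PathTo P n = Σ (List Step) λ p → (size p ≡ + n) × P (altitude p)

  Spread : ℤ → (ℤ → Set) → ℤ → Set
  Spread s P x = P (s ℤ.+ x) ⊎ P (ℤ.- s ℤ.+ x)

  private
    size-nonneg : ∀ p → ∃ λ m → size p ≡ + m
    size-nonneg []      = 0 , refl
    size-nonneg (N ∷ p) = let (m , eq) = size-nonneg p in suc m , cong (ℤ._+_ (+ 1)) eq
    size-nonneg (N̄ ∷ p) = let (m , eq) = size-nonneg p in suc m , cong (ℤ._+_ (+ 1)) eq
    size-nonneg (E ∷ p) = let (m , eq) = size-nonneg p in suc (suc m) , cong (ℤ._+_ (+ 2)) eq
    size-nonneg (Ē ∷ p) = let (m , eq) = size-nonneg p in suc (suc m) , cong (ℤ._+_ (+ 2)) eq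

    1+size≢0 : ∀ p → + 1 ℤ.+ size p ≡ + 0 → ⊥
    1+size≢0 p eq with size p | size-nonneg p
    1+size≢0 p () | _ | (m , refl)

    2+size≢0 : ∀ p → + 2 ℤ.+ size p ≡ + 0 → ⊥
    2+size≢0 p eq with size p | size-nonneg p
    2+size≢0 p () | _ | (m , refl)

    2+size≢1 : ∀ p → + 2 ℤ.+ size p ≡ + 1 → ⊥
    2+size≢1 p eq with size p | size-nonneg p
    2+size≢1 p () | _ | (m , refl)

    cancel₁ : ∀ {i n} → + 1 ℤ.+ i ≡ + suc n → i ≡ + n
    cancel₁ {i} {n} = ∙-cancelˡ (+ 1) i (+ n)

    cancel₂ : ∀ {i n} → + 2 ℤ.+ i ≡ + suc (suc n) → i ≡ + n
    cancel₂ {i} {n} = ∙-cancelˡ (+ 2) i (+ n)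

    same-path : ∀ {P : ℤ → Set} {n p} {e e′ : size p ≡ + n} {x : P (altitude p)} →
                _≡_ {A = PathTo P n} (p , e , x) (p , e′ , x)
    same-path {p = p} {x = x} = cong (λ e → p , e , x) (uip _ _)

  PathTo-0 : ∀ P → PathTo P 0 ↔ P 0ℤ
  PathTo-0 P = mk↔ₛ′ to (λ x → [] , refl , x) (λ _ → refl) from∘to
    where
    to : PathTo P 0 → P 0ℤ
    to ([] , _ , x)    = x
    to (N ∷ p , e , _) = ⊥-elim (1+size≢0 p e)
    to (N̄ ∷ p , e , _) = ⊥-elim (1+size≢0 p e)
    to (E ∷ p , e , _) = ⊥-elim (2+size≢0 p e)
    to (Ē ∷ p , e , _) = ⊥-elim (2+size≢0 p e)

    from∘to : ∀ p → ([] , refl , to p) ≡ p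
    from∘to ([] , refl , x) = refl
    from∘to (N ∷ p , e , _) = ⊥-elim (1+size≢0 p e)
    from∘to (N̄ ∷ p , e , _) = ⊥-elim (1+size≢0 p e)
    from∘to (E ∷ p , e , _) = ⊥-elim (2+size≢0 p e)
    from∘to (Ē ∷ p , e , _) = ⊥-elim (2+size≢0 p e)

  PathTo-1 : ∀ P → PathTo P 1 ↔ PathTo (Spread (+ 2) P) 0
  PathTo-1 P = mk↔ₛ′ to from to∘from from∘to
    where
    to : PathTo P 1 → PathTo (Spread (+ 2) P) 0
    to (N ∷ p , e , x) = p , cancel₁ e , inj₁ x
    to (N̄ ∷ p , e , x) = p , cancel₁ e , inj₂ x
    to (E ∷ p , e , _) = ⊥-elim (2+size≢1 p e)
    to (Ē ∷ p , e , _) = ⊥-elim (2+size≢1 p e)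

    from : PathTo (Spread (+ 2) P) 0 → PathTo P 1
    from (p , e , inj₁ x) = N ∷ p , cong (ℤ._+_ (+ 1)) e , x
    from (p , e , inj₂ x) = N̄ ∷ p , cong (ℤ._+_ (+ 1)) e , x

    to∘from : ∀ q → to (from q) ≡ q
    to∘from (p , e , inj₁ x) = same-path {Spread (+ 2) P}
    to∘from (p , e , inj₂ x) = same-path {Spread (+ 2) P}

    from∘to : ∀ q → from (to q) ≡ q
    from∘to (N ∷ p , e , x) = same-path {P} {p = N ∷ p}
    from∘to (N̄ ∷ p , e , x) = same-path {P} {p = N̄ ∷ p}
    from∘to (E ∷ p , e , _) = ⊥-elim (2+size≢1 p e)
    from∘to (Ē ∷ p , e , _) = ⊥-elim (2+size≢1 p e)

  PathTo-2+ : ∀ P n → PathTo P (2 ℕ.+ n) ↔ (PathTo (Spread (+ 2) P) (suc n) ⊎ PathTo (Spread (+ 1) P) n)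
  PathTo-2+ P n = mk↔ₛ′ to from to∘from from∘to
    where
    to : PathTo P (2 ℕ.+ n) → PathTo (Spread (+ 2) P) (suc n) ⊎ PathTo (Spread (+ 1) P) n
    to (N ∷ p , e , x) = inj₁ (p , cancel₁ e , inj₁ x)
    to (N̄ ∷ p , e , x) = inj₁ (p , cancel₁ e , inj₂ x)
    to (E ∷ p , e , x) = inj₂ (p , cancel₂ e , inj₁ x)
    to (Ē ∷ p , e , x) = inj₂ (p , cancel₂ e , inj₂ x)

    from : PathTo (Spread (+ 2) P) (suc n) ⊎ PathTo (Spread (+ 1) P) n → PathTo P (2 ℕ.+ n)
    from (inj₁ (p , e , inj₁ x)) = N ∷ p , cong (ℤ._+_ (+ 1)) e , x
    from (inj₁ (p , e , inj₂ x)) = N̄ ∷ p , cong (ℤ._+_ (+ 1)) e , x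
    from (inj₂ (p , e , inj₁ x)) = E ∷ p , cong (ℤ._+_ (+ 2)) e , x
    from (inj₂ (p , e , inj₂ x)) = Ē ∷ p , cong (ℤ._+_ (+ 2)) e , x

    to∘from : ∀ q → to (from q) ≡ q
    to∘from (inj₁ (p , e , inj₁ x)) = cong inj₁ (same-path {Spread (+ 2) P})
    to∘from (inj₁ (p , e , inj₂ x)) = cong inj₁ (same-path {Spread (+ 2) P})
    to∘from (inj₂ (p , e , inj₁ x)) = cong inj₂ (same-path {Spread (+ 1) P})
    to∘from (inj₂ (p , e , inj₂ x)) = cong inj₂ (same-path {Spread (+ 1) P})

    from∘to : ∀ q → from (to q) ≡ q
    from∘to (N ∷ p , e , x) = same-path {P} {p = N ∷ p}
    from∘to (N̄ ∷ p , e , x) = same-path {P} {p = N̄ ∷ p}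
    from∘to (E ∷ p , e , x) = same-path {P} {p = E ∷ p}
    from∘to (Ē ∷ p , e , x) = same-path {P} {p = Ē ∷ p}

  -- Runs along the recursion of `pathSum`, which removes the first step; sums of cardinalities are
  -- matched by disjoint unions.
  pathSum-counts : ∀ n {P f} → (∀ x → Fin (f x) ↔ P x) → Fin (pathSum n f) ↔ PathTo P n
  pathSum-counts n {P} {f} counts = go n counts
    where
    spread-counts : ∀ s {P f} → (∀ x → Fin (f x) ↔ P x) → ∀ x → Fin (spread s f x) ↔ Spread s P x
    spread-counts s counts x = (counts _ ⊎-↔ counts _) ↔-∘ Finₚ.+↔⊎

    go : ∀ n {P f} → (∀ x → Fin (f x) ↔ P x) → Fin (pathSum n f) ↔ PathTo P n
    go zero          {P} counts = ↔-sym (PathTo-0 P) ↔-∘ counts 0ℤ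
    go (suc zero)    {P} counts = ↔-sym (PathTo-1 P) ↔-∘ (↔-sym (PathTo-0 (Spread (+ 2) P)) ↔-∘ spread-counts (+ 2) counts 0ℤ)
    go (suc (suc n)) {P} counts =
      ↔-sym (PathTo-2+ P n) ↔-∘ ((go (suc n) (spread-counts (+ 2) counts) ⊎-↔ go n (spread-counts (+ 1) counts)) ↔-∘ Finₚ.+↔⊎)

  nonneg : ℤ → ℕ
  nonneg (+ _)    = 1
  nonneg -[1+ _ ] = 0

  nonneg-counts : ∀ x → Fin (nonneg x) ↔ (0ℤ ℤ.≤ x)
  nonneg-counts (+ n)    = mk↔ₛ′ (λ _ → ℤ.+≤+ ℕ.z≤n) (λ _ → zero) (λ _ → ℤₚ.≤-irrelevant _ _) λ { zero → refl }
  nonneg-counts -[1+ n ] = mk↔ₛ′ (λ ()) (λ ()) (λ ()) (λ ())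

  nonNegativePaths : ∀ (t : ℕ → ℕ) → (∀ n → Fin (t n) ↔ NonNegativePath n) → ∀ n → t n ≡ pathSum n nonneg
  nonNegativePaths t count n = Perm.↔⇒≡ (↔-sym (pathSum-counts n nonneg-counts) ↔-∘ count n)

  spread-cong : ∀ s {f g} → (∀ x → f x ≡ g x) → ∀ x → spread s f x ≡ spread s g x
  spread-cong s eq x = cong₂ ℕ._+_ (eq _) (eq _)

  pathSum-cong : ∀ n {f g} → (∀ x → f x ≡ g x) → pathSum n f ≡ pathSum n g
  pathSum-cong zero          eq = eq 0ℤ
  pathSum-cong (suc zero)    eq = spread-cong (+ 2) eq 0ℤ
  pathSum-cong (suc (suc n)) eq =
    cong₂ ℕ._+_ (pathSum-cong (suc n) (spread-cong (+ 2) eq)) (pathSum-cong n (spread-cong (+ 1) eq))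

  spread-+ : ∀ s f g x → spread s (λ y → f y ℕ.+ g y) x ≡ spread s f x ℕ.+ spread s g x
  spread-+ s f g x = interchange (f (s ℤ.+ x)) (g (s ℤ.+ x)) (f (ℤ.- s ℤ.+ x)) (g (ℤ.- s ℤ.+ x))

  pathSum-+ : ∀ n f g → pathSum n (λ x → f x ℕ.+ g x) ≡ pathSum n f ℕ.+ pathSum n g
  pathSum-+ zero          f g = refl
  pathSum-+ (suc zero)    f g = spread-+ (+ 2) f g 0ℤ
  pathSum-+ (suc (suc n)) f g = trans
    (cong₂ ℕ._+_
      (trans (pathSum-cong (suc n) (spread-+ (+ 2) f g)) (pathSum-+ (suc n) (spread (+ 2) f) (spread (+ 2) g)))
      (trans (pathSum-cong n (spread-+ (+ 1) f g)) (pathSum-+ n (spread (+ 1) f) (spread (+ 1) g))))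
    (interchange (pathSum (suc n) (spread (+ 2) f)) (pathSum (suc n) (spread (+ 2) g))
                 (pathSum n (spread (+ 1) f)) (pathSum n (spread (+ 1) g)))

  spread-reflect : ∀ s f x → spread s (λ y → f (ℤ.- y)) x ≡ spread s f (ℤ.- x)
  spread-reflect s f x = trans (ℕₚ.+-comm (f (ℤ.- (s ℤ.+ x))) (f (ℤ.- (ℤ.- s ℤ.+ x))))
    (cong₂ (λ a b → f a ℕ.+ f b) (lemma₁ s x) (lemma₂ s x))
    where
    lemma₁ : ∀ s x → ℤ.- (ℤ.- s ℤ.+ x) ≡ s ℤ.+ ℤ.- x
    lemma₁ = ℤ-solver.solve-∀
    lemma₂ : ∀ s x → ℤ.- (s ℤ.+ x) ≡ ℤ.- s ℤ.+ ℤ.- x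
    lemma₂ = ℤ-solver.solve-∀

  -- Reflection exchanges N with N̄ and E with Ē, that is, the two summands of each `spread`.
  pathSum-reflect : ∀ n f → pathSum n (λ x → f (ℤ.- x)) ≡ pathSum n f
  pathSum-reflect zero          f = refl
  pathSum-reflect (suc zero)    f = spread-reflect (+ 2) f 0ℤ
  pathSum-reflect (suc (suc n)) f = cong₂ ℕ._+_
    (trans (pathSum-cong (suc n) (spread-reflect (+ 2) f)) (pathSum-reflect (suc n) (spread (+ 2) f)))
    (trans (pathSum-cong n (spread-reflect (+ 1) f)) (pathSum-reflect n (spread (+ 1) f)))

  one δ₀ : ℤ → ℕ
  one _ = 1
  δ₀ (+ zero)  = 1
  δ₀ (+ suc _) = 0
  δ₀ -[1+ _ ]  = 0

  δ : ℤ → ℤ → ℕ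
  δ k x = δ₀ (x ℤ.- k)

  δ₀-even : ∀ x → δ₀ (ℤ.- x) ≡ δ₀ x
  δ₀-even (+ zero)  = refl
  δ₀-even (+ suc n) = refl
  δ₀-even -[1+ n ]  = refl

  spread-δ : ∀ s k x → spread s (δ k) x ≡ δ (k ℤ.- s) x ℕ.+ δ (k ℤ.+ s) x
  spread-δ s k x = cong₂ (λ a b → δ₀ a ℕ.+ δ₀ b) (lemma₁ s k x) (lemma₂ s k x)
    where
    lemma₁ : ∀ s k x → s ℤ.+ x ℤ.- k ≡ x ℤ.- (k ℤ.- s)
    lemma₁ = ℤ-solver.solve-∀
    lemma₂ : ∀ s k x → ℤ.- s ℤ.+ x ℤ.- k ≡ x ℤ.- (k ℤ.+ s)
    lemma₂ = ℤ-solver.solve-∀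

  pathSum-δ-even : ∀ n k → pathSum n (δ (ℤ.- k)) ≡ pathSum n (δ k)
  pathSum-δ-even n k = trans
    (pathSum-cong n λ x → trans (sym (δ₀-even (x ℤ.- ℤ.- k))) (cong δ₀ (lemma k x)))
    (pathSum-reflect n (δ k))
    where
    lemma : ∀ k x → ℤ.- (x ℤ.- ℤ.- k) ≡ ℤ.- x ℤ.- k
    lemma = ℤ-solver.solve-∀

  nonneg-reflect : ∀ x → nonneg x ℕ.+ nonneg (ℤ.- x) ≡ one x ℕ.+ δ₀ x
  nonneg-reflect (+ zero)  = refl
  nonneg-reflect (+ suc n) = refl
  nonneg-reflect -[1+ n ]  = refl

  twice-nonneg : ∀ n → pathSum n nonneg ℕ.+ pathSum n nonneg ≡ pathSum n one ℕ.+ pathSum n δ₀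
  twice-nonneg n = begin
    pathSum n nonneg ℕ.+ pathSum n nonneg
      ≡⟨ cong (pathSum n nonneg ℕ.+_) (pathSum-reflect n nonneg) ⟨
    pathSum n nonneg ℕ.+ pathSum n (λ x → nonneg (ℤ.- x))
      ≡⟨ pathSum-+ n nonneg (λ x → nonneg (ℤ.- x)) ⟨
    pathSum n (λ x → nonneg x ℕ.+ nonneg (ℤ.- x))
      ≡⟨ pathSum-cong n nonneg-reflect ⟩
    pathSum n (λ x → one x ℕ.+ δ₀ x)
      ≡⟨ pathSum-+ n one δ₀ ⟩
    pathSum n one ℕ.+ pathSum n δ₀ ∎
    where open ≡-Reasoning

  total : ℕ → ℕ
  total n = pathSum n one

  total-rec : ∀ n → total (2 ℕ.+ n) ≡ (total (suc n) ℕ.+ total (suc n)) ℕ.+ (total n ℕ.+ total n)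
  total-rec n = cong₂ ℕ._+_ (pathSum-+ (suc n) one one) (pathSum-+ n one one)

  iterate : ℤ → ℕ → (ℤ → ℕ) → ℤ → ℕ
  iterate s zero    f = f
  iterate s (suc m) f = spread s (iterate s m f)

  spread-comm : ∀ s t f x → spread s (spread t f) x ≡ spread t (spread s f) x
  spread-comm s t f x = trans
    (interchange (f (t ℤ.+ (s ℤ.+ x))) (f (ℤ.- t ℤ.+ (s ℤ.+ x))) (f (t ℤ.+ (ℤ.- s ℤ.+ x))) (f (ℤ.- t ℤ.+ (ℤ.- s ℤ.+ x))))
    (cong₂ ℕ._+_ (cong₂ (λ a b → f a ℕ.+ f b) (swap t s) (swap t (ℤ.- s)))
                 (cong₂ (λ a b → f a ℕ.+ f b) (swap (ℤ.- t) s) (swap (ℤ.- t) (ℤ.- s))))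
    where
    open import Algebra.Properties.CommutativeSemigroup ℤₚ.+-commutativeSemigroup using (x∙yz≈y∙xz)
    swap : ∀ t s → t ℤ.+ (s ℤ.+ x) ≡ s ℤ.+ (t ℤ.+ x)
    swap t s = x∙yz≈y∙xz t s x

  spread-iterate : ∀ s t m f x → spread s (iterate t m f) x ≡ iterate t m (spread s f) x
  spread-iterate s t zero    f x = refl
  spread-iterate s t (suc m) f x = trans (spread-comm s t (iterate t m f) x) (spread-cong t (spread-iterate s t m f) x)

  iterate-comm : ∀ s t m n f x → iterate s m (iterate t n f) x ≡ iterate t n (iterate s m f) x
  iterate-comm s t zero    n f x = refl
  iterate-comm s t (suc m) n f x = trans (spread-cong s (iterate-comm s t m n f) x) (spread-iterate s t n (iterate s m f) x)

  iterate-+ : ∀ s m n f x → iterate s (m ℕ.+ n) f x ≡ iterate s m (iterate s n f) x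
  iterate-+ s zero    n f x = refl
  iterate-+ s (suc m) n f x = spread-cong s (iterate-+ s m n f) x

  -- Here f has total mass 2ᵐ, and no value takes more than the fraction 1 / r of it.
  Bounded : ℕ → ℕ → (ℤ → ℕ) → Set
  Bounded r m f = ∀ x → f x ℕ.* r ≤ 2 ℕ.^ m

  spread-bounded : ∀ s {r m f} → Bounded r m f → Bounded r (suc m) (spread s f)
  spread-bounded s {r} {m} {f} bound x = begin
    (f (s ℤ.+ x) ℕ.+ f (ℤ.- s ℤ.+ x)) ℕ.* r              ≡⟨ ℕₚ.*-distribʳ-+ r (f (s ℤ.+ x)) _ ⟩
    f (s ℤ.+ x) ℕ.* r ℕ.+ f (ℤ.- s ℤ.+ x) ℕ.* r          ≤⟨ ℕₚ.+-mono-≤ (bound _) (bound _) ⟩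
    2 ℕ.^ m ℕ.+ 2 ℕ.^ m                                  ≡⟨ cong (2 ℕ.^ m ℕ.+_) (ℕₚ.+-identityʳ _) ⟨
    2 ℕ.^ suc m                                          ∎
    where open ℕₚ.≤-Reasoning

  iterate-bounded : ∀ s {r m} n {f} → Bounded r m f → Bounded r (n ℕ.+ m) (iterate s n f)
  iterate-bounded s         zero    bound = bound
  iterate-bounded s {r} {m} (suc n) {f} bound =
    spread-bounded s {r} {n ℕ.+ m} {iterate s n f} (iterate-bounded s {r} {m} n {f} bound)

  iterate-bounded-≥ : ∀ s {r m n f} → m ≤ n → Bounded r m (iterate s m f) → Bounded r n (iterate s n f)
  iterate-bounded-≥ s {r} {m} {n} {f} m≤n bound x =
    subst (λ k → iterate s k f x ℕ.* r ≤ 2 ℕ.^ k) (ℕₚ.m∸n+n≡m m≤n)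
      (subst (λ v → v ℕ.* r ≤ 2 ℕ.^ ((n ℕ.∸ m) ℕ.+ m)) (sym (iterate-+ s (n ℕ.∸ m) m f x))
        (iterate-bounded s {r} {m} (n ℕ.∸ m) {iterate s m f} bound x))

  -- Steps commute, so what a step sequence makes of δ₀ depends only on the number i of its steps N, N̄
  -- and the number j of its steps E, Ē.
  mixed : ℕ → ℕ → ℤ → ℕ
  mixed i j = iterate (+ 2) i (iterate (+ 1) j δ₀)

  -- The weight `mixed i j` records the steps already taken, so n + i + 2j is constant along the
  -- recursion and the assumed bound is used only at its ends, where all steps are recorded. Adding
  -- these bounds costs a factor 2 per step, which is how `total` grows too.
  pathSum-bounded : ∀ r M → (∀ i j → M ≤ i ℕ.+ (j ℕ.+ j) → Bounded r (i ℕ.+ j) (mixed i j)) →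
    ∀ n i j → M ≤ n ℕ.+ (i ℕ.+ (j ℕ.+ j)) → pathSum n (mixed i j) ℕ.* r ≤ 2 ℕ.^ (i ℕ.+ j) ℕ.* total n
  pathSum-bounded r M bound zero i j M≤ = begin
    mixed i j 0ℤ ℕ.* r           ≤⟨ bound i j M≤ 0ℤ ⟩
    2 ℕ.^ (i ℕ.+ j)              ≡⟨ ℕₚ.*-identityʳ _ ⟨
    2 ℕ.^ (i ℕ.+ j) ℕ.* 1        ∎
    where open ℕₚ.≤-Reasoning
  pathSum-bounded r M bound (suc zero) i j M≤ = begin
    mixed (suc i) j 0ℤ ℕ.* r     ≤⟨ bound (suc i) j M≤ 0ℤ ⟩
    2 ℕ.^ (suc i ℕ.+ j)          ≡⟨ ℕₚ.*-comm 2 (2 ℕ.^ (i ℕ.+ j)) ⟩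
    2 ℕ.^ (i ℕ.+ j) ℕ.* 2        ∎
    where open ℕₚ.≤-Reasoning
  pathSum-bounded r M bound (suc (suc n)) i j M≤ = begin
    (pathSum (suc n) (mixed (suc i) j) ℕ.+ pathSum n (spread (+ 1) (mixed i j))) ℕ.* r
      ≡⟨ cong (λ v → (pathSum (suc n) (mixed (suc i) j) ℕ.+ v) ℕ.* r)
           (pathSum-cong n (spread-iterate (+ 1) (+ 2) i (iterate (+ 1) j δ₀))) ⟩
    (pathSum (suc n) (mixed (suc i) j) ℕ.+ pathSum n (mixed i (suc j))) ℕ.* r
      ≡⟨ ℕₚ.*-distribʳ-+ r (pathSum (suc n) (mixed (suc i) j)) _ ⟩
    pathSum (suc n) (mixed (suc i) j) ℕ.* r ℕ.+ pathSum n (mixed i (suc j)) ℕ.* r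
      ≤⟨ ℕₚ.+-mono-≤
           (pathSum-bounded r M bound (suc n) (suc i) j (subst (M ≤_) (lemma₁ n i j) M≤))
           (pathSum-bounded r M bound n i (suc j) (subst (M ≤_) (lemma₂ n i j) M≤)) ⟩
    2 ℕ.^ (suc i ℕ.+ j) ℕ.* total (suc n) ℕ.+ 2 ℕ.^ (i ℕ.+ suc j) ℕ.* total n
      ≡⟨ cong (λ k → 2 ℕ.^ (suc i ℕ.+ j) ℕ.* total (suc n) ℕ.+ 2 ℕ.^ k ℕ.* total n) (ℕₚ.+-suc i j) ⟩
    2 ℕ.^ (suc i ℕ.+ j) ℕ.* total (suc n) ℕ.+ 2 ℕ.^ (suc i ℕ.+ j) ℕ.* total n
      ≡⟨ lemma₃ (2 ℕ.^ (i ℕ.+ j)) (total (suc n)) (total n) ⟩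
    2 ℕ.^ (i ℕ.+ j) ℕ.* ((total (suc n) ℕ.+ total (suc n)) ℕ.+ (total n ℕ.+ total n))
      ≡⟨ cong (2 ℕ.^ (i ℕ.+ j) ℕ.*_) (total-rec n) ⟨
    2 ℕ.^ (i ℕ.+ j) ℕ.* total (2 ℕ.+ n) ∎
    where
    open ℕₚ.≤-Reasoning
    lemma₁ : ∀ n i j → 2 ℕ.+ n ℕ.+ (i ℕ.+ (j ℕ.+ j)) ≡ suc n ℕ.+ (suc i ℕ.+ (j ℕ.+ j))
    lemma₁ = ℕ-solver.solve-∀
    lemma₂ : ∀ n i j → 2 ℕ.+ n ℕ.+ (i ℕ.+ (j ℕ.+ j)) ≡ n ℕ.+ (i ℕ.+ (suc j ℕ.+ suc j))
    lemma₂ = ℕ-solver.solve-∀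
    lemma₃ : ∀ p a b → (2 ℕ.* p) ℕ.* a ℕ.+ (2 ℕ.* p) ℕ.* b ≡ p ℕ.* ((a ℕ.+ a) ℕ.+ (b ℕ.+ b))
    lemma₃ = ℕ-solver.solve-∀

  -- Row m of Pascal's triangle, spread over the integers of the parity of m.
  binomial : ℕ → ℤ → ℕ
  binomial m = iterate (+ 1) m δ₀

  private
    b : ℕ → ℤ → ℤ
    b m k = + binomial m k

    b-suc : ∀ m k → b (suc m) k ≡ b m (1ℤ ℤ.+ k) ℤ.+ b m (ℤ.- 1ℤ ℤ.+ k)
    b-suc m k = ℤₚ.pos-+ (binomial m (1ℤ ℤ.+ k)) (binomial m (ℤ.- 1ℤ ℤ.+ k))

  mutual
    -- For k = 2j - m this is twice (m - j) C(m, j) = (j + 1) C(m, j + 1). The ratio in row m + 1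
    -- comes from the two passages between the rows m and m + 1, and these from the ratio in row m.
    binomial-ratio : ∀ m k → (+ m ℤ.- k) ℤ.* b m k ≡ (+ m ℤ.+ + 2 ℤ.+ k) ℤ.* b m (k ℤ.+ + 2)
    binomial-ratio zero (+ zero)  = refl
    binomial-ratio zero (+ suc n) = begin
      (0ℤ ℤ.- + suc n) ℤ.* 0ℤ                                  ≡⟨ ℤₚ.*-zeroʳ (0ℤ ℤ.- + suc n) ⟩
      0ℤ                                                       ≡⟨ ℤₚ.*-zeroʳ (0ℤ ℤ.+ + 2 ℤ.+ + suc n) ⟨
      (0ℤ ℤ.+ + 2 ℤ.+ + suc n) ℤ.* b 0 (+ suc n ℤ.+ + 2)       ∎
      where open ≡-Reasoning
    binomial-ratio zero -[1+ 0 ]           = refl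
    -- At k = -2 the entry on the right is 1, and it is the factor 0 + 2 + k that vanishes.
    binomial-ratio zero -[1+ 1 ]           = refl
    binomial-ratio zero -[1+ suc (suc n) ] = begin
      (0ℤ ℤ.- -[1+ suc (suc n) ]) ℤ.* 0ℤ                       ≡⟨ ℤₚ.*-zeroʳ (0ℤ ℤ.- -[1+ suc (suc n) ]) ⟩
      0ℤ                                                       ≡⟨ ℤₚ.*-zeroʳ (0ℤ ℤ.+ + 2 ℤ.+ -[1+ suc (suc n) ]) ⟨
      (0ℤ ℤ.+ + 2 ℤ.+ -[1+ suc (suc n) ]) ℤ.* b 0 (-[1+ suc (suc n) ] ℤ.+ + 2) ∎
      where open ≡-Reasoning
    binomial-ratio (suc m) k = begin
      (+ suc m ℤ.- k) ℤ.* b (suc m) k                          ≡⟨ cong₂ ℤ._*_ (lemma₁ (+ m) k) (cong (b (suc m)) (lemma₂ k)) ⟩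
      (+ m ℤ.+ + 2 ℤ.- (k ℤ.+ 1ℤ)) ℤ.* b (suc m) ((k ℤ.+ 1ℤ) ℤ.- 1ℤ)   ≡⟨ binomial-down m (k ℤ.+ 1ℤ) ⟨
      (+ 2 ℤ.* (+ m ℤ.+ 1ℤ)) ℤ.* b m (k ℤ.+ 1ℤ)                        ≡⟨ binomial-up m (k ℤ.+ 1ℤ) ⟩
      (+ m ℤ.+ + 2 ℤ.+ (k ℤ.+ 1ℤ)) ℤ.* b (suc m) ((k ℤ.+ 1ℤ) ℤ.+ 1ℤ)   ≡⟨ cong₂ ℤ._*_ (lemma₃ (+ m) k) (cong (b (suc m)) (lemma₄ k)) ⟩
      (+ suc m ℤ.+ + 2 ℤ.+ k) ℤ.* b (suc m) (k ℤ.+ + 2)        ∎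
      where
      open ≡-Reasoning
      lemma₁ : ∀ m k → 1ℤ ℤ.+ m ℤ.- k ≡ m ℤ.+ + 2 ℤ.- (k ℤ.+ 1ℤ)
      lemma₁ = ℤ-solver.solve-∀
      lemma₂ : ∀ k → k ≡ (k ℤ.+ 1ℤ) ℤ.- 1ℤ
      lemma₂ = ℤ-solver.solve-∀
      lemma₃ : ∀ m k → m ℤ.+ + 2 ℤ.+ (k ℤ.+ 1ℤ) ≡ 1ℤ ℤ.+ m ℤ.+ + 2 ℤ.+ k
      lemma₃ = ℤ-solver.solve-∀
      lemma₄ : ∀ k → k ℤ.+ 1ℤ ℤ.+ 1ℤ ≡ k ℤ.+ + 2
      lemma₄ = ℤ-solver.solve-∀

    -- For k = 2j - m this is twice (m + 1) C(m, j) = (j + 1) C(m + 1, j + 1); `binomial-down` is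
    -- its mirror image.
    binomial-up : ∀ m k → (+ 2 ℤ.* (+ m ℤ.+ 1ℤ)) ℤ.* b m k ≡ (+ m ℤ.+ + 2 ℤ.+ k) ℤ.* b (suc m) (k ℤ.+ 1ℤ)
    binomial-up m k = begin
      (+ 2 ℤ.* (+ m ℤ.+ 1ℤ)) ℤ.* b m k
        ≡⟨ lemma₁ (+ m) k (b m k) ⟩
      (+ m ℤ.- k) ℤ.* b m k ℤ.+ (+ m ℤ.+ + 2 ℤ.+ k) ℤ.* b m k
        ≡⟨ cong (ℤ._+ (+ m ℤ.+ + 2 ℤ.+ k) ℤ.* b m k) (binomial-ratio m k) ⟩
      (+ m ℤ.+ + 2 ℤ.+ k) ℤ.* b m (k ℤ.+ + 2) ℤ.+ (+ m ℤ.+ + 2 ℤ.+ k) ℤ.* b m k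
        ≡⟨ ℤₚ.*-distribˡ-+ (+ m ℤ.+ + 2 ℤ.+ k) (b m (k ℤ.+ + 2)) (b m k) ⟨
      (+ m ℤ.+ + 2 ℤ.+ k) ℤ.* (b m (k ℤ.+ + 2) ℤ.+ b m k)
        ≡⟨ cong ((+ m ℤ.+ + 2 ℤ.+ k) ℤ.*_) (cong₂ (λ i j → b m i ℤ.+ b m j) (lemma₂ k) (lemma₃ k)) ⟩
      (+ m ℤ.+ + 2 ℤ.+ k) ℤ.* (b m (1ℤ ℤ.+ (k ℤ.+ 1ℤ)) ℤ.+ b m (ℤ.- 1ℤ ℤ.+ (k ℤ.+ 1ℤ)))
        ≡⟨ cong ((+ m ℤ.+ + 2 ℤ.+ k) ℤ.*_) (b-suc m (k ℤ.+ 1ℤ)) ⟨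
      (+ m ℤ.+ + 2 ℤ.+ k) ℤ.* b (suc m) (k ℤ.+ 1ℤ) ∎
      where
      open ≡-Reasoning
      lemma₁ : ∀ m k x → (+ 2 ℤ.* (m ℤ.+ 1ℤ)) ℤ.* x ≡ (m ℤ.- k) ℤ.* x ℤ.+ (m ℤ.+ + 2 ℤ.+ k) ℤ.* x
      lemma₁ = ℤ-solver.solve-∀
      lemma₂ : ∀ k → k ℤ.+ + 2 ≡ 1ℤ ℤ.+ (k ℤ.+ 1ℤ)
      lemma₂ = ℤ-solver.solve-∀
      lemma₃ : ∀ k → k ≡ ℤ.- 1ℤ ℤ.+ (k ℤ.+ 1ℤ)
      lemma₃ = ℤ-solver.solve-∀

    binomial-down : ∀ m k → (+ 2 ℤ.* (+ m ℤ.+ 1ℤ)) ℤ.* b m k ≡ (+ m ℤ.+ + 2 ℤ.- k) ℤ.* b (suc m) (k ℤ.- 1ℤ)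
    binomial-down m k = begin
      (+ 2 ℤ.* (+ m ℤ.+ 1ℤ)) ℤ.* b m k
        ≡⟨ cong (λ i → (+ 2 ℤ.* (+ m ℤ.+ 1ℤ)) ℤ.* b m i) (lemma₂ k) ⟩
      (+ 2 ℤ.* (+ m ℤ.+ 1ℤ)) ℤ.* b m ((k ℤ.- + 2) ℤ.+ + 2)
        ≡⟨ lemma₁ (+ m) k (b m ((k ℤ.- + 2) ℤ.+ + 2)) ⟩
      (+ m ℤ.+ + 2 ℤ.+ (k ℤ.- + 2)) ℤ.* b m ((k ℤ.- + 2) ℤ.+ + 2) ℤ.+ (+ m ℤ.+ + 2 ℤ.- k) ℤ.* b m ((k ℤ.- + 2) ℤ.+ + 2)
        ≡⟨ cong₂ ℤ._+_ (sym (binomial-ratio m (k ℤ.- + 2))) (cong (λ i → (+ m ℤ.+ + 2 ℤ.- k) ℤ.* b m i) (sym (lemma₂ k))) ⟩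
      (+ m ℤ.- (k ℤ.- + 2)) ℤ.* b m (k ℤ.- + 2) ℤ.+ (+ m ℤ.+ + 2 ℤ.- k) ℤ.* b m k
        ≡⟨ lemma₃ (+ m) k (b m (k ℤ.- + 2)) (b m k) ⟩
      (+ m ℤ.+ + 2 ℤ.- k) ℤ.* (b m k ℤ.+ b m (k ℤ.- + 2))
        ≡⟨ cong ((+ m ℤ.+ + 2 ℤ.- k) ℤ.*_) (cong₂ (λ i j → b m i ℤ.+ b m j) (lemma₄ k) (lemma₅ k)) ⟩
      (+ m ℤ.+ + 2 ℤ.- k) ℤ.* (b m (1ℤ ℤ.+ (k ℤ.- 1ℤ)) ℤ.+ b m (ℤ.- 1ℤ ℤ.+ (k ℤ.- 1ℤ)))
        ≡⟨ cong ((+ m ℤ.+ + 2 ℤ.- k) ℤ.*_) (b-suc m (k ℤ.- 1ℤ)) ⟨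
      (+ m ℤ.+ + 2 ℤ.- k) ℤ.* b (suc m) (k ℤ.- 1ℤ) ∎
      where
      open ≡-Reasoning
      lemma₁ : ∀ m k x → (+ 2 ℤ.* (m ℤ.+ 1ℤ)) ℤ.* x ≡ (m ℤ.+ + 2 ℤ.+ (k ℤ.- + 2)) ℤ.* x ℤ.+ (m ℤ.+ + 2 ℤ.- k) ℤ.* x
      lemma₁ = ℤ-solver.solve-∀
      lemma₂ : ∀ k → k ≡ (k ℤ.- + 2) ℤ.+ + 2
      lemma₂ = ℤ-solver.solve-∀
      lemma₃ : ∀ m k x y → (m ℤ.- (k ℤ.- + 2)) ℤ.* x ℤ.+ (m ℤ.+ + 2 ℤ.- k) ℤ.* y ≡ (m ℤ.+ + 2 ℤ.- k) ℤ.* (y ℤ.+ x)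
      lemma₃ = ℤ-solver.solve-∀
      lemma₄ : ∀ k → k ≡ 1ℤ ℤ.+ (k ℤ.- 1ℤ)
      lemma₄ = ℤ-solver.solve-∀
      lemma₅ : ∀ k → k ℤ.- + 2 ≡ ℤ.- 1ℤ ℤ.+ (k ℤ.- 1ℤ)
      lemma₅ = ℤ-solver.solve-∀

  binomial-even : ∀ m k → binomial m (ℤ.- k) ≡ binomial m k
  binomial-even zero    k = δ₀-even k
  binomial-even (suc m) k =
    trans (sym (spread-reflect 1ℤ (binomial m) k)) (spread-cong 1ℤ (binomial-even m) k)

  binomial-up-ℕ : ∀ m j → (2 ℕ.* (m ℕ.+ 1)) ℕ.* binomial m (+ j) ≡ (m ℕ.+ 2 ℕ.+ j) ℕ.* binomial (suc m) (+ suc j)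
  binomial-up-ℕ m j = ℤₚ.+-injective (begin
    + ((2 ℕ.* (m ℕ.+ 1)) ℕ.* binomial m (+ j))               ≡⟨ ℤₚ.pos-* (2 ℕ.* (m ℕ.+ 1)) (binomial m (+ j)) ⟩
    + (2 ℕ.* (m ℕ.+ 1)) ℤ.* b m (+ j)                        ≡⟨ cong (ℤ._* b m (+ j)) (ℤₚ.pos-* 2 (m ℕ.+ 1)) ⟩
    (+ 2 ℤ.* (+ m ℤ.+ 1ℤ)) ℤ.* b m (+ j)                     ≡⟨ binomial-up m (+ j) ⟩
    + (m ℕ.+ 2 ℕ.+ j) ℤ.* b (suc m) (+ (j ℕ.+ 1))            ≡⟨ cong (λ i → + (m ℕ.+ 2 ℕ.+ j) ℤ.* b (suc m) (+ i)) (ℕₚ.+-comm j 1) ⟩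
    + (m ℕ.+ 2 ℕ.+ j) ℤ.* b (suc m) (+ suc j)                ≡⟨ ℤₚ.pos-* (m ℕ.+ 2 ℕ.+ j) (binomial (suc m) (+ suc j)) ⟨
    + ((m ℕ.+ 2 ℕ.+ j) ℕ.* binomial (suc m) (+ suc j))       ∎)
    where open ≡-Reasoning

  -- For m = 2l this is the ratio 2(2l + 1)/(l + 1) of consecutive central binomial coefficients.
  binomial-centre : ∀ m → (m ℕ.+ 2) ℕ.* binomial (2 ℕ.+ m) 0ℤ ≡ 4 ℕ.* (m ℕ.+ 1) ℕ.* binomial m 0ℤ
  binomial-centre m = begin
    (m ℕ.+ 2) ℕ.* (binomial (suc m) (+ 1) ℕ.+ binomial (suc m) (ℤ.- + 1))
      ≡⟨ cong (λ v → (m ℕ.+ 2) ℕ.* (binomial (suc m) (+ 1) ℕ.+ v)) (binomial-even (suc m) (+ 1)) ⟩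
    (m ℕ.+ 2) ℕ.* (binomial (suc m) (+ 1) ℕ.+ binomial (suc m) (+ 1))
      ≡⟨ lemma₁ m (binomial (suc m) (+ 1)) ⟩
    2 ℕ.* ((m ℕ.+ 2 ℕ.+ 0) ℕ.* binomial (suc m) (+ 1))
      ≡⟨ cong (2 ℕ.*_) (binomial-up-ℕ m 0) ⟨
    2 ℕ.* ((2 ℕ.* (m ℕ.+ 1)) ℕ.* binomial m 0ℤ)
      ≡⟨ lemma₂ m (binomial m 0ℤ) ⟩
    4 ℕ.* (m ℕ.+ 1) ℕ.* binomial m 0ℤ ∎
    where
    open ≡-Reasoning
    lemma₁ : ∀ m x → (m ℕ.+ 2) ℕ.* (x ℕ.+ x) ≡ 2 ℕ.* ((m ℕ.+ 2 ℕ.+ 0) ℕ.* x)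
    lemma₁ = ℕ-solver.solve-∀
    lemma₂ : ∀ m x → 2 ℕ.* ((2 ℕ.* (m ℕ.+ 1)) ℕ.* x) ≡ 4 ℕ.* (m ℕ.+ 1) ℕ.* x
    lemma₂ = ℕ-solver.solve-∀

  -- Defined by recursion so that `binomial (double (suc l))` unfolds by two rows.
  double : ℕ → ℕ
  double zero    = 0
  double (suc l) = suc (suc (double l))

  double≡ : ∀ l → double l ≡ 2 ℕ.* l
  double≡ zero    = refl
  double≡ (suc l) = trans (cong (2 ℕ.+_) (double≡ l)) (lemma l)
    where
    lemma : ∀ l → 2 ℕ.+ 2 ℕ.* l ≡ 2 ℕ.* suc l
    lemma = ℕ-solver.solve-∀

  private
    -- With `ratio` squared this comes down to 4(l + 1)(l + 2) ≤ (2l + 3)², where the sides differ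
    -- by 1; hence the summand `16 ℕ.* p`.
    off-centre-step : ∀ l {v x p} → (2 ℕ.* l ℕ.+ 3) ℕ.* x ≤ 8 ℕ.* (l ℕ.+ 1) ℕ.* v →
      v ℕ.* v ℕ.* suc l ≤ p → x ℕ.* x ℕ.* suc (suc l) ≤ 16 ℕ.* p
    off-centre-step l {v} {x} {p} ratio bound =
      ℕₚ.*-cancelˡ-≤ ((3 ℕ.+ 2 ℕ.* l) ℕ.* (3 ℕ.+ 2 ℕ.* l)) (begin
        ((3 ℕ.+ 2 ℕ.* l) ℕ.* (3 ℕ.+ 2 ℕ.* l)) ℕ.* (x ℕ.* x ℕ.* suc (suc l))
          ≡⟨ lemma₁ l x ⟩
        (((2 ℕ.* l ℕ.+ 3) ℕ.* x) ℕ.* ((2 ℕ.* l ℕ.+ 3) ℕ.* x)) ℕ.* (l ℕ.+ 2)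
          ≤⟨ ℕₚ.*-monoˡ-≤ (l ℕ.+ 2) (ℕₚ.*-mono-≤ ratio ratio) ⟩
        ((8 ℕ.* (l ℕ.+ 1) ℕ.* v) ℕ.* (8 ℕ.* (l ℕ.+ 1) ℕ.* v)) ℕ.* (l ℕ.+ 2)
          ≡⟨ lemma₂ l v ⟩
        (64 ℕ.* ((l ℕ.+ 1) ℕ.* (l ℕ.+ 2))) ℕ.* (v ℕ.* v ℕ.* suc l)
          ≤⟨ ℕₚ.*-monoʳ-≤ (64 ℕ.* ((l ℕ.+ 1) ℕ.* (l ℕ.+ 2))) bound ⟩
        (64 ℕ.* ((l ℕ.+ 1) ℕ.* (l ℕ.+ 2))) ℕ.* p
          ≤⟨ ℕₚ.m≤m+n _ (16 ℕ.* p) ⟩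
        (64 ℕ.* ((l ℕ.+ 1) ℕ.* (l ℕ.+ 2))) ℕ.* p ℕ.+ 16 ℕ.* p
          ≡⟨ lemma₃ l p ⟩
        ((3 ℕ.+ 2 ℕ.* l) ℕ.* (3 ℕ.+ 2 ℕ.* l)) ℕ.* (16 ℕ.* p) ∎)
      where
      open ℕₚ.≤-Reasoning
      lemma₁ : ∀ l x → ((3 ℕ.+ 2 ℕ.* l) ℕ.* (3 ℕ.+ 2 ℕ.* l)) ℕ.* (x ℕ.* x ℕ.* suc (suc l))
                     ≡ (((2 ℕ.* l ℕ.+ 3) ℕ.* x) ℕ.* ((2 ℕ.* l ℕ.+ 3) ℕ.* x)) ℕ.* (l ℕ.+ 2)
      lemma₁ = ℕ-solver.solve-∀
      lemma₂ : ∀ l v → ((8 ℕ.* (l ℕ.+ 1) ℕ.* v) ℕ.* (8 ℕ.* (l ℕ.+ 1) ℕ.* v)) ℕ.* (l ℕ.+ 2)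
                     ≡ (64 ℕ.* ((l ℕ.+ 1) ℕ.* (l ℕ.+ 2))) ℕ.* (v ℕ.* v ℕ.* suc l)
      lemma₂ = ℕ-solver.solve-∀
      lemma₃ : ∀ l p → (64 ℕ.* ((l ℕ.+ 1) ℕ.* (l ℕ.+ 2))) ℕ.* p ℕ.+ 16 ℕ.* p
                     ≡ ((3 ℕ.+ 2 ℕ.* l) ℕ.* (3 ℕ.+ 2 ℕ.* l)) ℕ.* (16 ℕ.* p)
      lemma₃ = ℕ-solver.solve-∀

    -- Here it comes down to (2l + 1)²(l + 2) ≤ 4(l + 1)³, with the difference 3l + 2.
    centre-step : ∀ l {v x p} → (2 ℕ.* l ℕ.+ 2) ℕ.* x ≡ 4 ℕ.* (2 ℕ.* l ℕ.+ 1) ℕ.* v →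
      v ℕ.* v ℕ.* suc l ≤ p → x ℕ.* x ℕ.* suc (suc l) ≤ 16 ℕ.* p
    centre-step l {v} {x} {p} ratio bound =
      ℕₚ.*-cancelˡ-≤ (suc l ℕ.* (suc l ℕ.* suc l)) (ℕₚ.*-cancelˡ-≤ 4 (begin
        4 ℕ.* ((suc l ℕ.* (suc l ℕ.* suc l)) ℕ.* (x ℕ.* x ℕ.* suc (suc l)))
          ≡⟨ lemma₁ l x ⟩
        (((2 ℕ.* l ℕ.+ 2) ℕ.* x) ℕ.* ((2 ℕ.* l ℕ.+ 2) ℕ.* x)) ℕ.* (suc l ℕ.* (l ℕ.+ 2))
          ≡⟨ cong (λ y → (y ℕ.* y) ℕ.* (suc l ℕ.* (l ℕ.+ 2))) ratio ⟩
        ((4 ℕ.* (2 ℕ.* l ℕ.+ 1) ℕ.* v) ℕ.* (4 ℕ.* (2 ℕ.* l ℕ.+ 1) ℕ.* v)) ℕ.* (suc l ℕ.* (l ℕ.+ 2))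
          ≡⟨ lemma₂ l v ⟩
        (16 ℕ.* ((2 ℕ.* l ℕ.+ 1) ℕ.* (2 ℕ.* l ℕ.+ 1) ℕ.* (l ℕ.+ 2))) ℕ.* (v ℕ.* v ℕ.* suc l)
          ≤⟨ ℕₚ.*-monoʳ-≤ (16 ℕ.* ((2 ℕ.* l ℕ.+ 1) ℕ.* (2 ℕ.* l ℕ.+ 1) ℕ.* (l ℕ.+ 2))) bound ⟩
        (16 ℕ.* ((2 ℕ.* l ℕ.+ 1) ℕ.* (2 ℕ.* l ℕ.+ 1) ℕ.* (l ℕ.+ 2))) ℕ.* p
          ≤⟨ ℕₚ.m≤m+n _ (16 ℕ.* ((3 ℕ.* l ℕ.+ 2) ℕ.* p)) ⟩
        (16 ℕ.* ((2 ℕ.* l ℕ.+ 1) ℕ.* (2 ℕ.* l ℕ.+ 1) ℕ.* (l ℕ.+ 2))) ℕ.* p ℕ.+ 16 ℕ.* ((3 ℕ.* l ℕ.+ 2) ℕ.* p)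
          ≡⟨ lemma₃ l p ⟩
        4 ℕ.* ((suc l ℕ.* (suc l ℕ.* suc l)) ℕ.* (16 ℕ.* p)) ∎))
      where
      open ℕₚ.≤-Reasoning
      lemma₁ : ∀ l x → 4 ℕ.* ((suc l ℕ.* (suc l ℕ.* suc l)) ℕ.* (x ℕ.* x ℕ.* suc (suc l)))
                     ≡ (((2 ℕ.* l ℕ.+ 2) ℕ.* x) ℕ.* ((2 ℕ.* l ℕ.+ 2) ℕ.* x)) ℕ.* (suc l ℕ.* (l ℕ.+ 2))
      lemma₁ = ℕ-solver.solve-∀
      lemma₂ : ∀ l v → ((4 ℕ.* (2 ℕ.* l ℕ.+ 1) ℕ.* v) ℕ.* (4 ℕ.* (2 ℕ.* l ℕ.+ 1) ℕ.* v)) ℕ.* (suc l ℕ.* (l ℕ.+ 2))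
                     ≡ (16 ℕ.* ((2 ℕ.* l ℕ.+ 1) ℕ.* (2 ℕ.* l ℕ.+ 1) ℕ.* (l ℕ.+ 2))) ℕ.* (v ℕ.* v ℕ.* suc l)
      lemma₂ = ℕ-solver.solve-∀
      lemma₃ : ∀ l p → (16 ℕ.* ((2 ℕ.* l ℕ.+ 1) ℕ.* (2 ℕ.* l ℕ.+ 1) ℕ.* (l ℕ.+ 2))) ℕ.* p ℕ.+ 16 ℕ.* ((3 ℕ.* l ℕ.+ 2) ℕ.* p)
                     ≡ 4 ℕ.* ((suc l ℕ.* (suc l ℕ.* suc l)) ℕ.* (16 ℕ.* p))
      lemma₃ = ℕ-solver.solve-∀

    larger : ∀ {A : ℕ → Set} x y → A x → A y → ∃ λ v → A v × x ℕ.+ y ≤ 2 ℕ.* v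
    larger x y ax ay with ℕₚ.≤-total x y
    ... | inj₁ x≤y = y , ay , ℕₚ.≤-trans (ℕₚ.+-monoˡ-≤ y x≤y) (ℕₚ.≤-reflexive (cong (y ℕ.+_) (sym (ℕₚ.+-identityʳ y))))
    ... | inj₂ y≤x = x , ax , ℕₚ.≤-trans (ℕₚ.+-monoʳ-≤ x y≤x) (ℕₚ.≤-reflexive (cong (x ℕ.+_) (sym (ℕₚ.+-identityʳ x))))

  -- Off the centre, an entry x of row 2l + 2 satisfies (2l + 3) x ≤ 8(l + 1) v for the larger v of
  -- two entries of row 2l. At the centre the same argument yields only x ≤ 4v, which loses the
  -- factor (l + 2)/(l + 1); hence the exact ratio there.
  binomial-square-bound⁺ : ∀ l j → binomial (double l) (+ j) ℕ.* binomial (double l) (+ j) ℕ.* suc l ≤ 16 ℕ.^ l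
  binomial-square-bound  : ∀ l k → binomial (double l) k ℕ.* binomial (double l) k ℕ.* suc l ≤ 16 ℕ.^ l

  binomial-square-bound l (+ j)    = binomial-square-bound⁺ l j
  binomial-square-bound l -[1+ j ] =
    subst (λ v → v ℕ.* v ℕ.* suc l ≤ 16 ℕ.^ l) (sym (binomial-even (double l) (+ suc j)))
      (binomial-square-bound⁺ l (suc j))

  binomial-square-bound⁺ zero    zero    = s≤s z≤n
  binomial-square-bound⁺ zero    (suc _) = z≤n
  binomial-square-bound⁺ (suc l) zero  = centre-step l
    (subst (λ m → (m ℕ.+ 2) ℕ.* binomial (2 ℕ.+ double l) 0ℤ ≡ 4 ℕ.* (m ℕ.+ 1) ℕ.* binomial (double l) 0ℤ)
      (double≡ l) (binomial-centre (double l)))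
    (binomial-square-bound l 0ℤ)
  binomial-square-bound⁺ (suc l) (suc j)
    with larger {λ v → v ℕ.* v ℕ.* suc l ≤ 16 ℕ.^ l}
           (binomial (double l) (1ℤ ℤ.+ + j)) (binomial (double l) (ℤ.- 1ℤ ℤ.+ + j))
           (binomial-square-bound l (1ℤ ℤ.+ + j)) (binomial-square-bound l (ℤ.- 1ℤ ℤ.+ + j))
  ... | (v , bound , sum≤) = off-centre-step l (begin
    (2 ℕ.* l ℕ.+ 3) ℕ.* x                                          ≤⟨ ℕₚ.*-monoˡ-≤ x (ℕₚ.m≤m+n (2 ℕ.* l ℕ.+ 3) j) ⟩
    (2 ℕ.* l ℕ.+ 3 ℕ.+ j) ℕ.* x                                    ≡⟨ cong (λ m → (m ℕ.+ 3 ℕ.+ j) ℕ.* x) (double≡ l) ⟨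
    (double l ℕ.+ 3 ℕ.+ j) ℕ.* x                                   ≡⟨ cong (λ m → (m ℕ.+ j) ℕ.* x) (ℕₚ.+-suc (double l) 2) ⟩
    (suc (double l) ℕ.+ 2 ℕ.+ j) ℕ.* x                             ≡⟨ binomial-up-ℕ (suc (double l)) j ⟨
    (2 ℕ.* (suc (double l) ℕ.+ 1)) ℕ.* binomial (suc (double l)) (+ j)
      ≤⟨ ℕₚ.*-monoʳ-≤ (2 ℕ.* (suc (double l) ℕ.+ 1)) sum≤ ⟩
    (2 ℕ.* (suc (double l) ℕ.+ 1)) ℕ.* (2 ℕ.* v)                   ≡⟨ cong (λ m → (2 ℕ.* (suc m ℕ.+ 1)) ℕ.* (2 ℕ.* v)) (double≡ l) ⟩
    (2 ℕ.* (suc (2 ℕ.* l) ℕ.+ 1)) ℕ.* (2 ℕ.* v)                    ≡⟨ lemma l v ⟩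
    8 ℕ.* (l ℕ.+ 1) ℕ.* v                                          ∎) bound
    where
    open ℕₚ.≤-Reasoning
    x = binomial (double (suc l)) (+ suc j)
    lemma : ∀ l v → (2 ℕ.* (suc (2 ℕ.* l) ℕ.+ 1)) ℕ.* (2 ℕ.* v) ≡ 8 ℕ.* (l ℕ.+ 1) ℕ.* v
    lemma = ℕ-solver.solve-∀

  private
    16^≡ : ∀ l → 16 ℕ.^ l ≡ 2 ℕ.^ double l ℕ.* 2 ℕ.^ double l
    16^≡ zero    = refl
    16^≡ (suc l) = trans (cong (16 ℕ.*_) (16^≡ l)) (lemma (2 ℕ.^ double l))
      where
      lemma : ∀ p → 16 ℕ.* (p ℕ.* p) ≡ (2 ℕ.* (2 ℕ.* p)) ℕ.* (2 ℕ.* (2 ℕ.* p))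
      lemma = ℕ-solver.solve-∀

    square-cancel-≤ : ∀ {m n} → m ℕ.* m ≤ n ℕ.* n → m ≤ n
    square-cancel-≤ {m} {n} le with m ℕₚ.≤? n
    ... | yes m≤n = m≤n
    ... | no  m≰n = contradiction le (ℕₚ.<⇒≱ (ℕₚ.*-mono-< (ℕₚ.≰⇒> m≰n) (ℕₚ.≰⇒> m≰n)))

  -- Row 2r² is far enough because r ≤ √(r² + 1).
  binomial-bounded : ∀ r → Bounded r (double (r ℕ.* r)) (binomial (double (r ℕ.* r)))
  binomial-bounded r k = square-cancel-≤ (begin
    (x ℕ.* r) ℕ.* (x ℕ.* r)          ≡⟨ lemma x r ⟩
    x ℕ.* x ℕ.* (r ℕ.* r)            ≤⟨ ℕₚ.*-monoʳ-≤ (x ℕ.* x) (ℕₚ.n≤1+n (r ℕ.* r)) ⟩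
    x ℕ.* x ℕ.* suc (r ℕ.* r)        ≤⟨ binomial-square-bound (r ℕ.* r) k ⟩
    16 ℕ.^ (r ℕ.* r)                 ≡⟨ 16^≡ (r ℕ.* r) ⟩
    2 ℕ.^ double (r ℕ.* r) ℕ.* 2 ℕ.^ double (r ℕ.* r) ∎)
    where
    open ℕₚ.≤-Reasoning
    x = binomial (double (r ℕ.* r)) k
    lemma : ∀ x r → (x ℕ.* r) ℕ.* (x ℕ.* r) ≡ x ℕ.* x ℕ.* (r ℕ.* r)
    lemma = ℕ-solver.solve-∀

  -- On a coset c + 2ℤ the steps ±2 are the steps ±1 of k. The inequality in place of an equation
  -- also covers the odd coset, where `δ₀` vanishes.
  iterate-rescale : ∀ c m {f g} → (∀ k → f (c ℤ.+ (k ℤ.+ k)) ≤ g k) →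
                    ∀ k → iterate (+ 2) m f (c ℤ.+ (k ℤ.+ k)) ≤ iterate (+ 1) m g k
  iterate-rescale c zero    le = le
  iterate-rescale c (suc m) {f} {g} le k = ℕₚ.+-mono-≤
    (subst (λ x → iterate (+ 2) m f x ≤ iterate (+ 1) m g (1ℤ ℤ.+ k)) (lemma₁ c k) (iterate-rescale c m le (1ℤ ℤ.+ k)))
    (subst (λ x → iterate (+ 2) m f x ≤ iterate (+ 1) m g (ℤ.- 1ℤ ℤ.+ k)) (lemma₂ c k) (iterate-rescale c m le (ℤ.- 1ℤ ℤ.+ k)))
    where
    lemma₁ : ∀ c k → c ℤ.+ (1ℤ ℤ.+ k ℤ.+ (1ℤ ℤ.+ k)) ≡ + 2 ℤ.+ (c ℤ.+ (k ℤ.+ k))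
    lemma₁ = ℤ-solver.solve-∀
    lemma₂ : ∀ c k → c ℤ.+ (ℤ.- 1ℤ ℤ.+ k ℤ.+ (ℤ.- 1ℤ ℤ.+ k)) ≡ ℤ.- + 2 ℤ.+ (c ℤ.+ (k ℤ.+ k))
    lemma₂ = ℤ-solver.solve-∀

  private
    δ₀-even-lattice : ∀ k → δ₀ (0ℤ ℤ.+ (k ℤ.+ k)) ≤ δ₀ k
    δ₀-even-lattice (+ zero)  = s≤s z≤n
    δ₀-even-lattice (+ suc n) = z≤n
    δ₀-even-lattice -[1+ n ]  = z≤n

    δ₀-odd-lattice : ∀ k → δ₀ (1ℤ ℤ.+ (k ℤ.+ k)) ≤ δ₀ k
    δ₀-odd-lattice (+ zero)  = z≤n
    δ₀-odd-lattice (+ suc n) = z≤n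
    δ₀-odd-lattice -[1+ n ]  = z≤n

    i*2≡i+i : ∀ i → i ℤ.* + 2 ≡ i ℤ.+ i
    i*2≡i+i = ℤ-solver.solve-∀

    parity : ∀ x → ∃ λ k → (x ≡ 0ℤ ℤ.+ (k ℤ.+ k)) ⊎ (x ≡ 1ℤ ℤ.+ (k ℤ.+ k))
    parity x with x ℤ-DivMod.%ℕ 2 | x ℤ-DivMod./ℕ 2 | ℤ-DivMod.a≡a%ℕn+[a/ℕn]*n x 2 | ℤ-DivMod.n%ℕd<d x 2
    ... | 0           | k | eq | _ = k , inj₁ (trans eq (cong (ℤ._+_ 0ℤ) (i*2≡i+i k)))
    ... | 1           | k | eq | _ = k , inj₂ (trans eq (cong (ℤ._+_ 1ℤ) (i*2≡i+i k)))
    ... | suc (suc _) | k | eq | s≤s (s≤s ())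

  iterate-2-bounded : ∀ {r m} → Bounded r m (iterate (+ 1) m δ₀) → Bounded r m (iterate (+ 2) m δ₀)
  iterate-2-bounded {r} {m} bound x with parity x
  ... | (k , inj₁ refl) = ℕₚ.≤-trans (ℕₚ.*-monoˡ-≤ r (iterate-rescale 0ℤ m δ₀-even-lattice k)) (bound k)
  ... | (k , inj₂ refl) = ℕₚ.≤-trans (ℕₚ.*-monoˡ-≤ r (iterate-rescale 1ℤ m δ₀-odd-lattice k)) (bound k)

  -- For d = 2r², the condition i + 2j ≥ 3d forces i ≥ d or j ≥ d. The steps of that kind alone
  -- achieve the bound, and by `spread-bounded` all further steps preserve it.
  mixed-bounded : ∀ r i j → let d = double (r ℕ.* r) in d ℕ.+ (d ℕ.+ d) ≤ i ℕ.+ (j ℕ.+ j) →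
                  Bounded r (i ℕ.+ j) (mixed i j)
  mixed-bounded r i j le with double (r ℕ.* r) ℕₚ.≤? j
  ... | yes d≤j = iterate-bounded (+ 2) i (iterate-bounded-≥ (+ 1) d≤j (binomial-bounded r))
  ... | no d≰j with double (r ℕ.* r) ℕₚ.≤? i
  ...   | yes d≤i = λ x → subst₂ (λ v k → v ℕ.* r ≤ 2 ℕ.^ k) (sym (iterate-comm (+ 2) (+ 1) i j δ₀ x)) (ℕₚ.+-comm j i)
          (iterate-bounded (+ 1) j (iterate-bounded-≥ (+ 2) d≤i (iterate-2-bounded {r} {double (r ℕ.* r)} (binomial-bounded r))) x)
  ...   | no d≰i = contradiction le (ℕₚ.<⇒≱ (ℕₚ.+-mono-< (ℕₚ.≰⇒> d≰i) (ℕₚ.+-mono-< (ℕₚ.≰⇒> d≰j) (ℕₚ.≰⇒> d≰j))))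

  threshold : ℕ → ℕ
  threshold r = d ℕ.+ (d ℕ.+ d) where d = double (r ℕ.* r)

  returns-negligible : ∀ r n → threshold r ≤ n → pathSum n δ₀ ℕ.* r ≤ total n
  returns-negligible r n le = ℕₚ.≤-trans
    (pathSum-bounded r (threshold r) (mixed-bounded r) n 0 0 (ℕₚ.≤-trans le (ℕₚ.≤-reflexive (sym (ℕₚ.+-identityʳ n)))))
    (ℕₚ.≤-reflexive (ℕₚ.*-identityˡ (total n)))

-- Ring laws of ℚ(√d)

module QuadraticField (d : ℕ) where
  open RingOps (ℚ√-rawRing d)
  open ≡ using (refl; trans; cong; cong₂; isEquivalence)
  open +-*-Solver using (solve; _:=_; _:+_; _:*_; con)
  private
    D = + d ℚ./ 1

    +-assoc : ∀ x y z → (x + y) + z ≡ x + (y + z)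
    +-assoc x y z = cong₂ _+√_ (ℚₚ.+-assoc (rat x) (rat y) (rat z)) (ℚₚ.+-assoc (irr x) (irr y) (irr z))

    +-comm : ∀ x y → x + y ≡ y + x
    +-comm x y = cong₂ _+√_ (ℚₚ.+-comm (rat x) (rat y)) (ℚₚ.+-comm (irr x) (irr y))

    +-identityˡ : ∀ x → 0# + x ≡ x
    +-identityˡ x = cong₂ _+√_ (ℚₚ.+-identityˡ (rat x)) (ℚₚ.+-identityˡ (irr x))

    -‿inverseˡ : ∀ x → - x + x ≡ 0#
    -‿inverseˡ x = cong₂ _+√_ (ℚₚ.+-inverseˡ (rat x)) (ℚₚ.+-inverseˡ (irr x))

    *-assoc : ∀ x y z → (x * y) * z ≡ x * (y * z)
    *-assoc (a +√ b) (a′ +√ b′) (a″ +√ b″) = cong₂ _+√_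
      (solve 7 (λ d a b a′ b′ a″ b″ →
          (a :* a′ :+ d :* (b :* b′)) :* a″ :+ d :* ((a :* b′ :+ b :* a′) :* b″)
        := a :* (a′ :* a″ :+ d :* (b′ :* b″)) :+ d :* (b :* (a′ :* b″ :+ b′ :* a″)))
        refl D a b a′ b′ a″ b″)
      (solve 7 (λ d a b a′ b′ a″ b″ →
          (a :* a′ :+ d :* (b :* b′)) :* b″ :+ (a :* b′ :+ b :* a′) :* a″
        := a :* (a′ :* b″ :+ b′ :* a″) :+ b :* (a′ :* a″ :+ d :* (b′ :* b″)))
        refl D a b a′ b′ a″ b″)

    *-comm : ∀ x y → x * y ≡ y * x
    *-comm (a +√ b) (a′ +√ b′) = cong₂ _+√_
      (solve 5 (λ d a b a′ b′ → a :* a′ :+ d :* (b :* b′) := a′ :* a :+ d :* (b′ :* b)) refl D a b a′ b′)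
      (solve 4 (λ a b a′ b′ → a :* b′ :+ b :* a′ := a′ :* b :+ b′ :* a) refl a b a′ b′)

    *-identityˡ : ∀ x → 1# * x ≡ x
    *-identityˡ (a +√ b) = cong₂ _+√_
      (solve 3 (λ d a b → con 1ℚ :* a :+ d :* (con 0ℚ :* b) := a) refl D a b)
      (solve 2 (λ a b → con 1ℚ :* b :+ con 0ℚ :* a := b) refl a b)

    distribˡ : ∀ x y z → x * (y + z) ≡ x * y + x * z
    distribˡ (a +√ b) (a′ +√ b′) (a″ +√ b″) = cong₂ _+√_
      (solve 7 (λ d a b a′ b′ a″ b″ →
          a :* (a′ :+ a″) :+ d :* (b :* (b′ :+ b″))
        := (a :* a′ :+ d :* (b :* b′)) :+ (a :* a″ :+ d :* (b :* b″)))
        refl D a b a′ b′ a″ b″)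
      (solve 6 (λ a b a′ b′ a″ b″ →
          a :* (b′ :+ b″) :+ b :* (a′ :+ a″) := (a :* b′ :+ b :* a′) :+ (a :* b″ :+ b :* a″))
        refl a b a′ b′ a″ b″)

  isCommutativeRing : IsCommutativeRing _≡_ _+_ _*_ -_ 0# 1#
  isCommutativeRing = record
    { isRing = record
      { +-isAbelianGroup = record
        { isGroup = record
          { isMonoid = record
            { isSemigroup = record
              { isMagma = record { isEquivalence = isEquivalence ; ∙-cong = cong₂ _+_ }
              ; assoc = +-assoc }
            ; identity = +-identityˡ , λ x → trans (+-comm x 0#) (+-identityˡ x) }
          ; inverse = -‿inverseˡ , λ x → trans (+-comm x (- x)) (-‿inverseˡ x)
          ; ⁻¹-cong = cong (λ x → - x) }
        ; comm = +-comm }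
      ; *-cong = cong₂ _*_
      ; *-assoc = *-assoc
      ; *-identity = *-identityˡ , λ x → trans (*-comm x 1#) (*-identityˡ x)
      ; distrib = distribˡ , λ x y z → trans (*-comm (y + z) x)
          (trans (distribˡ x y z) (cong₂ _+_ (*-comm x y) (*-comm x z))) }
    ; *-comm = *-comm }

  commutativeRing : CommutativeRing 0ℓ 0ℓ
  commutativeRing = record { isCommutativeRing = isCommutativeRing }

-- Inequalities between rationals

module Rationals where
  open ≡ using (refl; sym; trans; cong; cong₂; subst; subst₂)
  open import Data.Rational.Base using (_≤_; _<_)

  fromNatℚ : ℕ → ℚ
  fromNatℚ n = + n ℚ./ 1

  private
    toℚᵘ-fromNatℚ : ∀ n → toℚᵘ (fromNatℚ n) ℚᵘ.≃ ℚᵘ.mkℚᵘ (+ n) 0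
    toℚᵘ-fromNatℚ n = ℚₚ.toℚᵘ-fromℚᵘ (ℚᵘ.mkℚᵘ (+ n) 0)

  fromNatℚ-+ : ∀ m n → fromNatℚ (m ℕ.+ n) ≡ fromNatℚ m ℚ.+ fromNatℚ n
  fromNatℚ-+ m n = ℚₚ.toℚᵘ-injective (begin
    toℚᵘ (fromNatℚ (m ℕ.+ n))                          ≈⟨ toℚᵘ-fromNatℚ (m ℕ.+ n) ⟩
    ℚᵘ.mkℚᵘ (+ (m ℕ.+ n)) 0
      ≈⟨ ℚᵘ.*≡* (cong (ℤ._* + 1) (cong₂ (λ i j → i ℤ.+ j) (ℤₚ.*-identityʳ (+ m)) (ℤₚ.*-identityʳ (+ n)))) ⟨
    ℚᵘ.mkℚᵘ (+ m) 0 ℚᵘ.+ ℚᵘ.mkℚᵘ (+ n) 0               ≈⟨ ℚᵘₚ.+-cong (toℚᵘ-fromNatℚ m) (toℚᵘ-fromNatℚ n) ⟨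
    toℚᵘ (fromNatℚ m) ℚᵘ.+ toℚᵘ (fromNatℚ n)           ≈⟨ ℚₚ.toℚᵘ-homo-+ (fromNatℚ m) (fromNatℚ n) ⟨
    toℚᵘ (fromNatℚ m ℚ.+ fromNatℚ n)                   ∎)
    where open ℚᵘₚ.≃-Reasoning

  fromNatℚ-* : ∀ m n → fromNatℚ (m ℕ.* n) ≡ fromNatℚ m ℚ.* fromNatℚ n
  fromNatℚ-* m n = ℚₚ.toℚᵘ-injective (begin
    toℚᵘ (fromNatℚ (m ℕ.* n))                          ≈⟨ toℚᵘ-fromNatℚ (m ℕ.* n) ⟩
    ℚᵘ.mkℚᵘ (+ (m ℕ.* n)) 0                            ≈⟨ ℚᵘ.*≡* (cong (ℤ._* + 1) (ℤₚ.pos-* m n)) ⟩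
    ℚᵘ.mkℚᵘ (+ m) 0 ℚᵘ.* ℚᵘ.mkℚᵘ (+ n) 0               ≈⟨ ℚᵘₚ.*-cong (toℚᵘ-fromNatℚ m) (toℚᵘ-fromNatℚ n) ⟨
    toℚᵘ (fromNatℚ m) ℚᵘ.* toℚᵘ (fromNatℚ n)           ≈⟨ ℚₚ.toℚᵘ-homo-* (fromNatℚ m) (fromNatℚ n) ⟨
    toℚᵘ (fromNatℚ m ℚ.* fromNatℚ n)                   ∎)
    where open ℚᵘₚ.≃-Reasoning

  0≤fromNatℚ : ∀ n → 0ℚ ≤ fromNatℚ n
  0≤fromNatℚ n = ℚₚ.toℚᵘ-cancel-≤ (ℚᵘₚ.≤-trans
    (ℚᵘ.*≤* (ℤₚ.≤-trans (ℤ.+≤+ z≤n) (ℤₚ.≤-reflexive (sym (ℤₚ.*-identityʳ (+ n))))))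
    (ℚᵘₚ.≤-reflexive (ℚᵘₚ.≃-sym (toℚᵘ-fromNatℚ n))))

  -- Truncated subtraction is exact because m ≤ n.
  difference : ∀ {m n} → m ℕ.≤ n → fromNatℚ n ≡ fromNatℚ m ℚ.+ fromNatℚ (n ℕ.∸ m)
  difference {m} {n} m≤n = trans (cong fromNatℚ (sym (ℕₚ.m+[n∸m]≡n m≤n))) (fromNatℚ-+ m (n ℕ.∸ m))

  0≤+ : ∀ {p q} → 0ℚ ≤ p → 0ℚ ≤ q → 0ℚ ≤ p ℚ.+ q
  0≤+ = ℚₚ.+-mono-≤

  0<+ : ∀ {p q} → 0ℚ < p → 0ℚ ≤ q → 0ℚ < p ℚ.+ q
  0<+ = ℚₚ.+-mono-<-≤

  0≤* : ∀ {p q} → 0ℚ ≤ p → 0ℚ ≤ q → 0ℚ ≤ p ℚ.* q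
  0≤* {p} {q} 0≤p 0≤q = ℚₚ.nonNegative⁻¹ _ {{ℚₚ.nonNeg*nonNeg⇒nonNeg p {{ℚ.nonNegative 0≤p}} q {{ℚ.nonNegative 0≤q}}}}

  0<* : ∀ {p q} → 0ℚ < p → 0ℚ < q → 0ℚ < p ℚ.* q
  0<* {p} {q} 0<p 0<q = ℚₚ.positive⁻¹ _ {{ℚₚ.pos*pos⇒pos p {{ℚ.positive 0<p}} q {{ℚ.positive 0<q}}}}

  0<1 : 0ℚ < 1ℚ
  0<1 = *<* (+<+ (s≤s z≤n))

  0≤difference : ∀ {m n} → m ℕ.≤ n → 0ℚ ≤ fromNatℚ n ℚ.- fromNatℚ m
  0≤difference {m} {n} m≤n = subst (0ℚ ≤_) (sym eq) (0≤fromNatℚ (n ℕ.∸ m))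
    where
    open +-*-Solver
    eq : fromNatℚ n ℚ.- fromNatℚ m ≡ fromNatℚ (n ℕ.∸ m)
    eq = trans (cong (ℚ._- fromNatℚ m) (difference m≤n))
      (solve 2 (λ a b → (a :+ b) :- a := b) refl (fromNatℚ m) (fromNatℚ (n ℕ.∸ m)))

  0<difference : ∀ {m n} → m ℕ.< n → 0ℚ < fromNatℚ n ℚ.- fromNatℚ m
  0<difference {m} {n} m<n = subst (0ℚ <_) eq (0<+ 0<1 (0≤difference m<n))
    where
    open +-*-Solver
    eq : 1ℚ ℚ.+ (fromNatℚ n ℚ.- fromNatℚ (suc m)) ≡ fromNatℚ n ℚ.- fromNatℚ m
    eq = trans (cong (λ a → 1ℚ ℚ.+ (fromNatℚ n ℚ.- a)) (fromNatℚ-+ 1 m))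
      (solve 2 (λ a b → con 1ℚ :+ (a :- (con 1ℚ :+ b)) := a :- b) refl (fromNatℚ n) (fromNatℚ m))

  -- The comparisons of squares below are certified by a difference that is a sum of visibly
  -- non-negative terms, one of them positive.
  from-difference : ∀ {p q r} → 0ℚ < r → q ≡ p ℚ.+ r → p < q
  from-difference {p} {q} {r} 0<r eq = subst₂ _<_ (ℚₚ.+-identityʳ p) (sym eq) (ℚₚ.+-monoʳ-< p 0<r)

  to-difference : ∀ {p q} → p < q → 0ℚ < q ℚ.- p
  to-difference {p} {q} p<q = subst (_< q ℚ.- p) (ℚₚ.+-inverseʳ p) (ℚₚ.+-monoˡ-< (ℚ.- p) p<q)

  fraction : ∀ ε → 0ℚ < ε → ∃ λ m → ∃ λ d → 1 ℕ.≤ m × 1 ℕ.≤ d × fromNatℚ d ℚ.* ε ≡ fromNatℚ m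
  fraction ε@(mkℚ (+ zero) d-1 c) (*<* (+<+ ()))
  fraction ε@(mkℚ (+ suc m) d-1 c) 0<ε = suc m , suc d-1 , s≤s z≤n , s≤s z≤n ,
    ℚₚ.toℚᵘ-injective (begin
      toℚᵘ (fromNatℚ (suc d-1) ℚ.* ε)                   ≈⟨ ℚₚ.toℚᵘ-homo-* (fromNatℚ (suc d-1)) ε ⟩
      toℚᵘ (fromNatℚ (suc d-1)) ℚᵘ.* toℚᵘ ε             ≈⟨ ℚᵘₚ.*-cong (toℚᵘ-fromNatℚ (suc d-1)) ℚᵘₚ.≃-refl ⟩
      ℚᵘ.mkℚᵘ (+ suc d-1) 0 ℚᵘ.* ℚᵘ.mkℚᵘ (+ suc m) d-1  ≈⟨ ℚᵘ.*≡* (cong +_ (lemma (suc d-1) (suc m))) ⟩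
      ℚᵘ.mkℚᵘ (+ suc m) 0                               ≈⟨ toℚᵘ-fromNatℚ (suc m) ⟨
      toℚᵘ (fromNatℚ (suc m))                           ∎)
    where
    open ℚᵘₚ.≃-Reasoning
    lemma : ∀ d m → (d ℕ.* m) ℕ.* 1 ≡ m ℕ.* (1 ℕ.* d)
    lemma = ℕ-solver.solve-∀

-- Asymptotics of the number of paths

module Asymptotics where
  open ≡ using (refl; sym; trans; cong; cong₂; subst; subst₂; module ≡-Reasoning)
  open import Data.Rational.Base using (_≤_; _<_)
  open Paths using (pathSum; δ₀; total; total-rec; threshold; returns-negligible)
  open Rationals

  -- (1 + √3)ⁿ = ratPart n + irrPart n √3
  ratPart irrPart : ℕ → ℕ
  ratPart zero    = 1
  ratPart (suc n) = ratPart n ℕ.+ 3 ℕ.* irrPart n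
  irrPart zero    = 0
  irrPart (suc n) = irrPart n ℕ.+ ratPart n

  private
    recurrence : ∀ n → irrPart (2 ℕ.+ n) ≡ (irrPart (suc n) ℕ.+ irrPart (suc n)) ℕ.+ (irrPart n ℕ.+ irrPart n)
    recurrence n = lemma (ratPart n) (irrPart n)
      where
      lemma : ∀ a b → (b ℕ.+ a) ℕ.+ (a ℕ.+ 3 ℕ.* b) ≡ ((b ℕ.+ a) ℕ.+ (b ℕ.+ a)) ℕ.+ (b ℕ.+ b)
      lemma = ℕ-solver.solve-∀

  total≡irrPart : ∀ n → total n ≡ irrPart (suc n)
  total≡irrPart zero          = refl
  total≡irrPart (suc zero)    = refl
  total≡irrPart (suc (suc n)) = trans (total-rec n) (trans
    (cong₂ (λ a b → (a ℕ.+ a) ℕ.+ (b ℕ.+ b)) (total≡irrPart (suc n)) (total≡irrPart n))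
    (sym (recurrence (suc n))))

  irrPart≤ratPart : ∀ n → irrPart n ℕ.≤ ratPart n
  irrPart≤ratPart zero    = z≤n
  irrPart≤ratPart (suc n) = subst (ℕ._≤ ratPart (suc n)) (ℕₚ.+-comm (ratPart n) (irrPart n))
    (ℕₚ.+-monoʳ-≤ (ratPart n) (ℕₚ.m≤m+n (irrPart n) (2 ℕ.* irrPart n)))

  2^n≤irrPart : ∀ n → 2 ℕ.^ n ℕ.≤ irrPart (suc n)
  2^n≤irrPart zero    = s≤s z≤n
  2^n≤irrPart (suc n) = ℕₚ.+-mono-≤ (2^n≤irrPart n)
    (ℕₚ.≤-trans (ℕₚ.≤-reflexive (ℕₚ.+-identityʳ _)) (ℕₚ.≤-trans (2^n≤irrPart n) (irrPart≤ratPart (suc n))))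

  n<2^n : ∀ n → n ℕ.< 2 ℕ.^ n
  n<2^n zero    = s≤s z≤n
  n<2^n (suc n) = ℕₚ.+-mono-≤ (ℕₚ.≤-trans (s≤s z≤n) (n<2^n n))
    (ℕₚ.≤-trans (n<2^n n) (ℕₚ.≤-reflexive (sym (ℕₚ.+-identityʳ _))))

  private
    -- The norm of 1 + √3 is -2, so a² - 3 b² = (-2)ⁿ for a = ratPart n and b = irrPart n.
    norm-identity : ∀ a b → (a ℕ.+ 3 ℕ.* b) ℕ.* (a ℕ.+ 3 ℕ.* b) ℕ.+ 2 ℕ.* (a ℕ.* a)
                          ≡ 3 ℕ.* ((b ℕ.+ a) ℕ.* (b ℕ.+ a)) ℕ.+ 2 ℕ.* (3 ℕ.* (b ℕ.* b))
    norm-identity = ℕ-solver.solve-∀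

  -- The two halves of |a² - 3b²| ≤ 2ⁿ, free of the alternating sign. Since the norm -2 is negative,
  -- each half for n + 1 follows from the other half for n.
  norm-bounds : ∀ n → ratPart n ℕ.* ratPart n ℕ.≤ 3 ℕ.* (irrPart n ℕ.* irrPart n) ℕ.+ 2 ℕ.^ n
                    × 3 ℕ.* (irrPart n ℕ.* irrPart n) ℕ.≤ ratPart n ℕ.* ratPart n ℕ.+ 2 ℕ.^ n
  norm-bounds zero    = s≤s z≤n , z≤n
  norm-bounds (suc n) with norm-bounds n
  ... | (upper , lower) = ℕₚ.+-cancelʳ-≤ (2 ℕ.* (a ℕ.* a)) _ _ (begin
      a′ ℕ.* a′ ℕ.+ 2 ℕ.* (a ℕ.* a)                          ≡⟨ norm-identity a b ⟩
      3 ℕ.* (b′ ℕ.* b′) ℕ.+ 2 ℕ.* (3 ℕ.* (b ℕ.* b))          ≤⟨ ℕₚ.+-monoʳ-≤ (3 ℕ.* (b′ ℕ.* b′)) (ℕₚ.*-monoʳ-≤ 2 lower) ⟩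
      3 ℕ.* (b′ ℕ.* b′) ℕ.+ 2 ℕ.* (a ℕ.* a ℕ.+ 2 ℕ.^ n)      ≡⟨ lemma (3 ℕ.* (b′ ℕ.* b′)) (a ℕ.* a) (2 ℕ.^ n) ⟩
      3 ℕ.* (b′ ℕ.* b′) ℕ.+ 2 ℕ.^ suc n ℕ.+ 2 ℕ.* (a ℕ.* a)  ∎)
    , ℕₚ.+-cancelʳ-≤ (2 ℕ.* (3 ℕ.* (b ℕ.* b))) _ _ (begin
      3 ℕ.* (b′ ℕ.* b′) ℕ.+ 2 ℕ.* (3 ℕ.* (b ℕ.* b))          ≡⟨ norm-identity a b ⟨
      a′ ℕ.* a′ ℕ.+ 2 ℕ.* (a ℕ.* a)                          ≤⟨ ℕₚ.+-monoʳ-≤ (a′ ℕ.* a′) (ℕₚ.*-monoʳ-≤ 2 upper) ⟩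
      a′ ℕ.* a′ ℕ.+ 2 ℕ.* (3 ℕ.* (b ℕ.* b) ℕ.+ 2 ℕ.^ n)      ≡⟨ lemma (a′ ℕ.* a′) (3 ℕ.* (b ℕ.* b)) (2 ℕ.^ n) ⟩
      a′ ℕ.* a′ ℕ.+ 2 ℕ.^ suc n ℕ.+ 2 ℕ.* (3 ℕ.* (b ℕ.* b))  ∎)
    where
    open ℕₚ.≤-Reasoning
    a = ratPart n
    b = irrPart n
    a′ = ratPart (suc n)
    b′ = irrPart (suc n)
    lemma : ∀ x y p → x ℕ.+ 2 ℕ.* (y ℕ.+ p) ≡ x ℕ.+ 2 ℕ.* p ℕ.+ 2 ℕ.* y
    lemma = ℕ-solver.solve-∀

  0≤square : ∀ p → 0ℚ ≤ p ℚ.* p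
  0≤square p with ℚₚ.≤-total 0ℚ p
  ... | inj₁ 0≤p = 0≤* 0≤p 0≤p
  ... | inj₂ p≤0 = subst (0ℚ ≤_) (solve 1 (λ p → (:- p) :* (:- p) := p :* p) refl p)
                     (0≤* (ℚₚ.neg-antimono-≤ p≤0) (ℚₚ.neg-antimono-≤ p≤0))
    where open +-*-Solver

  private
    3ℚ : ℚ
    3ℚ = + 3 ℚ./ 1

    2ℚ : ℚ
    2ℚ = + 2 ℚ./ 1

  module _ {ε a b c η : ℚ} (0<ε : 0ℚ < ε) (0<a : 0ℚ < a) (0<b : 0ℚ < b) (0≤c : 0ℚ ≤ c) (0≤η : 0ℚ ≤ η)
    (lower : 0ℚ ≤ a ℚ.* a ℚ.+ η ℚ.- 3ℚ ℚ.* (b ℚ.* b))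
    (upper : 0ℚ ≤ 3ℚ ℚ.* (b ℚ.* b) ℚ.+ η ℚ.- a ℚ.* a)
    (b≤a : 0ℚ ≤ a ℚ.* a ℚ.- b ℚ.* b)
    (small-η : 0ℚ < 2ℚ ℚ.* ε ℚ.* (b ℚ.* b) ℚ.- (1ℚ ℚ.+ ε ℚ.* ε) ℚ.* η)
    (small-c : 0ℚ ≤ ε ℚ.* b ℚ.- 2ℚ ℚ.* c)
    where
    private
      0≤ε = ℚₚ.<⇒≤ 0<ε
      0≤b = ℚₚ.<⇒≤ 0<b
      0≤nat : ∀ n → 0ℚ ≤ fromNatℚ n
      0≤nat = 0≤fromNatℚ
    open +-*-Solver

    -- For y = a + b√3 and T = 2(b + c)√3 the number is (ε + 1) y - T. As a is about b√3, its
    -- rational part dominates; `small-η` and `small-c` control the errors from a² - 3b² and from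
    -- the paths ending on the axis.
    positive-below : Positive {3} (((ε ℚ.+ 1ℚ) ℚ.* a) +√ ((ε ℚ.- 1ℚ) ℚ.* b ℚ.- 2ℚ ℚ.* c))
    positive-below = inj₁ (0<* (0<+ 0<ε (ℚₚ.<⇒≤ 0<1)) 0<a , from-difference
      (0<+ small-η (0≤+ (0≤* (0≤+ (ℚₚ.<⇒≤ 0<1) (0≤* 0≤ε 0≤ε)) lower)
        (0≤+ (0≤* (0≤* (0≤nat 2) 0≤ε) b≤a)
          (0≤* (0≤nat 3) (0≤+ (0≤* (0≤* (0≤nat 2) 0≤b) small-c)
            (0≤+ (0≤* (0≤* (0≤nat 4) 0≤c) small-c) (0≤* (0≤nat 4) (0≤* 0≤c 0≤c))))))))
      (solve 5 (λ e a b c h →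
          ((e :+ con 1ℚ) :* a) :* ((e :+ con 1ℚ) :* a)
        := con 3ℚ :* (((e :- con 1ℚ) :* b :- con 2ℚ :* c) :* ((e :- con 1ℚ) :* b :- con 2ℚ :* c))
           :+ ((con 2ℚ :* e :* (b :* b) :- (con 1ℚ :+ e :* e) :* h)
           :+ ((con 1ℚ :+ e :* e) :* (a :* a :+ h :- con 3ℚ :* (b :* b))
           :+ (con 2ℚ :* e :* (a :* a :- b :* b)
           :+ con 3ℚ :* (con 2ℚ :* b :* (e :* b :- con 2ℚ :* c)
           :+ (con (fromNatℚ 4) :* c :* (e :* b :- con 2ℚ :* c) :+ con (fromNatℚ 4) :* (c :* c)))))))
        refl ε a b c η))

    -- Likewise (ε - 1) y + T, where the irrational part dominates.
    positive-above : Positive {3} (((ε ℚ.- 1ℚ) ℚ.* a) +√ ((ε ℚ.+ 1ℚ) ℚ.* b ℚ.+ 2ℚ ℚ.* c))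
    positive-above = inj₂ (0<+ (0<* (0<+ 0<ε (ℚₚ.<⇒≤ 0<1)) 0<b) (0≤* (0≤nat 2) 0≤c) , from-difference
      (0<+ small-η (0≤+ (0≤* (0≤* (0≤nat 10) 0≤ε) (0≤* 0≤b 0≤b))
        (0≤+ (0≤* (0≤* (0≤nat 2) 0≤ε) 0≤η)
          (0≤+ (0≤* (0≤square (ε ℚ.- 1ℚ)) upper)
            (0≤+ (0≤* (0≤* (0≤nat 12) (0≤+ 0≤ε (ℚₚ.<⇒≤ 0<1))) (0≤* 0≤b 0≤c)) (0≤* (0≤nat 12) (0≤* 0≤c 0≤c)))))))
      (solve 5 (λ e a b c h →
          con 3ℚ :* (((e :+ con 1ℚ) :* b :+ con 2ℚ :* c) :* ((e :+ con 1ℚ) :* b :+ con 2ℚ :* c))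
        := ((e :- con 1ℚ) :* a) :* ((e :- con 1ℚ) :* a)
           :+ ((con 2ℚ :* e :* (b :* b) :- (con 1ℚ :+ e :* e) :* h)
           :+ (con (fromNatℚ 10) :* e :* (b :* b)
           :+ (con 2ℚ :* e :* h
           :+ ((e :- con 1ℚ) :* (e :- con 1ℚ) :* (con 3ℚ :* (b :* b) :+ h :- a :* a)
           :+ (con (fromNatℚ 12) :* (e :+ con 1ℚ) :* (b :* c) :+ con (fromNatℚ 12) :* (c :* c))))))
        ) refl ε a b c η))

  open RingOps (ℚ√-rawRing 3)

  private
    λ⁺ λ⁻ : ℚ√ 3
    λ⁺ = 1ℚ +√ 1ℚ
    -- The inverse (√3 - 1) / 2 of λ⁺.
    λ⁻ = (ℚ.- ½) +√ ½

  private
    ≤⇒≯ : ∀ {p q} → p ≤ q → ¬ (q < p)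
    ≤⇒≯ p≤q q<p = ℚₚ.<-irrefl refl (ℚₚ.≤-<-trans p≤q q<p)

  -- The product is (3q - p)/2 + ((p - q)/2)√3. The norm of `λ⁻` is -1/2, so the dominating part
  -- changes and each alternative of `Positive` is sent to the other one.
  λ⁻-positive : ∀ x → Positive {3} x → Positive {3} (x * λ⁻)
  λ⁻-positive (p +√ q) (inj₁ (0<p , 3q²<p²)) with p ℚₚ.≤? q
  ... | yes p≤q = contradiction 3q²<p² (≤⇒≯ (ℚₚ.≤-trans
          (ℚₚ.≤-trans (ℚₚ.*-monoˡ-≤-nonNeg p {{ℚ.nonNegative (ℚₚ.<⇒≤ 0<p)}} p≤q)
                      (ℚₚ.*-monoʳ-≤-nonNeg q {{ℚ.nonNegative (ℚₚ.≤-trans (ℚₚ.<⇒≤ 0<p) p≤q)}} p≤q))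
          (subst₂ _≤_ (ℚₚ.+-identityʳ (q ℚ.* q))
            (solve 1 (λ q → q :* q :+ con 2ℚ :* (q :* q) := con 3ℚ :* (q :* q)) refl q)
            (ℚₚ.+-monoʳ-≤ (q ℚ.* q) (0≤* (0≤fromNatℚ 2) (0≤square q))))))
    where open +-*-Solver
  ... | no p≰q = inj₂
          ( subst (0ℚ <_) (solve 2 (λ p q → con ½ :* (p :- q) := p :* con ½ :+ q :* (:- con ½)) refl p q)
              (0<* (ℚₚ.positive⁻¹ ½) (to-difference (ℚₚ.≰⇒> p≰q)))
          , from-difference (0<* (ℚₚ.positive⁻¹ ½) (to-difference 3q²<p²))
              (solve 2 (λ p q →
                  con 3ℚ :* ((p :* con ½ :+ q :* (:- con ½)) :* (p :* con ½ :+ q :* (:- con ½)))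
                := (p :* (:- con ½) :+ con 3ℚ :* (q :* con ½)) :* (p :* (:- con ½) :+ con 3ℚ :* (q :* con ½))
                   :+ con ½ :* (p :* p :- con 3ℚ :* (q :* q))) refl p q) )
    where open +-*-Solver
  λ⁻-positive (p +√ q) (inj₂ (0<q , p²<3q²)) with 3ℚ ℚ.* q ℚₚ.≤? p
  ... | yes 3q≤p = contradiction p²<3q² (≤⇒≯ (ℚₚ.≤-trans
          (subst₂ _≤_ (ℚₚ.+-identityʳ (3ℚ ℚ.* (q ℚ.* q)))
            (solve 1 (λ q → con 3ℚ :* (q :* q) :+ con (fromNatℚ 6) :* (q :* q) := (con 3ℚ :* q) :* (con 3ℚ :* q)) refl q)
            (ℚₚ.+-monoʳ-≤ (3ℚ ℚ.* (q ℚ.* q)) (0≤* (0≤fromNatℚ 6) (0≤square q))))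
          (ℚₚ.≤-trans (ℚₚ.*-monoˡ-≤-nonNeg (3ℚ ℚ.* q) {{ℚ.nonNegative 0≤3q}} 3q≤p)
                      (ℚₚ.*-monoʳ-≤-nonNeg p {{ℚ.nonNegative (ℚₚ.≤-trans 0≤3q 3q≤p)}} 3q≤p))))
    where
    open +-*-Solver
    0≤3q = 0≤* (0≤fromNatℚ 3) (ℚₚ.<⇒≤ 0<q)
  ... | no 3q≰p = inj₁
          ( subst (0ℚ <_) (solve 2 (λ p q → con ½ :* (con 3ℚ :* q :- p) := p :* (:- con ½) :+ con 3ℚ :* (q :* con ½)) refl p q)
              (0<* (ℚₚ.positive⁻¹ ½) (to-difference (ℚₚ.≰⇒> 3q≰p)))
          , from-difference (0<* (ℚₚ.positive⁻¹ ½) (to-difference p²<3q²))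
              (solve 2 (λ p q →
                  (p :* (:- con ½) :+ con 3ℚ :* (q :* con ½)) :* (p :* (:- con ½) :+ con 3ℚ :* (q :* con ½))
                := con 3ℚ :* ((p :* con ½ :+ q :* (:- con ½)) :* (p :* con ½ :+ q :* (:- con ½)))
                   :+ con ½ :* (con 3ℚ :* (q :* q) :- p :* p)) refl p q) )
    where open +-*-Solver

  private
    module F = CommutativeRing (QuadraticField.commutativeRing 3)

  λ⁻-positive^ : ∀ n x → Positive {3} x → Positive {3} (x * λ⁻ ^ n)
  λ⁻-positive^ zero    x 0<x = subst Positive (sym (F.*-identityʳ x)) 0<x
  λ⁻-positive^ (suc n) x 0<x = subst Positive (F.*-assoc x λ⁻ (λ⁻ ^ n)) (λ⁻-positive^ n (x * λ⁻) (λ⁻-positive x 0<x))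

  λ^ : ∀ n → λ⁺ ^ n ≡ fromNatℚ (ratPart n) +√ fromNatℚ (irrPart n)
  λ^ zero    = refl
  λ^ (suc n) = trans (cong (λ⁺ *_) (λ^ n)) (cong₂ _+√_
    (trans (solve 2 (λ a b → con 1ℚ :* a :+ con 3ℚ :* (con 1ℚ :* b) := a :+ con 3ℚ :* b) refl (fromNatℚ (ratPart n)) (fromNatℚ (irrPart n)))
      (sym (trans (fromNatℚ-+ (ratPart n) (3 ℕ.* irrPart n)) (cong (fromNatℚ (ratPart n) ℚ.+_) (fromNatℚ-* 3 (irrPart n))))))
    (trans (solve 2 (λ a b → con 1ℚ :* b :+ con 1ℚ :* a := b :+ a) refl (fromNatℚ (ratPart n)) (fromNatℚ (irrPart n)))
      (sym (fromNatℚ-+ (irrPart n) (ratPart n)))))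
    where open +-*-Solver

  λ^λ⁻^ : ∀ n → λ⁺ ^ n * λ⁻ ^ n ≡ 1#
  λ^λ⁻^ zero    = refl
  λ^λ⁻^ (suc n) = trans (interchange λ⁺ (λ⁺ ^ n) λ⁻ (λ⁻ ^ n)) (cong (1# *_) (λ^λ⁻^ n))
    where open import Algebra.Properties.CommutativeSemigroup F.*-commutativeSemigroup using (interchange)

  module _ (t : ℕ → ℕ) (2t : ∀ n → t n ℕ.+ t n ≡ total n ℕ.+ pathSum n δ₀) where

    module _ {ε : ℚ} (0<ε : 0ℚ < ε) {m d : ℕ} (1≤m : 1 ℕ.≤ m) (1≤d : 1 ℕ.≤ d) (dε≡m : fromNatℚ d ℚ.* ε ≡ fromNatℚ m)
      {n : ℕ} (n≥ : threshold (2 ℕ.* d) ℕ.≤ n) (d+m≤n : d ℕ.+ m ℕ.≤ n) where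
      private
        aₙ = ratPart (suc n)
        bₙ = irrPart (suc n)
        cₙ = pathSum n δ₀
        ηₙ = 2 ℕ.^ suc n
        a = fromNatℚ aₙ
        b = fromNatℚ bₙ
        c = fromNatℚ cₙ
        η = fromNatℚ ηₙ
        D = fromNatℚ d
        0≤ε = ℚₚ.<⇒≤ 0<ε
        open +-*-Solver

        0<nat : ∀ {k} → 1 ℕ.≤ k → 0ℚ < fromNatℚ k
        0<nat {k} 1≤k = subst (0ℚ <_) (ℚₚ.+-identityʳ (fromNatℚ k)) (0<difference 1≤k)

        1≤b : 1 ℕ.≤ bₙ
        1≤b = ℕₚ.≤-trans (ℕₚ.≤-trans (s≤s z≤n) (n<2^n n)) (2^n≤irrPart n)

        nat-3b² : fromNatℚ (3 ℕ.* (bₙ ℕ.* bₙ)) ≡ 3ℚ ℚ.* (b ℚ.* b)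
        nat-3b² = trans (fromNatℚ-* 3 (bₙ ℕ.* bₙ)) (cong (3ℚ ℚ.*_) (fromNatℚ-* bₙ bₙ))

        lower : 0ℚ ≤ a ℚ.* a ℚ.+ η ℚ.- 3ℚ ℚ.* (b ℚ.* b)
        lower = subst₂ (λ x y → 0ℚ ≤ x ℚ.- y)
          (trans (fromNatℚ-+ (aₙ ℕ.* aₙ) ηₙ) (cong (ℚ._+ η) (fromNatℚ-* aₙ aₙ))) nat-3b²
          (0≤difference (proj₂ (norm-bounds (suc n))))

        upper : 0ℚ ≤ 3ℚ ℚ.* (b ℚ.* b) ℚ.+ η ℚ.- a ℚ.* a
        upper = subst₂ (λ x y → 0ℚ ≤ x ℚ.- y)
          (trans (fromNatℚ-+ (3 ℕ.* (bₙ ℕ.* bₙ)) ηₙ) (cong (ℚ._+ η) nat-3b²)) (fromNatℚ-* aₙ aₙ)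
          (0≤difference (proj₁ (norm-bounds (suc n))))

        b≤a : 0ℚ ≤ a ℚ.* a ℚ.- b ℚ.* b
        b≤a = subst₂ (λ x y → 0ℚ ≤ x ℚ.- y) (fromNatℚ-* aₙ aₙ) (fromNatℚ-* bₙ bₙ)
          (0≤difference (ℕₚ.*-mono-≤ (irrPart≤ratPart (suc n)) (irrPart≤ratPart (suc n))))

        1≤Dε : 0ℚ ≤ D ℚ.* ε ℚ.- 1ℚ
        1≤Dε = subst (λ x → 0ℚ ≤ x ℚ.- 1ℚ) (sym dε≡m) (0≤difference 1≤m)

        -- From b ≥ 2ⁿ and d + m ≤ n < 2ⁿ. Multiplied by ε it yields `small-η`, because ε(d + m) =
        -- dε + dε² is at least 1 + ε².
        η-bound : (d ℕ.+ m) ℕ.* ηₙ ℕ.< 2 ℕ.* (bₙ ℕ.* bₙ)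
        η-bound = begin-strict
          (d ℕ.+ m) ℕ.* (2 ℕ.* 2 ℕ.^ n)       ≡⟨ lemma (d ℕ.+ m) (2 ℕ.^ n) ⟩
          2 ℕ.* ((d ℕ.+ m) ℕ.* 2 ℕ.^ n)
            <⟨ ℕₚ.*-monoʳ-< 2 (ℕₚ.*-monoˡ-< (2 ℕ.^ n) {{ℕₚ.m^n≢0 2 n}} (ℕₚ.≤-<-trans d+m≤n (n<2^n n))) ⟩
          2 ℕ.* (2 ℕ.^ n ℕ.* 2 ℕ.^ n)         ≤⟨ ℕₚ.*-monoʳ-≤ 2 (ℕₚ.*-mono-≤ (2^n≤irrPart n) (2^n≤irrPart n)) ⟩
          2 ℕ.* (bₙ ℕ.* bₙ)                   ∎
          where
          open ℕₚ.≤-Reasoning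
          lemma : ∀ k p → k ℕ.* (2 ℕ.* p) ≡ 2 ℕ.* (k ℕ.* p)
          lemma = ℕ-solver.solve-∀

        small-η : 0ℚ < 2ℚ ℚ.* ε ℚ.* (b ℚ.* b) ℚ.- (1ℚ ℚ.+ ε ℚ.* ε) ℚ.* η
        small-η = subst (0ℚ <_)
          (solve 4 (λ e b h D →
              e :* (con 2ℚ :* (b :* b) :- (D :+ D :* e) :* h)
                :+ (h :* (D :* e :- con 1ℚ) :+ (h :* e) :* (e :* (D :- con 1ℚ)))
            := con 2ℚ :* e :* (b :* b) :- (con 1ℚ :+ e :* e) :* h) refl ε b η D)
          (0<+ (0<* 0<ε (subst₂ (λ x y → 0ℚ < x ℚ.- y)
              (trans (fromNatℚ-* 2 (bₙ ℕ.* bₙ)) (cong (2ℚ ℚ.*_) (fromNatℚ-* bₙ bₙ)))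
              (trans (fromNatℚ-* (d ℕ.+ m) ηₙ) (cong (ℚ._* η) (trans (fromNatℚ-+ d m) (cong (D ℚ.+_) (sym dε≡m)))))
              (0<difference η-bound)))
            (0≤+ (0≤* (0≤fromNatℚ ηₙ) 1≤Dε) (0≤* (0≤* (0≤fromNatℚ ηₙ) 0≤ε) (0≤* 0≤ε (0≤difference 1≤d)))))

        -- `returns-negligible` with r = 2d gives 2dc ≤ b, and 1/d ≤ ε.
        small-c : 0ℚ ≤ ε ℚ.* b ℚ.- 2ℚ ℚ.* c
        small-c = subst (0ℚ ≤_)
          (solve 4 (λ e b c D →
              e :* (b :- c :* (con 2ℚ :* D)) :+ (con 2ℚ :* c) :* (D :* e :- con 1ℚ)
            := e :* b :- con 2ℚ :* c) refl ε b c D)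
          (0≤+ (0≤* 0≤ε (subst (λ y → 0ℚ ≤ b ℚ.- y)
              (trans (fromNatℚ-* cₙ (2 ℕ.* d)) (cong (c ℚ.*_) (fromNatℚ-* 2 d)))
              (0≤difference (subst (cₙ ℕ.* (2 ℕ.* d) ℕ.≤_) (total≡irrPart n) (returns-negligible (2 ℕ.* d) n n≥)))))
            (0≤* (0≤* (0≤fromNatℚ 2) (0≤fromNatℚ cₙ)) 1≤Dε))

        0<a = 0<nat (ℕₚ.≤-trans 1≤b (irrPart≤ratPart (suc n)))

        y v κ T quotient₀ : ℚ√ 3
        y = λ⁺ ^ suc n
        v = λ⁻ ^ suc n
        κ = 0ℚ +√ (+ 1 ℚ./ 12)
        -- 1/κ = 4√3 and b + c = 2tₙ, so T is tₙ/κ; times the inverse v of y it is the quotient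
        -- tₙ/(κy).
        T = 0ℚ +√ (2ℚ ℚ.* (b ℚ.+ c))
        quotient₀ = T * v

        b+c : b ℚ.+ c ≡ fromNatℚ (t n) ℚ.+ fromNatℚ (t n)
        b+c = trans (sym (fromNatℚ-+ bₙ cₙ)) (trans
          (cong fromNatℚ (trans (cong (ℕ._+ cₙ) (sym (total≡irrPart n))) (sym (2t n))))
          (fromNatℚ-+ (t n) (t n)))

        Tκ : T * κ ≡ fromℕ (t n)
        Tκ = trans (cong (λ x → (0ℚ +√ (2ℚ ℚ.* x)) * κ) b+c) (cong₂ _+√_
          (solve 1 (λ t → con 0ℚ :* con 0ℚ :+ con 3ℚ :* (con 2ℚ :* (t :+ t) :* con (+ 1 ℚ./ 12)) := t) refl (fromNatℚ (t n)))
          (solve 1 (λ t → con 0ℚ :* con (+ 1 ℚ./ 12) :+ con 2ℚ :* (t :+ t) :* con 0ℚ := con 0ℚ) refl (fromNatℚ (t n))))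

        κy≢0 : κ * y ≢ 0#
        -- 4√3 inverts κ and v inverts y.
        κy≢0 eq = contradiction (trans (sym 1≡) (trans (cong (λ x → (0ℚ +√ (fromNatℚ 4)) * (x * v)) eq) 0≡)) λ ()
          where
          0≡ : (0ℚ +√ (fromNatℚ 4)) * (0# * v) ≡ 0#
          0≡ = trans (cong ((0ℚ +√ (fromNatℚ 4)) *_) (F.zeroˡ v)) (F.zeroʳ (0ℚ +√ (fromNatℚ 4)))
          1≡ : (0ℚ +√ (fromNatℚ 4)) * ((κ * y) * v) ≡ 1#
          1≡ = trans (cong ((0ℚ +√ (fromNatℚ 4)) *_) (trans (F.*-assoc κ y v) (cong (κ *_) (λ^λ⁻^ (suc n))))) refl

        quotient-correct : quotient₀ * (κ * y) ≡ fromℕ (t n)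
        quotient-correct = begin
          (T * v) * (κ * y)     ≡⟨ interchange T v κ y ⟩
          (T * κ) * (v * y)     ≡⟨ cong ((T * κ) *_) (trans (F.*-comm v y) (λ^λ⁻^ (suc n))) ⟩
          (T * κ) * 1#          ≡⟨ F.*-identityʳ (T * κ) ⟩
          T * κ                 ≡⟨ Tκ ⟩
          fromℕ (t n)           ∎
          where
          open ≡-Reasoning
          open import Algebra.Properties.CommutativeSemigroup F.*-commutativeSemigroup using (interchange)

        module FS = IntegerSolver (QuadraticField.commutativeRing 3)
        open Cancellation (QuadraticField.commutativeRing 3)

        below : fromℚ ε - (quotient₀ - 1#) ≡ (((ε ℚ.+ 1ℚ) ℚ.* a) +√ ((ε ℚ.- 1ℚ) ℚ.* b ℚ.- 2ℚ ℚ.* c)) * v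
        below = trans
          ((- (fromℚ ε + 1#)) modulo FS.solve 4 (λ E T y v →
            E FS.:- (T FS.:* v FS.:- FS.con (+ 1))
            FS.:= ((E FS.:+ FS.con (+ 1)) FS.:* y FS.:- T) FS.:* v
                  FS.:+ (FS.:- (E FS.:+ FS.con (+ 1))) FS.:* (y FS.:* v FS.:- FS.con (+ 1)))
            refl (fromℚ ε) T y v by λ^λ⁻^ (suc n))
          (cong (_* v) (trans (cong (λ x → (fromℚ ε + 1#) * x - T) (λ^ (suc n))) (cong₂ _+√_
            (solve 3 (λ e a b → (e :+ con 1ℚ) :* a :+ con 3ℚ :* ((con 0ℚ :+ con 0ℚ) :* b) :+ (:- con 0ℚ) := (e :+ con 1ℚ) :* a) refl ε a b)
            (solve 4 (λ e a b c → (e :+ con 1ℚ) :* b :+ (con 0ℚ :+ con 0ℚ) :* a :- con 2ℚ :* (b :+ c) := (e :- con 1ℚ) :* b :- con 2ℚ :* c) refl ε a b c))))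

        above : fromℚ ε + (quotient₀ - 1#) ≡ (((ε ℚ.- 1ℚ) ℚ.* a) +√ ((ε ℚ.+ 1ℚ) ℚ.* b ℚ.+ 2ℚ ℚ.* c)) * v
        above = trans
          ((- (fromℚ ε - 1#)) modulo FS.solve 4 (λ E T y v →
            E FS.:+ (T FS.:* v FS.:- FS.con (+ 1))
            FS.:= ((E FS.:- FS.con (+ 1)) FS.:* y FS.:+ T) FS.:* v
                  FS.:+ (FS.:- (E FS.:- FS.con (+ 1))) FS.:* (y FS.:* v FS.:- FS.con (+ 1)))
            refl (fromℚ ε) T y v by λ^λ⁻^ (suc n))
          (cong (_* v) (trans (cong (λ x → (fromℚ ε - 1#) * x + T) (λ^ (suc n))) (cong₂ _+√_
            (solve 3 (λ e a b → (e :- con 1ℚ) :* a :+ con 3ℚ :* ((con 0ℚ :- con 0ℚ) :* b) :+ con 0ℚ := (e :- con 1ℚ) :* a) refl ε a b)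
            (solve 4 (λ e a b c → (e :- con 1ℚ) :* b :+ (con 0ℚ :- con 0ℚ) :* a :+ con 2ℚ :* (b :+ c) := (e :+ con 1ℚ) :* b :+ con 2ℚ :* c) refl ε a b c))))

      quotient-close : ∃ λ q → (q ≐ fromℕ (t n) ÷ κ * y) × Positive (fromℚ ε - (q - 1#)) × Positive (fromℚ ε + (q - 1#))
      quotient-close = quotient₀ , (κy≢0 , quotient-correct)
        , subst Positive (sym below) (λ⁻-positive^ (suc n) _
            (positive-below 0<ε 0<a (0<nat 1≤b) (0≤fromNatℚ cₙ) (0≤fromNatℚ ηₙ) lower upper b≤a small-η small-c))
        , subst Positive (sym above) (λ⁻-positive^ (suc n) _
            (positive-above 0<ε 0<a (0<nat 1≤b) (0≤fromNatℚ cₙ) (0≤fromNatℚ ηₙ) lower upper b≤a small-η small-c))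

    asymptotics : (λ n → fromℕ (t n)) ∼ (λ n → (0ℚ +√ (+ 1 ℚ./ 12)) * (1ℚ +√ 1ℚ) ^ suc n)
    asymptotics ε 0<ε with fraction ε 0<ε
    ... | (m , d , 1≤m , 1≤d , dε≡m) = threshold (2 ℕ.* d) ℕ.⊔ (d ℕ.+ m) , λ n n₀≤n →
      quotient-close 0<ε 1≤m 1≤d dε≡m
        (ℕₚ.≤-trans (ℕₚ.m≤m⊔n (threshold (2 ℕ.* d)) (d ℕ.+ m)) n₀≤n)
        (ℕₚ.≤-trans (ℕₚ.m≤n⊔m (threshold (2 ℕ.* d)) (d ℕ.+ m)) n₀≤n)

-- Generating functions of the weighted counts

ℚ√2 : CommutativeRing 0ℓ 0ℓ
ℚ√2 = QuadraticField.commutativeRing 2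

module GeneratingFunction {R : CommutativeRing 0ℓ 0ℓ} (E : Embedding ℚ√2 R) where
  private
    module K = CommutativeRing ℚ√2
    module P = PowerSeries ℚ√2
  open P using (_◂_; pointwise)
  open Embedding E
  open Integrality E
  open CommutativeRing R
  open IntegerSolver R using (solve; _:=_; _:+_; _:*_; _:-_; :-_; con)
  open Cancellation R
  open Paths
  open Rationals using (fromNatℚ-+)

  interleaveZeros-cong : ∀ {a b} → (∀ n → a n ≡ b n) → ∀ m → interleaveZeros a m ≡ interleaveZeros b m
  interleaveZeros-cong eq zero          = ≡.cong fromℕ (eq 0)
  interleaveZeros-cong eq (suc zero)    = ≡.refl
  interleaveZeros-cong eq (suc (suc m)) = interleaveZeros-cong (λ n → eq (suc n)) m

  interleaveZeros-+ : ∀ a b m →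
    interleaveZeros (λ n → a n ℕ.+ b n) m ≡ interleaveZeros a m K.+ interleaveZeros b m
  interleaveZeros-+ a b zero          = ≡.cong (_+√ 0ℚ) (fromNatℚ-+ (a 0) (b 0))
  interleaveZeros-+ a b (suc zero)    = ≡.refl
  interleaveZeros-+ a b (suc (suc m)) = interleaveZeros-+ (λ n → a (suc n)) (λ n → b (suc n)) m

  series : (ℕ → ℕ) → Carrier
  series a = ι (interleaveZeros a)

  series-cong : ∀ {a b} → (∀ n → a n ≡ b n) → series a ≈ series b
  series-cong eq = ι-cong (pointwise (interleaveZeros-cong eq))

  series-+ : ∀ a b → series (λ n → a n ℕ.+ b n) ≈ series a + series b
  series-+ a b = trans (ι-cong (pointwise (interleaveZeros-+ a b))) (ι-+ (interleaveZeros a) (interleaveZeros b))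

  count : (ℤ → ℕ) → Carrier
  count f = series λ n → pathSum n f

  count-cong : ∀ {f g} → (∀ x → f x ≡ g x) → count f ≈ count g
  count-cong eq = series-cong λ n → pathSum-cong n eq

  count-+ : ∀ f g → count (λ x → f x ℕ.+ g x) ≈ count f + count g
  count-+ f g = trans (series-cong λ n → pathSum-+ n f g) (series-+ (λ n → pathSum n f) (λ n → pathSum n g))

  count-even : ∀ k → count (δ (ℤ.- k)) ≈ count (δ k)
  count-even k = series-cong λ n → pathSum-δ-even n k

  const : ℕ → Carrier
  const n = constant (fromℕ n)

  const-0 : const 0 ≈ 0#
  const-0 = ι-0#

  const-1 : const 1 ≈ 1#
  const-1 = ι-1#

  module Recurrences {z : Carrier} (z≈ : z ≈ w * w) where

    series-suc : ∀ a → series a ≈ const (a 0) + z * series (λ n → a (suc n))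
    series-suc a = trans (ι-cong (pointwise λ { zero → ≡.refl ; (suc zero) → ≡.refl ; (suc (suc m)) → ≡.refl }))
      (trans (ι-◂ (fromℕ (a 0)) (K.0# ◂ b))
        (+-congˡ (trans (*-congˡ (ι-0◂ b)) (trans (sym (*-assoc w w (ι b))) (*-congʳ (sym z≈))))))
      where b = interleaveZeros (λ n → a (suc n))

    -- The recursion of `pathSum` starts at size 2, so the sizes 0 and 1 are split off first; the
    -- term of size 1 then serves as the constant term of the series with weight `spread (+ 2) f`.
    count-recurrence : ∀ f →
      count f ≈ const (f 0ℤ) + z * count (spread (+ 2) f) + z * z * count (spread (+ 1) f)
    count-recurrence f = trans (series-suc (λ n → pathSum n f)) (trans
      (+-congˡ (*-congˡ (trans (series-suc (λ n → pathSum (suc n) f)) (+-congˡ (*-congˡ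
        (series-+ (λ n → pathSum (suc n) (spread (+ 2) f)) (λ n → pathSum n (spread (+ 1) f))))))))
      (trans (solve 5 (λ c z a b d → c :+ z :* (a :+ z :* (b :+ d)) := c :+ z :* (a :+ z :* b) :+ z :* z :* d)
        refl (const (f 0ℤ)) z (const (spread (+ 2) f 0ℤ))
          (series (λ n → pathSum (suc n) (spread (+ 2) f))) (count (spread (+ 1) f)))
      (+-congʳ (+-congˡ (*-congˡ (sym (series-suc (λ n → pathSum n (spread (+ 2) f)))))))))

    count-spread-δ : ∀ s k {i j} → k ℤ.- s ≡ i → k ℤ.+ s ≡ j → count (spread s (δ k)) ≈ count (δ i) + count (δ j)
    count-spread-δ s k ≡.refl ≡.refl = trans (count-cong (spread-δ s k)) (count-+ (δ (k ℤ.- s)) (δ (k ℤ.+ s)))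

    g : ℕ → Carrier
    g k = count (δ (+ k))

    private
      recurrence : ∀ k {a b p q c} → const (δ k 0ℤ) ≈ c → count (spread (+ 2) (δ k)) ≈ a + b → count (spread (+ 1) (δ k)) ≈ p + q →
                   count (δ k) ≈ c + z * (a + b) + z * z * (p + q)
      recurrence k eq eq₂ eq₁ = trans (count-recurrence (δ k)) (+-cong (+-cong eq (*-congˡ eq₂)) (*-congˡ eq₁))

      drop-0 : ∀ {x a b} → x ≈ 0# + a + b → x ≈ a + b
      drop-0 eq = trans eq (+-congʳ (+-identityˡ _))

    g-recurrence₀ : g 0 ≈ 1# + z * (g 2 + g 2) + z * z * (g 1 + g 1)
    g-recurrence₀ = recurrence (+ 0) const-1
      (trans (count-spread-δ (+ 2) (+ 0) {j = + 2} ≡.refl ≡.refl) (+-congʳ (count-even (+ 2))))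
      (trans (count-spread-δ (+ 1) (+ 0) {j = + 1} ≡.refl ≡.refl) (+-congʳ (count-even (+ 1))))

    g-recurrence₁ : g 1 ≈ z * (g 1 + g 3) + z * z * (g 0 + g 2)
    g-recurrence₁ = drop-0 (recurrence (+ 1) const-0
      (trans (count-spread-δ (+ 2) (+ 1) ≡.refl ≡.refl) (+-congʳ (count-even (+ 1))))
      (count-spread-δ (+ 1) (+ 1) ≡.refl ≡.refl))

    g-recurrence : ∀ k → g (2 ℕ.+ k) ≈ z * (g k + g (4 ℕ.+ k)) + z * z * (g (1 ℕ.+ k) + g (3 ℕ.+ k))
    g-recurrence k = drop-0 (recurrence (+ (2 ℕ.+ k)) const-0
      (count-spread-δ (+ 2) (+ (2 ℕ.+ k)) ≡.refl (≡.cong +_ (ℕₚ.+-comm (2 ℕ.+ k) 2)))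
      (count-spread-δ (+ 1) (+ (2 ℕ.+ k)) ≡.refl (≡.cong +_ (ℕₚ.+-comm (2 ℕ.+ k) 1))))

    -- `spread s one` is by definition twice `one`, so the recurrence closes up at the constant
    -- weight.
    all-paths : count one * (1# - (1# + 1#) * z - (1# + 1#) * (z * z)) ≈ 1#
    all-paths = 1# modulo solve 2 (λ z a → a :* (con (+ 1) :- con (+ 2) :* z :- con (+ 2) :* (z :* z))
        := con (+ 1) :+ con (+ 1) :* (a :- (con (+ 1) :+ z :* (a :+ a) :+ z :* z :* (a :+ a))))
      refl z (count one) by
      trans (count-recurrence one) (+-cong (+-cong const-1 (*-congˡ (count-+ one one))) (*-congˡ (count-+ one one)))

    twice-nonneg-series : count nonneg + count nonneg ≈ count one + g 0
    twice-nonneg-series = trans (sym (series-+ (λ n → pathSum n nonneg) (λ n → pathSum n nonneg)))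
      (trans (series-cong twice-nonneg) (trans (series-+ (λ n → pathSum n one) (λ n → pathSum n δ₀))
        (+-congˡ (count-cong λ x → ≡.cong δ₀ (≡.sym (ℤₚ.+-identityʳ x))))))

-- The closed form from power series for the radicals

module Solution {R : CommutativeRing 0ℓ 0ℓ} (E : Embedding ℚ√2 R) where
  open RingOps (CommutativeRing.rawRing R)
  open CommutativeRing R using (refl; sym; trans; *-cong; +-cong; *-congˡ; *-congʳ; +-congʳ; -‿cong; zeroʳ; zeroˡ)
  open Embedding E using (w; w⁻¹; w*w⁻¹)
  open Integrality E
  open Cancellation R
  open Paths using (nonneg)
  open IntegerSolver R using (solve; _:=_; _:+_; _:*_; _:-_; :-_; con)
  private
    infixl 6 _⊕_
    infixl 7 _⊛_
    _⊕_ : ∀ {x y} → Int x → Int y → Int (x + y)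
    _⊕_ = O-+ 0
    _⊛_ : ∀ {x y} → Int x → Int y → Int (x * y)
    _⊛_ = O-* 0 0

  invertible⇒≉0 : ¬ (1# ≈ 0#) → ∀ {x y} → x * y ≈ 1# → x ≉ 0#
  invertible⇒≉0 1≉0 {x} {y} xy x≈0 = 1≉0 (trans (sym xy) (trans (*-congʳ x≈0) (zeroˡ y)))

  module Parameters {½ : Carrier} (½½ : ½ + ½ ≈ 1#) (int-½ : Int ½)
    {z z⁻¹ c₀ c₁ c₂ : Carrier} (z≈ : z ≈ w * w) (z⁻¹≈ : z⁻¹ ≈ w⁻¹ * w⁻¹)
    (int-c₀ : Int c₀) (int-c₁ : Int c₁) (int-c₂ : Int c₂) where
    -- All three radicands begin with 1/z = w⁻², so w times each root is a power series 1 + wc. The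
    -- hypotheses of `Squares` are the radicands multiplied by w².
    y₀ y₁ y₂ x √x₁ √x₂ : Carrier
    y₀ = 1# + w * c₀
    y₁ = 1# + w * c₁
    y₂ = 1# + w * c₂
    x = w⁻¹ * y₀
    √x₁ = w⁻¹ * y₁
    √x₂ = w⁻¹ * y₂

    w⁵ : Carrier
    w⁵ = w * (w * w) * (w * w)

    zz⁻¹ : z * z⁻¹ ≈ 1#
    zz⁻¹ = trans (*-cong z≈ z⁻¹≈) ((w * w⁻¹ + 1#) modulo
      solve 2 (λ w v → w :* w :* (v :* v) := con (+ 1) :+ (w :* v :+ con (+ 1)) :* (w :* v :- con (+ 1))) refl w w⁻¹ by w*w⁻¹)

    module Squares
      (y₀² : y₀ * y₀ ≈ 1# + w * ((1# + 1#) * w + ½ * ½ * w⁵))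
      (y₁² : y₁ * y₁ ≈ 1# + w * (- ((1# + 1#) * w) - w * w * y₀ + ½ * w⁵))
      (y₂² : y₂ * y₂ ≈ 1# + w * (- ((1# + 1#) * w) + w * w * y₀ + ½ * w⁵))
      where

      xx : x * x ≈ z⁻¹ + (1# + 1#) + ½ * ½ * (z * z)
      xx = trans ((((1# + 1#) + ½ * ½ * (w * w * (w * w))) * (w * w⁻¹ + 1#)) modulo (w⁻¹ * w⁻¹ modulo
        solve 4 (λ w v h y → (v :* y) :* (v :* y)
          := (v :* v :+ con (+ 2) :+ h :* h :* ((w :* w) :* (w :* w))
             :+ ((con (+ 2) :+ h :* h :* (w :* w :* (w :* w))) :* (w :* v :+ con (+ 1))) :* (w :* v :- con (+ 1)))
             :+ (v :* v) :* (y :* y :- (con (+ 1) :+ w :* (con (+ 2) :* w :+ h :* h :* (w :* (w :* w) :* (w :* w))))))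
          refl w w⁻¹ ½ y₀ by y₀²) by w*w⁻¹)
        (sym (+-cong (+-congʳ z⁻¹≈) (*-congˡ (*-cong z≈ z≈))))

      xx₁ : √x₁ * √x₁ ≈ z⁻¹ - (1# + 1#) - z * x + ½ * (z * z)
      xx₁ = trans ((((½ * (w * w * (w * w))) - (1# + 1#)) * (w * w⁻¹ + 1#) - w * y₀ * (w * w⁻¹)) modulo (w⁻¹ * w⁻¹ modulo
        solve 5 (λ w v h y₀ y → (v :* y) :* (v :* y)
          := (v :* v :- con (+ 2) :- (w :* w) :* (v :* y₀) :+ h :* ((w :* w) :* (w :* w))
             :+ ((h :* (w :* w :* (w :* w)) :- con (+ 2)) :* (w :* v :+ con (+ 1)) :- w :* y₀ :* (w :* v)) :* (w :* v :- con (+ 1)))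
             :+ (v :* v) :* (y :* y :- (con (+ 1) :+ w :* (:- (con (+ 2) :* w) :- w :* w :* y₀ :+ h :* (w :* (w :* w) :* (w :* w))))))
          refl w w⁻¹ ½ y₀ y₁ by y₁²) by w*w⁻¹)
        (sym (+-cong (+-cong (+-congʳ z⁻¹≈) (-‿cong (*-congʳ z≈))) (*-congˡ (*-cong z≈ z≈))))

      xx₂ : √x₂ * √x₂ ≈ z⁻¹ - (1# + 1#) + z * x + ½ * (z * z)
      xx₂ = trans ((((½ * (w * w * (w * w))) - (1# + 1#)) * (w * w⁻¹ + 1#) + w * y₀ * (w * w⁻¹)) modulo (w⁻¹ * w⁻¹ modulo
        solve 5 (λ w v h y₀ y → (v :* y) :* (v :* y)
          := (v :* v :- con (+ 2) :+ (w :* w) :* (v :* y₀) :+ h :* ((w :* w) :* (w :* w))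
             :+ ((h :* (w :* w :* (w :* w)) :- con (+ 2)) :* (w :* v :+ con (+ 1)) :+ w :* y₀ :* (w :* v)) :* (w :* v :- con (+ 1)))
             :+ (v :* v) :* (y :* y :- (con (+ 1) :+ w :* (:- (con (+ 2) :* w) :+ w :* w :* y₀ :+ h :* (w :* (w :* w) :* (w :* w))))))
          refl w w⁻¹ ½ y₀ y₂ by y₂²) by w*w⁻¹)
        (sym (+-cong (+-cong (+-congʳ z⁻¹≈) (*-congʳ z≈)) (*-congˡ (*-cong z≈ z≈))))

      module Branches {√2 : Carrier} (√2√2 : √2 * √2 ≈ 1# + 1#) where
        private
          module GF = GeneratingFunction E
          open GF using (count)
          open GF.Recurrences z≈ using (g; g-recurrence₀; g-recurrence₁; g-recurrence; all-paths; twice-nonneg-series)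
        open RootFormulas.Roots R zz⁻¹ ½½ √2√2 xx xx₁ xx₂ public
        private
          int-z : Int z
          int-z = O-resp 0 (sym z≈) (Int-w ⊛ Int-w)

          k₁ : Carrier
          k₁ = ½ * (c₀ + c₁) - ½ * ½ * z

          int-k₁ : Int k₁
          int-k₁ = int-½ ⊛ (int-c₀ ⊕ int-c₁) ⊕ O-neg 0 (int-½ ⊛ int-½ ⊛ int-z)

          wu₁≈ : w * u₁ ≈ 1# + w * k₁
          wu₁≈ = 1# modulo ((½ * (y₀ + y₁)) modulo
            solve 6 (λ w v h z a b →
                w :* (h :* (v :* (con (+ 1) :+ w :* a) :+ v :* (con (+ 1) :+ w :* b)) :- h :* h :* z)
              := (con (+ 1) :+ w :* (h :* (a :+ b) :- h :* h :* z) :+ con (+ 1) :* (h :+ h :- con (+ 1)))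
                 :+ (h :* (con (+ 1) :+ w :* a :+ (con (+ 1) :+ w :* b))) :* (w :* v :- con (+ 1)))
              refl w w⁻¹ ½ z c₀ c₁ by w*w⁻¹) by ½½

          int-wu₁ : Int (w * u₁)
          int-wu₁ = O-resp 0 (sym wu₁≈) (Int-1# ⊕ Int-w ⊛ int-k₁)

          int-wu₂ : Int (w * u₂)
          int-wu₂ = O-resp 0 (sym ((- 1#) modulo ((- (½ * (y₀ + y₂))) modulo
            solve 6 (λ w v h z a b →
                w :* (:- (h :* (v :* (con (+ 1) :+ w :* a) :+ v :* (con (+ 1) :+ w :* b))) :- h :* h :* z)
              := (:- con (+ 1) :+ w :* (:- (h :* (a :+ b)) :+ :- (h :* h :* z)) :+ (:- con (+ 1)) :* (h :+ h :- con (+ 1)))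
                 :+ (:- (h :* (con (+ 1) :+ w :* a :+ (con (+ 1) :+ w :* b)))) :* (w :* v :- con (+ 1)))
              refl w w⁻¹ ½ z c₀ c₂ by w*w⁻¹) by ½½))
            (O-neg 0 Int-1# ⊕ Int-w ⊛ (O-neg 0 (int-½ ⊛ (int-c₀ ⊕ int-c₂)) ⊕ O-neg 0 (int-½ ⊛ int-½ ⊛ int-z)))

          -- The poles of x and `√x₁` cancel in v₁, whereas they add up in u₁.
          int-v₁ : Int v₁
          int-v₁ = O-resp 0 (sym ((½ * (c₀ - c₁)) modulo
            solve 6 (λ w v h z a b →
                h :* (v :* (con (+ 1) :+ w :* a) :- v :* (con (+ 1) :+ w :* b)) :- h :* h :* z
              := (h :* (a :- b) :+ :- (h :* h :* z)) :+ (h :* (a :- b)) :* (w :* v :- con (+ 1)))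
              refl w w⁻¹ ½ z c₀ c₁ by w*w⁻¹))
            (int-½ ⊛ (int-c₀ ⊕ O-neg 0 int-c₁) ⊕ O-neg 0 (int-½ ⊛ int-½ ⊛ int-z))

          int-v₂ : Int v₂
          int-v₂ = O-resp 0 (sym ((- (½ * (c₀ - c₂))) modulo
            solve 6 (λ w v h z a b →
                :- (h :* (v :* (con (+ 1) :+ w :* a) :- v :* (con (+ 1) :+ w :* b))) :- h :* h :* z
              := (:- (h :* (a :- b)) :+ :- (h :* h :* z)) :+ (:- (h :* (a :- b))) :* (w :* v :- con (+ 1)))
              refl w w⁻¹ ½ z c₀ c₂ by w*w⁻¹))
            (O-neg 0 (int-½ ⊛ (int-c₀ ⊕ O-neg 0 int-c₂)) ⊕ O-neg 0 (int-½ ⊛ int-½ ⊛ int-z))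

          module SF = KernelAlgebra.SymmetricFunctions R zz⁻¹ u₁v₁ u₂v₂ roots-sum traces-product

          -- A rearrangement of (1 + wk₁) v₁ = w that exhibits the factor w of v₁, which makes 1 +
          -- v₁v₂ a unit.
          v₁≈ : v₁ ≈ w * (1# - k₁ * v₁)
          v₁≈ = w modulo ((- v₁) modulo
            solve 4 (λ w u v k → v := (w :* (con (+ 1) :- k :* v) :+ w :* (u :* v :- con (+ 1)))
                :+ (:- v) :* (w :* u :- (con (+ 1) :+ w :* k)))
              refl w u₁ v₁ k₁ by wu₁≈) by u₁v₁

          unit-1+π̄ = unit ((Int-1# ⊕ O-neg 0 (int-k₁ ⊛ int-v₁)) ⊛ int-v₂)

          -- This is 1/(1 + π) in the form π̄/(1 + π̄), which has no pole.
          ρ : Carrier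
          ρ = v₁ * v₂ * proj₁ unit-1+π̄

          [1+π]ρ : (1# + u₁ * u₂) * ρ ≈ 1#
          [1+π]ρ = 1# modulo ((v₂ * proj₁ unit-1+π̄) modulo (proj₁ unit-1+π̄ modulo
            solve 6 (λ p q v₂ w k y →
                (con (+ 1) :+ p) :* (q :* v₂ :* y)
              := ((con (+ 1) :+ con (+ 1) :* ((con (+ 1) :+ w :* (k :* v₂)) :* y :- con (+ 1)))
                 :+ (v₂ :* y) :* (q :- w :* k))
                 :+ y :* (p :* (q :* v₂) :- con (+ 1)))
              refl (u₁ * u₂) v₁ v₂ w (1# - k₁ * v₁) (proj₁ unit-1+π̄)
            by SF.ππ̄) by v₁≈) by proj₂ unit-1+π̄

          g₀den : g 0 * SF.den ≈ 1# + u₁ * u₂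
          g₀den = KernelMethod.Kernel.kernel-method E z≈ zz⁻¹ u₁v₁ u₂v₂ roots-sum traces-product
            int-wu₁ int-wu₂ int-v₁ int-v₂ g (λ k → ι-Int _)
            g-recurrence₀ g-recurrence₁ g-recurrence

          module HP = SF.HalfPlane [1+π]ρ g₀den all-paths

        h₀ c h₁ : Carrier
        h₀ = g 0
        c = HP.c
        h₁ = c * h₀

        module Nontrivial (1≉0 : ¬ (1# ≈ 0#)) where

          u₁⁻¹-quotient : v₁ ≐ 1# ÷ u₁
          u₁⁻¹-quotient = invertible⇒≉0 1≉0 u₁v₁ , trans (CommutativeRing.*-comm R v₁ u₁) u₁v₁

          u₂⁻¹-quotient : v₂ ≐ 1# ÷ u₂
          u₂⁻¹-quotient = invertible⇒≉0 1≉0 u₂v₂ , trans (CommutativeRing.*-comm R v₂ u₂) u₂v₂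

          1+π≉0 : 1# + u₁ * u₂ ≉ 0#
          1+π≉0 = invertible⇒≉0 1≉0 [1+π]ρ

          h₀-quotient : h₀ ≐ 1# + u₁ * u₂
            ÷ 1# + u₁ * u₂ - 2 · z ^ 2 * (u₁ + u₂) - 2 · z
              + 2 · z * (1# - u₁ ^ 2 - u₂ ^ 2) * v₁ * v₂
          -- A vanishing denominator would make g₀ den = 1 + π vanish, which is a unit.
          h₀-quotient = (λ den≈0 → 1+π≉0 (trans (sym g₀den) (trans (*-congˡ den≈0) (zeroʳ h₀)))) , g₀den

          c-quotient : c ≐ u₁ + u₂ ÷ 1# + u₁ * u₂
          c-quotient = 1+π≉0
            , HP.c[1+π]

          counted-quotient : count nonneg ≐ h₀ * u₁ * u₂ - h₁ ÷ (1# - u₁) * (1# - u₂)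
          counted-quotient =
            invertible⇒≉0 1≉0 HP.Q-inverse
            , HP.halved ½½ twice-nonneg-series

-- T stands for the generating function of the paths of non-negative altitude.
record Solved (X : RawRing 0ℓ 0ℓ) (z z⁻¹ ⟨4z⟩⁻¹ ⟨2√2⟩⁻¹ T : RawRing.Carrier X)
              (LeadingPositive : RawRing.Carrier X → Set) : Set where
  open RingOps X
  field
    s r₁ r₂ u₁ u₂ u₁⁻¹ u₂⁻¹ h₀ c h₁ : Carrier
    s-positive  : LeadingPositive s
    r₁-positive : LeadingPositive r₁
    r₂-positive : LeadingPositive r₂
    s-square    : s * s ≈ z ^ 4 + 8 · z ^ 2 + 4 · z
    r₁-square   : r₁ * r₁ ≈ (z ^ 3 - z * s - 4 · z + 2 · 1#) * z⁻¹
    r₂-square   : r₂ * r₂ ≈ (z ^ 3 + z * s - 4 · z + 2 · 1#) * z⁻¹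
    u₁-formula  : u₁ ≈ (- (z ^ 2) + s) * ⟨4z⟩⁻¹ + ⟨2√2⟩⁻¹ * r₁
    u₂-formula  : u₂ ≈ (- (z ^ 2) - s) * ⟨4z⟩⁻¹ - ⟨2√2⟩⁻¹ * r₂
    u₁⁻¹-quotient : u₁⁻¹ ≐ 1# ÷ u₁
    u₂⁻¹-quotient : u₂⁻¹ ≐ 1# ÷ u₂
    h₀-quotient : h₀ ≐ 1# + u₁ * u₂
                    ÷ 1# + u₁ * u₂ - 2 · z ^ 2 * (u₁ + u₂) - 2 · z
                      + 2 · z * (1# - u₁ ^ 2 - u₂ ^ 2) * u₁⁻¹ * u₂⁻¹
    c-quotient  : c ≐ u₁ + u₂ ÷ 1# + u₁ * u₂
    h₁-formula  : h₁ ≈ c * h₀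
    T-quotient  : T ≐ h₀ * u₁ * u₂ - h₁ ÷ (1# - u₁) * (1# - u₂)

-- All data on which `Solved` depends, bundled so that one equation between bundles transports it at
-- once.
record SeriesRing : Set₁ where
  constructor seriesRing
  field
    X                       : RawRing 0ℓ 0ℓ
    z z⁻¹ ⟨4z⟩⁻¹ ⟨2√2⟩⁻¹ T : RawRing.Carrier X
    LeadingPositive         : RawRing.Carrier X → Set

-- The operations of the two rings are definitionally equal, but comparing composite
-- terms built from them is expensive; comparing the rings themselves is cheap.
transfer : ∀ {X z z⁻¹ ⟨4z⟩⁻¹ ⟨2√2⟩⁻¹ T P X′ z′ z⁻¹′ ⟨4z⟩⁻¹′ ⟨2√2⟩⁻¹′ T′ P′} →
  seriesRing X z z⁻¹ ⟨4z⟩⁻¹ ⟨2√2⟩⁻¹ T P ≡ seriesRing X′ z′ z⁻¹′ ⟨4z⟩⁻¹′ ⟨2√2⟩⁻¹′ T′ P′ →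
  Solved X z z⁻¹ ⟨4z⟩⁻¹ ⟨2√2⟩⁻¹ T P → Solved X′ z′ z⁻¹′ ⟨4z⟩⁻¹′ ⟨2√2⟩⁻¹′ T′ P′
transfer ≡.refl solved = solved

-- Construction of the square roots

module Existence {R : CommutativeRing 0ℓ 0ℓ} (E : Embedding ℚ√2 R)
  (over : PowerSeries.PowerSeries ℚ√2 → CommutativeRing.Carrier R)
  (over≈ : ∀ a → CommutativeRing._≈_ R (over a) (CommutativeRing._*_ R (Embedding.w⁻¹ E) (Embedding.ι E a)))
  where
  private
    module K = CommutativeRing ℚ√2
    module P = PowerSeries ℚ√2
  open P using (_◂_)
  open Laurent K.rawRing using (single)
  open RingOps (CommutativeRing.rawRing R)
  open CommutativeRing R using (refl; sym; trans; +-cong; *-congˡ; *-congʳ; +-congˡ)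
  open Embedding E
  open Integrality E
  open Cancellation R
  open Paths using (nonneg)
  open IntegerSolver R using (solve; _:=_; _:+_; _:*_; _:-_; :-_; con)

  √2ₖ : K.Carrier
  √2ₖ = 0ℚ +√ 1ℚ

  -- For a series c with coefficients a these encode s = 2w(1 + wc) and, after division by w, r = √2
  -- w⁻¹(1 + wc). Spelling out the leading coefficients lets `LeadingPositive` be checked by
  -- evaluation.
  S-coeffs r-coeffs : P.PowerSeries → P.PowerSeries
  S-coeffs a = K.0# ◂ (K.1# K.+ K.1#) ◂ (a P.+ a)
  r-coeffs a = √2ₖ ◂ (single √2ₖ P.* a)

  h √2 : Carrier
  h  = constant (fromℚ ½)
  √2 = constant √2ₖ

  private
    h+h≈1 : h + h ≈ 1#
    h+h≈1 = half+half (fromℚ ½) ≡.refl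

    √2√2 : √2 * √2 ≈ 1# + 1#
    √2√2 = trans (sym (constant-* √2ₖ √2ₖ)) (trans (constant-+ K.1# K.1#) (+-cong ι-1# ι-1#))

    S≈ : ∀ {a c} → c ≈ ι a → ι (S-coeffs a) ≈ (1# + 1#) * w * (1# + w * c)
    S≈ {a} {c} c≈ = trans (ι-0◂ _) (trans
      (*-congˡ (trans (ι-◂ (K.1# K.+ K.1#) (a P.+ a)) (+-cong
        (trans (constant-+ K.1# K.1#) (+-cong ι-1# ι-1#))
        (*-congˡ (trans (ι-+ a a) (+-cong (sym c≈) (sym c≈)))))))
      (solve 2 (λ w c → w :* (con (+ 2) :+ w :* (c :+ c)) := con (+ 2) :* w :* (con (+ 1) :+ w :* c)) refl w c))

    r≈ : ∀ {a c} → c ≈ ι a → over (r-coeffs a) ≈ √2 * (w⁻¹ * (1# + w * c))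
    r≈ {a} {c} c≈ = trans (over≈ (r-coeffs a)) (trans
      (*-congˡ (trans (ι-◂ √2ₖ (single √2ₖ P.* a))
        (+-congˡ (*-congˡ (trans (ι-* (single √2ₖ) a) (*-congˡ (sym c≈)))))))
      (solve 4 (λ w v q c → v :* (q :+ w :* (q :* c)) := q :* (v :* (con (+ 1) :+ w :* c))) refl w w⁻¹ √2 c))

  module _ {z z⁻¹ ⟨4z⟩⁻¹ ⟨2√2⟩⁻¹ : Carrier} (z≈ : z ≈ w * w) (z⁻¹≈ : z⁻¹ ≈ w⁻¹ * w⁻¹)
    (4z≈ : ⟨4z⟩⁻¹ ≈ h * h * z⁻¹) (2√2≈ : ⟨2√2⟩⁻¹ ≈ h * h * √2) where

    solution : ∀ {T LeadingPositive} → T ≈ GeneratingFunction.count E nonneg →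
      (∀ a → LeadingPositive (ι (S-coeffs a))) → (∀ a → LeadingPositive (over (r-coeffs a))) →
      Solved (CommutativeRing.rawRing R) z z⁻¹ ⟨4z⟩⁻¹ ⟨2√2⟩⁻¹ T LeadingPositive
    solution T≈ S-positive r-positive = record
      { s = ι (S-coeffs A₀) ; r₁ = over (r-coeffs A₁) ; r₂ = over (r-coeffs A₂)
      ; u₁ = Sol.u₁ ; u₂ = Sol.u₂ ; u₁⁻¹ = Sol.v₁ ; u₂⁻¹ = Sol.v₂ ; h₀ = Sol.h₀ ; c = Sol.c ; h₁ = Sol.h₁
      ; s-positive = S-positive A₀ ; r₁-positive = r-positive A₁ ; r₂-positive = r-positive A₂
      ; s-square = RF.s-square ; r₁-square = RF.r₁-square ; r₂-square = RF.r₂-square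
      ; u₁-formula = RF.u₁-formula ; u₂-formula = RF.u₂-formula
      ; u₁⁻¹-quotient = Non.u₁⁻¹-quotient ; u₂⁻¹-quotient = Non.u₂⁻¹-quotient
      ; h₀-quotient = Non.h₀-quotient ; c-quotient = Non.c-quotient ; h₁-formula = refl
      ; T-quotient = let (Q≉0 , eq) = Non.counted-quotient in Q≉0 , trans (*-congʳ T≈) eq }
      where
      1≉0# : ¬ (1# ≈ 0#)
      1≉0# = 1≉0 λ ()

      int-h : Int h
      int-h = ι-Int (single (fromℚ ½))

      infixl 6 _⊕_
      infixl 7 _⊛_
      _⊕_ : ∀ {x y} → Int x → Int y → Int (x + y)
      _⊕_ = O-+ 0
      _⊛_ : ∀ {x y} → Int x → Int y → Int (x * y)
      _⊛_ = O-* 0 0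

      w⁵ : Carrier
      w⁵ = w * (w * w) * (w * w)

      int-w⁵ : Int w⁵
      int-w⁵ = Int-w ⊛ (Int-w ⊛ Int-w) ⊛ (Int-w ⊛ Int-w)

      -- This root comes first because the radicands of the other two contain y₀.
      sqrt₀ = sqrt (fromℚ ½) ≡.refl ((Int-1# ⊕ Int-1#) ⊛ Int-w ⊕ int-h ⊛ int-h ⊛ int-w⁵)
      c₀ = proj₁ sqrt₀
      int-c₀ = proj₁ (proj₂ sqrt₀)
      int-y₀ = Int-1# ⊕ Int-w ⊛ int-c₀

      sqrt₁ = sqrt (fromℚ ½) ≡.refl
        (O-neg 0 ((Int-1# ⊕ Int-1#) ⊛ Int-w) ⊕ O-neg 0 (Int-w ⊛ Int-w ⊛ int-y₀) ⊕ int-h ⊛ int-w⁵)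
      c₁ = proj₁ sqrt₁
      int-c₁ = proj₁ (proj₂ sqrt₁)

      sqrt₂ = sqrt (fromℚ ½) ≡.refl
        (O-neg 0 ((Int-1# ⊕ Int-1#) ⊛ Int-w) ⊕ Int-w ⊛ Int-w ⊛ int-y₀ ⊕ int-h ⊛ int-w⁵)
      c₂ = proj₁ sqrt₂
      int-c₂ = proj₁ (proj₂ sqrt₂)

      A₀ = proj₁ (Int⇒ι int-c₀)
      A₁ = proj₁ (Int⇒ι int-c₁)
      A₂ = proj₁ (Int⇒ι int-c₂)

      module Par = Solution.Parameters E h+h≈1 int-h z≈ z⁻¹≈ int-c₀ int-c₁ int-c₂
      module Sq = Par.Squares (proj₂ (proj₂ sqrt₀)) (proj₂ (proj₂ sqrt₁)) (proj₂ (proj₂ sqrt₂))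
      module Sol = Sq.Branches √2√2
      module Non = Sol.Nontrivial 1≉0#

      s≈2zx : ι (S-coeffs A₀) ≈ (1# + 1#) * (z * (w⁻¹ * (1# + w * c₀)))
      s≈2zx = trans (S≈ (proj₂ (Int⇒ι int-c₀))) (sym (trans (*-congˡ (*-congʳ z≈))
        (((1# + 1#) * (w * (1# + w * c₀))) modulo
          solve 3 (λ w v y → con (+ 2) :* (w :* w :* (v :* y)) := con (+ 2) :* w :* y :+ (con (+ 2) :* (w :* y)) :* (w :* v :- con (+ 1)))
            refl w w⁻¹ (1# + w * c₀) by w*w⁻¹)))

      module RF = Sol.Formulas s≈2zx (r≈ (proj₂ (Int⇒ι int-c₁))) (r≈ (proj₂ (Int⇒ι int-c₂))) 4z≈ 2√2≈

-- The theorem for the concrete Laurent series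

open import Defs

private
  open Paths using (nonneg; nonNegativePaths; twice-nonneg)
  open Asymptotics using (asymptotics)
  module LE = LaurentEmbedding ℚ√2
  module K = CommutativeRing ℚ√2
  module L = CommutativeRing (LaurentSeries.commutativeRing ℚ√2)
  module EX = Existence LE.embedding (mk 1) (LE.mk≈ 0)
  module IE = Integrality LE.embedding

  z≈ : z L.≈ LE.w L.* LE.w
  z≈ = LE.monomial⁺-+ 1 1

  z⁻¹≈ : z⁻¹ L.≈ LE.w⁻¹ L.* LE.w⁻¹
  z⁻¹≈ = LE.monomial⁻-+ 0 0

  4z≈ : ⟨4z⟩⁻¹ L.≈ EX.h L.* EX.h L.* z⁻¹
  4z≈ = L.trans (LE.monomial-scale⁻ (fromℚ (+ 1 / 4)) 1)
    (L.*-congʳ {z⁻¹} {IE.constant (fromℚ (+ 1 / 4))} {EX.h L.* EX.h} (IE.constant-* (fromℚ ½) (fromℚ ½)))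

  2√2≈ : ⟨2√2⟩⁻¹ L.≈ EX.h L.* EX.h L.* EX.√2
  2√2≈ = L.trans (IE.constant-* (fromℚ (+ 1 / 4)) EX.√2ₖ)
    (L.*-congʳ {EX.√2} {IE.constant (fromℚ (+ 1 / 4))} {EX.h L.* EX.h} (IE.constant-* (fromℚ ½) (fromℚ ½)))

  2-positive : Positive {2} (fromℚ 1ℚ K.+ fromℚ 1ℚ)
  2-positive = inj₁ (from-yes (0ℚ ℚₚ.<? 1ℚ ℚ.+ 1ℚ) ,
    from-yes ((+ 2 / 1) ℚ.* ((0ℚ ℚ.+ 0ℚ) ℚ.* (0ℚ ℚ.+ 0ℚ)) ℚₚ.<? (1ℚ ℚ.+ 1ℚ) ℚ.* (1ℚ ℚ.+ 1ℚ)))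

  √2-positive : Positive EX.√2ₖ
  √2-positive = inj₂ (from-yes (0ℚ ℚₚ.<? 1ℚ) , from-yes (0ℚ ℚ.* 0ℚ ℚₚ.<? (+ 2 / 1) ℚ.* (1ℚ ℚ.* 1ℚ)))

  series-positive : ∀ a → LeadingPositive (LE.ι (EX.S-coeffs a))
  -- s starts with 2w, hence the index 1; the other two roots start at w⁻¹, which is index 0 under a
  -- pole of order 1.
  series-positive a = 1 , 2-positive , λ { zero _ → ≡.refl ; (suc _) (s≤s ()) }

  root-positive : ∀ a → LeadingPositive (mk 1 (EX.r-coeffs a))
  root-positive a = 0 , √2-positive , λ _ ()

  module GF = GeneratingFunction LE.embedding

  counted : ∀ t → (∀ n → Fin (t n) ↔ NonNegativePath n) → generatingFunction t L.≈ GF.count nonneg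
  counted t paths = GF.series-cong (nonNegativePaths t paths)

  solved : ∀ t → (∀ n → Fin (t n) ↔ NonNegativePath n) →
           Solved series-rawRing z z⁻¹ ⟨4z⟩⁻¹ ⟨2√2⟩⁻¹ (generatingFunction t) LeadingPositive
  solved t paths = transfer ≡.refl (EX.solution z≈ z⁻¹≈ 4z≈ 2√2≈ (counted t paths) series-positive root-positive)

corollary2p2 : (t : ℕ → ℕ) → (∀ n → Fin (t n) ↔ NonNegativePath n) →
    (let open SeriesOps in
    ∃ λ s → ∃ λ r₁ → ∃ λ r₂ → ∃ λ u₁ → ∃ λ u₂ → ∃ λ u₁⁻¹ → ∃ λ u₂⁻¹ →
    ∃ λ h₀ → ∃ λ c → ∃ λ h₁ →
    IsPrincipalSqrt s (z ^ 4 + 8 · z ^ 2 + 4 · z)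
    × IsPrincipalSqrt r₁ ((z ^ 3 - z * s - 4 · z + 2 · 1#) * z⁻¹)
    × IsPrincipalSqrt r₂ ((z ^ 3 + z * s - 4 · z + 2 · 1#) * z⁻¹)
    × (u₁ ≈ (- (z ^ 2) + s) * ⟨4z⟩⁻¹ + ⟨2√2⟩⁻¹ * r₁)
    × (u₂ ≈ (- (z ^ 2) - s) * ⟨4z⟩⁻¹ - ⟨2√2⟩⁻¹ * r₂)
    × (u₁⁻¹ ≐ 1# ÷ u₁)
    × (u₂⁻¹ ≐ 1# ÷ u₂)
    × (h₀ ≐ 1# + u₁ * u₂
    ÷ 1# + u₁ * u₂ - 2 · z ^ 2 * (u₁ + u₂) - 2 · z
    + 2 · z * (1# - u₁ ^ 2 - u₂ ^ 2) * u₁⁻¹ * u₂⁻¹)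
    × (c ≐ u₁ + u₂ ÷ 1# + u₁ * u₂)
    × (h₁ ≈ c * h₀)
    × (generatingFunction t ≐ h₀ * u₁ * u₂ - h₁ ÷ (1# - u₁) * (1# - u₂)))
    ×
    (let open RingOps (ℚ√-rawRing 3) in
    (λ n → fromℕ (t n)) ∼ (λ n → (0ℚ +√ (+ 1 / 12)) * (1ℚ +√ 1ℚ) ^ suc n))
corollary2p2 t paths =
    ( s , r₁ , r₂ , u₁ , u₂ , u₁⁻¹ , u₂⁻¹ , h₀ , c , h₁
    , record { square = s-square ; positive = s-positive }
    , record { square = r₁-square ; positive = r₁-positive }
    , record { square = r₂-square ; positive = r₂-positive }
    , u₁-formula , u₂-formula , u₁⁻¹-quotient , u₂⁻¹-quotient
    , h₀-quotient , c-quotient , h₁-formula , T-quotient )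
  , asymptotics t λ n →
      ≡.trans (≡.cong₂ ℕ._+_ (nonNegativePaths t paths n) (nonNegativePaths t paths n)) (twice-nonneg n)
  where open Solved (solved t paths)
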